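{- $\mathrm{CaRet}+\{\mathcal{C},\mathcal{R}\}=\mathrm{FO}$ over both finite nested words and nested $\omega$-words: every formula $\phi$ of $\mathrm{CaRet}+\{\mathcal{C},\mathcal{R}\}$ has a first-order formula $\phi'(x)$ with $(\bar w,i)\models\phi$ iff $\bar w\models\phi'(i)$ for all nested words $\bar w$ and positions $i$, and every first-order formula $\psi(x)$ with one free variable has a $\mathrm{CaRet}+\{\mathcal{C},\mathcal{R}\}$ formula $\psi'$ with $\bar w\models\psi(i)$ iff $(\bar w,i)\models\psi'$.
   Context: Let $\Sigma$ be a finite alphabet. A matching on $\mathbb{N}$ or on $[1,n]$ is a binary relation $\mu$ with unary relations $\mathit{call},\mathit{ret}$ such that: (1) $\mu(i,j)$ implies $\mathit{call}(i)$, $\mathit{ret}(j)$, $i<j$; (2) if $\mu(i,j),\mu(i,j')$ then $j=j'$, and if $\mu(i,j),\mu(i',j)$ then $i=i'$; (3) if $i\le j$, $\mathit{call}(i)$, $\mathit{ret}(j)$ then some $k\in[i,j]$ has $\mu(i,k)$ or $\mu(k,j)$. A finite nested word is $\bar w=(w,\mu,\mathit{call},\mathit{ret})$ with $w\in\Sigma^*$ of length $n$ and a matching on $[1,n]$; a nested $\omega$-word has $w\in\Sigma^\omega$ and a matching on $\mathbb{N}$; viewed as structures $\langle U,(P_a)_{a\in\Sigma},<,\mu,\mathit{call},\mathit{ret}\rangle$ for FO. If $\mu(i,j)$, $i$ is a matched call, $j$ a matched return, $r(i)=j$; a return without match is pending. $\mathcal{C}(i)$ is the greatest matched call $j<i$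 with $r(j)>i$, and $\mathcal{R}(i)$ the least matched return $l>i$ whose matching call is $<i$ (when they exist). $\bar w[i,j]$ is the substructure induced by positions $i,\dots,j$ ($\bar w[i,\infty]$: positions $\ge i$). Paths $i=i_0<\dots<i_k=j$: linear if $i_{p+1}=i_p+1$; call if $i_p=\mathcal{C}(i_{p+1})$ for all $p$; abstract if for all $p<k$, $i_{p+1}=r(i_p)$ when $i_p$ is a matched call, and $i_{p+1}=i_p+1$ when $i_p$ is not a call and $i_p+1$ is not a matched return (no other steps). Until along a path notion: $\phi\,\mathbf{U}\psi$ at $i$ iff there is $j\ge i$ and such a path from $i$ to $j$ with $\psi$ at $j$ and $\phi$ at every earlier path position; since: there is $j\le i$ and such a path from $j$ to $i$ with $\psi$ at $j$ and $\phi$ at every later path position. $\mathrm{CaRet}$ formulas: $\top$, $a$ for $a\in\Sigma\cup\{\mathit{pret}\}$ ($\mathit{pret}$ true exactly at pending returns), $\mathit{call}$, $\mathit{ret}$, closed under $\neg$, $\vee$, $\bigcirc$ (truth at $i+1$), $\bigcirc_\mu$ (truth at $r(i)$, $i$ a matched call), $\ominus_c$ ($\ominus_c\phi$ holds at $i$ iff $\mathcal{C}(i)$ is defined and $\phi$ holds at $\mathcal{C}(i)$), linear until $\mathbf{U}$, abstract until $\mathbf{U}^a$, and call since $\mathbf{S}^c$. $\mathrm{CaRet}+\{\mathcal{C},\mathcal{R}\}$ adds the past operator $\ominus$ ($\phi$ at $i-1$, $i>1$) and: $(\bar w,i)\models\mathcal{C}\phi$ iff $(\bar w[j,i],j)\models\phi$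 where $j=\mathcal{C}(i)$ if defined and $j=1$ otherwise; $(\bar w,i)\models\mathcal{R}\phi$ iff $(\bar w[i,j],i)\models\phi$ where $j=\mathcal{R}(i)$ if defined, and otherwise $j=|\bar w|$ if $\bar w$ is finite and $j=\infty$ if infinite. -}

module Defs where

open import Data.Nat using (ℕ; zero; suc; _≤_; _<_)
open import Data.Fin using (Fin)
open import Data.Product using (Σ; _×_; _,_)
open import Data.Sum using (_⊎_)
open import Data.Unit using (⊤)
open import Data.Empty using (⊥)
open import Data.Vec.Functional using (Vector; _∷_)
open import Relation.Nullary using (¬_)
open import Relation.Binary.PropositionalEquality using (_≡_)

-- Structures over the alphabet Σ = Fin k.
-- Positions are natural numbers; the universe of a structure is the
-- interval [lo, hi] (hi = inf means unbounded).  All relations are given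
-- on ℕ but only their restriction to the universe is ever used, so
-- the induced substructure w̄[a,b] is obtained by just changing lo/hi.

data Bound : Set where
  fin : ℕ → Bound
  inf : Bound

_≤B_ : ℕ → Bound → Set
i ≤B fin n = i ≤ n
i ≤B inf   = ⊤

record Str (k : ℕ) : Set₁ where
  field
    lo    : ℕ
    hi    : Bound
    lab   : ℕ → Fin k
    callP : ℕ → Set
    retP  : ℕ → Set
    mu    : ℕ → ℕ → Set
open Str public

Dom : ∀ {k} → Str k → ℕ → Set
Dom s i = lo s ≤ i × i ≤B hi s

sub : ∀ {k} → Str k → ℕ → Bound → Str k
sub s a b = record s { lo = a ; hi = b }

record IsMatching {k} (s : Str k) : Set where
  field
    m-call-ret : ∀ i j → Dom s i → Dom s j → mu s i j → callP s i × retP s j × i < j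
    m-fun  : ∀ i j j' → Dom s i → Dom s j → Dom s j' → mu s i j → mu s i j' → j ≡ j'
    m-inj  : ∀ i i' j → Dom s i → Dom s i' → Dom s j → mu s i j → mu s i' j → i ≡ i'
    m-nest : ∀ i j → Dom s i → Dom s j → i ≤ j → callP s i → retP s j →
             Σ ℕ (λ l → i ≤ l × l ≤ j × (mu s i l ⊎ mu s l j))

record NestedWord (k : ℕ) : Set₁ where
  field
    str      : Str k
    lo≡1     : lo str ≡ 1
    shape    : Σ ℕ (λ n → hi str ≡ fin n) ⊎ hi str ≡ inf
    matching : IsMatching str
open NestedWord public

M : ∀ {k} → Str k → ℕ → ℕ → Set
M s i j = Dom s i × Dom s j × mu s i j

MatchedRet : ∀ {k} → Str k → ℕ → Set
MatchedRet s j = Σ ℕ (λ i → M s i j)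

Pending : ∀ {k} → Str k → ℕ → Set
Pending s j = Dom s j × retP s j × ¬ MatchedRet s j

IsC : ∀ {k} → Str k → ℕ → ℕ → Set
IsC s i j = Dom s j × j < i × Σ ℕ (λ l → M s j l × i < l) ×
  (∀ j' l' → j < j' → j' < i → M s j' l' → i < l' → ⊥)

IsR : ∀ {k} → Str k → ℕ → ℕ → Set
IsR s i l = Dom s l × i < l × Σ ℕ (λ j → M s j l × j < i) ×
  (∀ l' j' → i < l' → l' < l → M s j' l' → j' < i → ⊥)

LinStep : ∀ {k} → Str k → ℕ → ℕ → Set
LinStep s i j = j ≡ suc i × Dom s j

CallStep : ∀ {k} → Str k → ℕ → ℕ → Set
CallStep s i j = IsC s j i

AbsStep : ∀ {k} → Str k → ℕ → ℕ → Set
AbsStep s i j = M s i j ⊎ (¬ callP s i × ¬ MatchedRet s (suc i) × j ≡ suc i × Dom s j)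

data Until (R : ℕ → ℕ → Set) (P Q : ℕ → Set) : ℕ → Set where
  here  : ∀ {i} → Q i → Until R P Q i
  there : ∀ {i j} → P i → R i j → Until R P Q j → Until R P Q i

data Since (R : ℕ → ℕ → Set) (P Q : ℕ → Set) : ℕ → Set where
  here  : ∀ {i} → Q i → Since R P Q i
  there : ∀ {i j} → P i → R j i → Since R P Q j → Since R P Q i

data CaRet (k : ℕ) : Set where
  top  : CaRet k
  lett : Fin k → CaRet k
  pret : CaRet k
  call : CaRet k
  ret  : CaRet k
  neg  : CaRet k → CaRet k
  _or_ : CaRet k → CaRet k → CaRet k
  next : CaRet k → CaRet k
  nextμ : CaRet k → CaRet k
  prevC : CaRet k → CaRet k
  _U_  : CaRet k → CaRet k → CaRet k
  _Ua_ : CaRet k → CaRet k → CaRet k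
  _Sc_ : CaRet k → CaRet k → CaRet k
  prev : CaRet k → CaRet k
  Cop  : CaRet k → CaRet k
  Rop  : CaRet k → CaRet k

Sat : ∀ {k} → Str k → CaRet k → ℕ → Set
Sat s top i = ⊤
Sat s (lett a) i = lab s i ≡ a
Sat s pret i = Pending s i
Sat s call i = callP s i
Sat s ret i = retP s i
Sat s (neg φ) i = ¬ Sat s φ i
Sat s (φ or ψ) i = Sat s φ i ⊎ Sat s ψ i
Sat s (next φ) i = Dom s (suc i) × Sat s φ (suc i)
Sat s (nextμ φ) i = Σ ℕ (λ j → M s i j × Sat s φ j)
Sat s (prevC φ) i = Σ ℕ (λ j → IsC s i j × Sat s φ j)
Sat s (φ U ψ) i = Until (LinStep s) (Sat s φ) (Sat s ψ) i
Sat s (φ Ua ψ) i = Until (AbsStep s) (Sat s φ) (Sat s ψ) i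
Sat s (φ Sc ψ) i = Since (CallStep s) (Sat s φ) (Sat s ψ) i
Sat s (prev φ) i = Σ ℕ (λ j → suc j ≡ i × Dom s j × Sat s φ j)
Sat s (Cop φ) i =
  Σ ℕ (λ j → IsC s i j × Sat (sub s j (fin i)) φ j)
  ⊎ ((¬ Σ ℕ (λ j → IsC s i j)) × Sat (sub s (lo s) (fin i)) φ (lo s))
Sat s (Rop φ) i =
  Σ ℕ (λ l → IsR s i l × Sat (sub s i (fin l)) φ i)
  ⊎ ((¬ Σ ℕ (λ l → IsR s i l)) × Sat (sub s i (hi s)) φ i)

data FO (k : ℕ) : ℕ → Set where
  P     : ∀ {n} → Fin k → Fin n → FO k n
  _≺_   : ∀ {n} → Fin n → Fin n → FO k n
  _≐_   : ∀ {n} → Fin n → Fin n → FO k n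
  muF   : ∀ {n} → Fin n → Fin n → FO k n
  callF : ∀ {n} → Fin n → FO k n
  retF  : ∀ {n} → Fin n → FO k n
  negF  : ∀ {n} → FO k n → FO k n
  _orF_ : ∀ {n} → FO k n → FO k n → FO k n
  exF   : ∀ {n} → FO k (suc n) → FO k n

FOSat : ∀ {k n} → Str k → Vector ℕ n → FO k n → Set
FOSat s ρ (P a x) = lab s (ρ x) ≡ a
FOSat s ρ (x ≺ y) = ρ x < ρ y
FOSat s ρ (x ≐ y) = ρ x ≡ ρ y
FOSat s ρ (muF x y) = mu s (ρ x) (ρ y)
FOSat s ρ (callF x) = callP s (ρ x)
FOSat s ρ (retF x) = retP s (ρ x)
FOSat s ρ (negF φ) = ¬ FOSat s ρ φ
FOSat s ρ (φ orF ψ) = FOSat s ρ φ ⊎ FOSat s ρ ψ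
FOSat s ρ (exF φ) = Σ ℕ (λ i → Dom s i × FOSat s (i ∷ ρ) φ)

{-# OPTIONS --safe #-}
module Submission where

open import Defs
open import Level using (0ℓ; Lift; lift)
open import Axiom.ExcludedMiddle using (ExcludedMiddle)
open import Data.Bool using (Bool; true; false; if_then_else_; _∧_; _∨_)
open import Data.Bool.Properties using (T-≡; ∨-assoc; ∨-zeroʳ; ∨-identityʳ; ∧-conicalˡ; ∧-conicalʳ; ∧-zeroʳ)
open import Data.Empty using (⊥; ⊥-elim)
open import Data.Fin using (Fin; zero; suc)
open import Data.List using (List; []; _∷_; map; length; cartesianProductWith; allFin; cartesianProduct)
import Data.List as List
open import Data.List.Membership.Propositional using (_∈_; lose; find)
open import Data.List.Membership.Propositional.Properties using (∈-cartesianProductWith⁺; ∈-cartesianProduct⁺; ∈-allFin)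
open import Data.List.Relation.Unary.Any using (Any; here; there; index)
import Data.List.Relation.Unary.Any as Any
open import Data.List.Relation.Unary.Any.Properties using (map⁺; lookup-index)
open import Data.Nat
open import Data.Nat.GeneralisedArithmetic using (fold)
open import Data.Nat.Properties
open import Data.Product using (Σ; _×_; _,_; proj₁; proj₂)
open import Data.Product.Function.NonDependent.Propositional using (_×-⇔_)
open import Data.Sum using (_⊎_; inj₁; inj₂; [_,_]′)
open import Data.Sum.Function.Propositional using (_⊎-⇔_)
open import Data.Unit using (⊤; tt)
open import Data.Vec using (Vec; []; _∷_; lookup; tabulate; replicate)
import Data.Vec as Vec
open import Data.Vec.Functional using (Vector) renaming (_∷_ to _∷ᵛ_)
open import Data.Vec.Properties using (lookup∘tabulate; tabulate-cong; lookup-replicate)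
open import Function using (_∘_; id)
open import Function.Bundles using (_⇔_; mk⇔; Equivalence)
open import Function.Properties.Equivalence using () renaming (refl to ⇔-refl; sym to ⇔-sym; trans to ⇔-trans)
open import Function.Related.TypeIsomorphisms using () renaming (¬-cong-⇔ to ¬-cong)
open import Relation.Binary.Construct.Closure.ReflexiveTransitive using (Star; _◅_; _◅◅_) renaming (ε to εˢ)
open import Relation.Binary.Definitions using (tri<; tri≈; tri>)
open import Relation.Binary.PropositionalEquality hiding ([_])
open import Relation.Nullary using (¬_; Dec; yes; no; does)
open import Relation.Nullary.Decidable using (dec-true; dec-false)

-- From CaRet + {C, R} to FO: the three kinds of paths are deterministic, so an until
-- speaks about reachability along steps, and reachability is first-order; C and R only
-- relativise to an interval.
--
-- From FO to CaRet + {C, R}: by induction on the formula one builds a finite algebra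
-- evaluating nested words whose free variables are marks on positions.  A quantifier
-- adds to the value of a word the set of its values with one more mark.  What is kept
-- along the induction is that the value of an unmarked word is definable at its first
-- position.  The value with a mark at p is obtained from the values of the siblings of
-- p and of the calls enclosing it.  C and R cut these sibling words out of the
-- structure, and their values act as maps along the chain of enclosing calls.  These
-- maps are aperiodic, so their composition along the chain is definable with the call
-- since alone: this is Kamp's theorem on finite words, proved as by Wilke, by
-- induction on the set of states on which the maps act.

-- First positions suffice because C and R evaluate their argument at the first position of the
-- structure they cut out: what is definable at the first position of every structure can be asked
-- of every word so cut. Hence each definability claim ranges over all structures that arise by
-- cutting. The cuts include the positions that bound them, and formulas must strip these off again.
--
-- The siblings of a position, even infinitely many, are thus settled by the induction hypothesis.
-- Only the passage through the enclosing calls composes unboundedly many maps, and there `prevC`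
-- and `_Sc_` act as next and until on a finite word. Aperiodicity is needed since a map that
-- permutes states nontrivially would count modulo some number. It has to hold for all composites
-- and to survive the power set step of a quantifier, so an algebra carries a whole class of
-- aperiodic maps closed under composition.
--
-- Excluded middle selects formulas and finite sets according to facts that no computation decides.

open Equivalence using (to; from)

infixr 4 _⇔∘_
_⇔∘_ : ∀ {a b c} {A : Set a} {B : Set b} {C : Set c} → A ⇔ B → B ⇔ C → A ⇔ C
f ⇔∘ g = ⇔-trans f g

-- Bounds and induced substructures.

≤B-trans : ∀ {q i} (B : Bound) → q ≤ i → i ≤B B → q ≤B B
≤B-trans (fin n) p q = ≤-trans p q
≤B-trans inf _ _ = tt

sub-matching : ∀ {k} {s : Str k} {a b} → (∀ {q} → Dom (sub s a b) q → Dom s q) → IsMatching s → IsMatching (sub s a b)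
sub-matching inc ms = record
  { m-call-ret = λ i j di dj → m-call-ret i j (inc di) (inc dj)
  ; m-fun = λ i j j' di dj dj' → m-fun i j j' (inc di) (inc dj) (inc dj')
  ; m-inj = λ i i' j di di' dj → m-inj i i' j (inc di) (inc di') (inc dj)
  ; m-nest = λ i j di dj → m-nest i j (inc di) (inc dj) }
  where open IsMatching ms

dom-∷ : ∀ {k n} {s : Str k} {ρ : Vector ℕ n} {p} → (∀ i → Dom s (ρ i)) → Dom s p → ∀ i → Dom s ((p ∷ᵛ ρ) i)
dom-∷ d dp zero = dp
dom-∷ d dp (suc i) = d i

-- Classical logic, and the geometry of matchings.

module Classical (em : ExcludedMiddle 0ℓ) where

  dec : Set → Bool
  dec A = does (em {A})

  dec⇒ : ∀ {A} → dec A ≡ true → A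
  dec⇒ {A} e with em {A}
  ... | yes a = a

  ⇒dec : ∀ {A} → A → dec A ≡ true
  ⇒dec {A} a with em {A}
  ... | yes _ = refl
  ... | no ¬a = ⊥-elim (¬a a)

  ⇒dec-false : ∀ {A} → ¬ A → dec A ≡ false
  ⇒dec-false {A} ¬a with em {A}
  ... | yes a = ⊥-elim (¬a a)
  ... | no _ = refl

  dec-cong : ∀ {A B} → A ⇔ B → dec A ≡ dec B
  dec-cong {A} {B} f with em {A}
  ... | yes a = sym (⇒dec (to f a))
  ... | no ¬a = sym (⇒dec-false (λ b → ¬a (from f b)))

  dne : ∀ {A : Set} → ¬ ¬ A → A
  dne {A} n with em {A}
  ... | yes a = a
  ... | no ¬a = ⊥-elim (n ¬a)

  ×-from-⊎ : {A B : Set} → (A × B) ⇔ (¬ (¬ A ⊎ ¬ B))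
  ×-from-⊎ = mk⇔ (λ { (a , b) (inj₁ n) → n a ; (a , b) (inj₂ n) → n b })
                 (λ n → dne (λ x → n (inj₁ x)) , dne (λ x → n (inj₂ x)))

  maxBelow : (Q : ℕ → Set) (x j : ℕ) → Q j → j < x →
             Σ ℕ λ m → j ≤ m × m < x × Q m × (∀ i → m < i → i < x → ¬ Q i)
  maxBelow Q (suc x) j q (s≤s j≤x) with em {Q x}
  ... | yes qx = x , j≤x , ≤-refl , qx , λ i x<i i<sx _ → <⇒≱ x<i (s≤s⁻¹ i<sx)
  ... | no ¬qx with m≤n⇒m<n∨m≡n j≤x
  ... | inj₂ refl = ⊥-elim (¬qx q)
  ... | inj₁ j<x with maxBelow Q x j q j<x
  ... | m , j≤m , m<x , qm , mx = m , j≤m , m<n⇒m<1+n m<x , qm , above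
    where
    above : ∀ i → m < i → i < suc x → ¬ Q i
    above i m<i i<sx qi with m≤n⇒m<n∨m≡n (s≤s⁻¹ i<sx)
    ... | inj₁ i<x = mx i m<i i<x qi
    ... | inj₂ refl = ¬qx qi

  module _ {k : ℕ} {s : Str k} (ms : IsMatching s) where
    open IsMatching ms

    M-fun : ∀ {i j j'} → M s i j → M s i j' → j ≡ j'
    M-fun (di , dj , u) (_ , dj' , v) = m-fun _ _ _ di dj dj' u v

    M-inj : ∀ {i i' j} → M s i j → M s i' j → i ≡ i'
    M-inj (di , dj , u) (di' , _ , v) = m-inj _ _ _ di di' dj u v

    M-call : ∀ {i j} → M s i j → callP s i
    M-call (di , dj , u) = proj₁ (m-call-ret _ _ di dj u)

    M-ret : ∀ {i j} → M s i j → retP s j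
    M-ret (di , dj , u) = proj₁ (proj₂ (m-call-ret _ _ di dj u))

    M-< : ∀ {i j} → M s i j → i < j
    M-< (di , dj , u) = proj₂ (proj₂ (m-call-ret _ _ di dj u))

    dom-between : ∀ {i j l} → Dom s i → Dom s j → i ≤ l → l ≤ j → Dom s l
    dom-between (a , _) (_ , b) p q = ≤-trans a p , ≤B-trans (hi s) q b

    nest : ∀ {i j} → Dom s i → Dom s j → i ≤ j → callP s i → retP s j →
           Σ ℕ λ l → i ≤ l × l ≤ j × (M s i l ⊎ M s l j)
    nest di dj i≤j ci rj with m-nest _ _ di dj i≤j ci rj
    ... | l , p , q , inj₁ u = l , p , q , inj₁ (di , dom-between di dj p q , u)
    ... | l , p , q , inj₂ u = l , p , q , inj₂ (dom-between di dj p q , dj , u)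

    -- Condition (3), applied to the call `c'` and the return `r`, yields a partner of one of them
    -- inside `[c', r]`. But `c'` is matched only to `r'`, beyond `r`, and `r` only to `c`, before
    -- `c'`.
    nocross : ∀ {c r c' r'} → M s c r → M s c' r' → c < c' → c' ≤ r → r < r' → ⊥
    nocross m m' c<c' c'<r r<r' with nest (proj₁ m') (proj₁ (proj₂ m)) c'<r (M-call m') (M-ret m)
    ... | l , p , q , inj₁ u with M-fun u m'
    ... | refl = <⇒≱ r<r' q
    nocross m m' c<c' c'<r r<r' | l , p , q , inj₂ u with M-inj u m
    ... | refl = <⇒≱ c<c' p

    -- Condition (3) on the interval `[x, x]` would match `x` with itself.
    call≢ret : ∀ {x} → Dom s x → callP s x → ¬ retP s x
    call≢ret dx cx rx with nest dx dx ≤-refl cx rx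
    ... | l , p , q , inj₁ u = <⇒≱ (M-< u) q
    ... | l , p , q , inj₂ u = <⇒≱ (M-< u) p

  Encl : ∀ {k} → Str k → ℕ → ℕ → Set
  Encl s x j = j < x × Σ ℕ λ l → M s j l × x < l

  encl⇒C : ∀ {k} {s : Str k} {x j} → Encl s x j → Σ ℕ λ m → j ≤ m × IsC s x m
  encl⇒C {s = s} {x} {j} e with maxBelow (Encl s x) x j e (proj₁ e)
  ... | m , j≤m , m<x , (_ , l , u , x<l) , mx =
    m , j≤m , proj₁ u , m<x , (l , u , x<l) , λ j' l' m<j' j'<x u' x<l' → mx j' m<j' j'<x (j'<x , l' , u' , x<l')

  C-unique : ∀ {k} {s : Str k} {x j j'} → IsC s x j → IsC s x j' → j ≡ j'
  C-unique {j = j} {j'} (_ , j<x , (l , u , x<l) , mx) (_ , j'<x , (l' , u' , x<l') , mx') with <-cmp j j'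
  ... | tri< lt _ _ = ⊥-elim (mx j' l' lt j'<x u' x<l')
  ... | tri≈ _ e _ = e
  ... | tri> _ _ gt = ⊥-elim (mx' j l gt j<x u x<l)

  R-unique : ∀ {k} {s : Str k} {x j j'} → IsR s x j → IsR s x j' → j ≡ j'
  R-unique {j = j} {j'} (_ , x<j , (l , u , l<x) , mx) (_ , x<j' , (l' , u' , l'<x) , mx') with <-cmp j j'
  ... | tri< lt _ _ = ⊥-elim (mx' j l x<j lt u l<x)
  ... | tri≈ _ e _ = e
  ... | tri> _ _ gt = ⊥-elim (mx j' l' x<j' gt u' l'<x)

  -- A return between `x` and `l` whose call precedes `x` has that call after `j`, since edges do
  -- not cross; its block would then enclose `x` more tightly than C(x) does. So C and R at `x` cut
  -- one and the same block into two halves.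
  C⇒R : ∀ {k} {s : Str k} → IsMatching s → ∀ {x j l} → IsC s x j → M s j l → IsR s x l
  C⇒R {s = s} ms {x} {j} {l} (_ , j<x , (l₀ , u₀ , x<l₀) , mx) u with M-fun ms u₀ u
  ... | refl = proj₁ (proj₂ u) , x<l₀ , (j , u , j<x) , least
    where
    least : ∀ l' j' → x < l' → l' < l → M s j' l' → j' < x → ⊥
    least l' j' x<l' l'<l u' j'<x with <-cmp j' j
    ... | tri< lt _ _ = nocross ms u' u lt (<⇒≤ (<-trans j<x x<l')) l'<l
    ... | tri> _ _ gt = mx j' l' gt j'<x u' x<l'
    ... | tri≈ _ refl _ = <⇒≢ l'<l (M-fun ms u' u)

  ¬C⇒¬R : ∀ {k} {s : Str k} {x} → ¬ Σ ℕ (IsC s x) → ¬ Σ ℕ (IsR s x)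
  ¬C⇒¬R {s = s} n (l , _ , x<l , (j , u , j<x) , _) = let m , _ , c = encl⇒C {s = s} (j<x , l , u , x<l) in n (m , c)

-- Finite sets, given by enumerations that may repeat elements.

record Finite (A : Set) : Set where
  field
    elements : List A
    complete : ∀ a → a ∈ elements
open Finite

finite-Bool : Finite Bool
finite-Bool = record { elements = true ∷ false ∷ [] ; complete = λ { true → here refl ; false → there (here refl) } }

finite-Fin : ∀ n → Finite (Fin n)
finite-Fin n = record { elements = allFin n ; complete = ∈-allFin }

finite-× : ∀ {A B} → Finite A → Finite B → Finite (A × B)
finite-× f g = record { elements = cartesianProduct (elements f) (elements g)
                      ; complete = λ (a , b) → ∈-cartesianProduct⁺ (complete f a) (complete g b) }

finite-Vec : ∀ {A} → Finite A → ∀ n → Finite (Vec A n)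
finite-Vec f zero = record { elements = [] ∷ [] ; complete = λ { [] → here refl } }
finite-Vec f (suc n) = record
  { elements = cartesianProductWith Vec._∷_ (elements f) (elements (finite-Vec f n))
  ; complete = λ { (x ∷ xs) → ∈-cartesianProductWith⁺ Vec._∷_ (complete f x) (complete (finite-Vec f n) xs) } }

-- Kamp's theorem on finite words, for letters acting on a finite set of states.

module Kamp (em : ExcludedMiddle 0ℓ) where
  open Classical em

  -- A predicate sees the whole remaining suffix, as a future formula does. The empty suffix counts
  -- as a position, so an until may end there.
  until : {A : Set₁} → (List A → Set) → (List A → Set) → List A → Set
  until B C [] = C []
  until B C (a ∷ t) = C (a ∷ t) ⊎ (B (a ∷ t) × until B C t)

  onTail : {A : Set₁} → (List A → Set) → List A → Set
  onTail B [] = ⊥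
  onTail B (a ∷ t) = B t

  -- The logic enters only through these closure properties. They are instantiated later with
  -- `prevC` as `d-tail` and call since as `d-until`.
  record Closed {A : Set₁} (Def : (List A → Set) → Set₁) : Set₂ where
    field
      d-ext   : ∀ {B C} → (∀ l → B l ⇔ C l) → Def B → Def C
      d-true  : Def (λ _ → ⊤)
      d-not   : ∀ {B} → Def B → Def (λ l → ¬ B l)
      d-or    : ∀ {B C} → Def B → Def C → Def (λ l → B l ⊎ C l)
      d-tail  : ∀ {B} → Def B → Def (onTail B)
      d-until : ∀ {B C} → Def B → Def C → Def (until B C)

    d-and : ∀ {B C} → Def B → Def C → Def (λ l → B l × C l)
    d-and b c = d-ext (λ _ → ⇔-sym ×-from-⊎) (d-not (d-or (d-not b) (d-not c)))

    d-const : (B : Set) → Def (λ _ → B)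
    d-const B with em {B}
    ... | yes b = d-ext (λ _ → mk⇔ (λ _ → b) (λ _ → tt)) d-true
    ... | no ¬b = d-ext (λ _ → mk⇔ (λ n → ⊥-elim (n tt)) (λ b _ → ¬b b)) (d-not d-true)

  -- Aperiodicity of the single letters would not pass to their products. `Good` is therefore a
  -- submonoid of maps that contains the letters and consists of aperiodic maps.
  record Monodromy (A : Set₁) (H : Set) : Set₂ where
    field
      act      : A → H → H
      Good     : (H → H) → Set₁
      good-id  : Good id
      good-∘   : ∀ {f g} → Good f → Good g → Good (f ∘ g)
      good-act : ∀ a → Good (act a)
      aper     : ∀ {f} → Good f → Σ ℕ λ N → ∀ h → fold h f N ≡ fold h f (suc N)

    headAct : List A → H → H
    headAct [] = id
    headAct (a ∷ _) = act a

    run : List A → H → H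
    run [] h = h
    run (a ∷ l) h = run l (act a h)

  module _ {A : Set₁} {H : Set} (mono : Monodromy A H) (finH : Finite H)
           {Def : (List A → Set) → Set₁} (closed : Closed Def) where
    open Monodromy mono
    open Closed closed

    d-∀ : ∀ {B : H → List A → Set} → (∀ h → Def (B h)) → Def (λ l → ∀ h → B h l)
    d-∀ {B} d = d-ext (λ l → mk⇔ (λ f h → f h (complete finH h)) (λ f h _ → f h)) (go (elements finH))
      where
      go : ∀ xs → Def (λ l → ∀ h → h ∈ xs → B h l)
      go [] = d-ext (λ l → mk⇔ (λ _ h ()) (λ _ → tt)) d-true
      go (x ∷ xs) = d-ext (λ l → mk⇔ (λ { (b , _) _ (here refl) → b ; (_ , f) h (there m) → f h m })
                                      (λ f → f x (here refl) , λ h m → f h (there m)))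
                          (d-and (d x) (go xs))

    d-∃ : ∀ {B : H → List A → Set} → (∀ h → Def (B h)) → Def (λ l → Σ H λ h → B h l)
    d-∃ d = d-ext (λ l → mk⇔ (λ n → dne λ m → n λ h b → m (h , b)) (λ (h , b) f → f h b))
                  (d-not (d-∀ (λ h → d-not (d h))))

    infix 4 _∋_
    _∋_ : (H → Bool) → H → Set
    S ∋ h = S h ≡ true

    -- A finite disjunction over the value of `f`. The set `S` is present because the induction
    -- provides definability only for states in it.
    d-bind : (S : H → Bool) {f : List A → H} {B : H → List A → Set} → (∀ l → S ∋ f l) →
             (∀ q → S ∋ q → Def (λ l → f l ≡ q)) → (∀ q → S ∋ q → Def (B q)) → Def (λ l → B (f l) l)
    d-bind S {f} {B} s df db = d-ext (λ l → mk⇔ (λ { (_ , _ , refl , b) → b }) (λ b → f l , s l , refl , b)) (d-∃ part)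
      where
      part : ∀ q → Def (λ l → S ∋ q × f l ≡ q × B q l)
      part q with em {S ∋ q}
      ... | yes m = d-ext (λ l → mk⇔ (m ,_) proj₂) (d-and (df q m) (db q m))
      ... | no ¬m = d-ext (λ l → mk⇔ (λ ()) (λ (m , _) → ⊥-elim (¬m m))) (d-const ⊥)

    count : (H → Bool) → List H → ℕ
    count S [] = 0
    count S (x ∷ xs) = (if S x then 1 else 0) + count S xs

    module _ {S S' : H → Bool} (inc : ∀ h → S' ∋ h → S ∋ h) where
      count-head : ∀ x → (if S' x then 1 else 0) ≤ (if S x then 1 else 0)
      count-head x with S' x in e
      ... | false = z≤n
      ... | true rewrite inc x e = ≤-refl

      count-≤ : ∀ xs → count S' xs ≤ count S xs
      count-≤ [] = z≤n
      count-≤ (x ∷ xs) = +-mono-≤ (count-head x) (count-≤ xs)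

      count-< : ∀ {x xs} → x ∈ xs → S ∋ x → ¬ S' ∋ x → count S' xs < count S xs
      count-< {x} {_ ∷ xs} (here refl) m n with S x | m | S' x | n
      ... | true | _ | false | _ = s≤s (count-≤ xs)
      ... | true | _ | true | ¬t = ⊥-elim (¬t refl)
      count-< {x} {y ∷ xs} (there i) m n = +-mono-≤-< (count-head y) (count-< i m n)

    -- The letter `ν` depends on the suffix, and reading stops at the first suffix satisfying `E`. A
    -- whole block can then be a letter sitting at one position of the same word, so the induction
    -- never passes to a new word over a new alphabet.
    product : (List A → Set) → (List A → H → H) → List A → H → H
    product E ν [] p = p
    product E ν (a ∷ t) p = if dec (E (a ∷ t)) then p else product E ν t (ν (a ∷ t) p)

    module _ {E : List A → Set} {ν : List A → H → H} where
      product-stop : ∀ l {p} → E l → product E ν l p ≡ p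
      product-stop [] e = refl
      product-stop (a ∷ t) e rewrite ⇒dec e = refl

      product-step : ∀ a t {p} → ¬ E (a ∷ t) → product E ν (a ∷ t) p ≡ product E ν t (ν (a ∷ t) p)
      product-step a t ne rewrite ⇒dec-false ne = refl

      product-stable : ∀ {S} → (∀ l p → S ∋ p → S ∋ ν l p) → ∀ l p → S ∋ p → S ∋ product E ν l p
      product-stable st [] p m = m
      product-stable st (a ∷ t) p m with dec (E (a ∷ t))
      ... | true = m
      ... | false = product-stable st t _ (st _ p m)

      product-good : (∀ l → Good (ν l)) → ∀ l → Good (product E ν l)
      product-good g [] = good-id
      product-good g (a ∷ t) with dec (E (a ∷ t))
      ... | true = good-id
      ... | false = good-∘ (product-good g t) (g _)

    Agree : (H → Bool) → (H → H) → (H → H) → Set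
    Agree S f g = ∀ p → S ∋ p → f p ≡ g p

    -- The invariant of Wilke's induction, which descends lexicographically in the size of `S` and
    -- the length of `Γ`. Letters that act as the identity on `S` are free and need no entry in `Γ`.
    record Letters (S : H → Bool) (Γ : List (H → H)) (E : List A → Set) (ν : List A → H → H) : Set₁ where
      field
        E-def  : Def E
        ν-def  : ∀ p q → S ∋ p → Def (λ l → ν l p ≡ q)
        ν-good : ∀ l → Good (ν l)
        stable : ∀ l p → S ∋ p → S ∋ ν l p
        cover  : ∀ l → Agree S (ν l) id ⊎ Any (Agree S (ν l)) Γ
    open Letters

    shrink : ∀ {S Γ γ E ν} → (∀ l → Agree S (ν l) γ → Agree S (ν l) id) → Letters S (γ ∷ Γ) E ν → Letters S Γ E ν
    shrink {S} {Γ} {γ} {E} {ν} h L = record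
      { E-def = E-def L ; ν-def = ν-def L ; ν-good = ν-good L ; stable = stable L ; cover = λ l → cov l (cover L l) }
      where
      cov : ∀ l → Agree S (ν l) id ⊎ Any (Agree S (ν l)) (γ ∷ Γ) → Agree S (ν l) id ⊎ Any (Agree S (ν l)) Γ
      cov l (inj₁ i) = inj₁ i
      cov l (inj₂ (here e)) = inj₁ (h l e)
      cov l (inj₂ (there m)) = inj₂ m

    -- Here aperiodicity is used. As `f` is onto `S`, a state `p` is the `N`-fold image of some
    -- `p'`, and applying `f` once more changes nothing.
    onto-id : ∀ {S f} → Good f → (∀ h → S ∋ h → Σ H λ p → S ∋ p × f p ≡ h) → Agree S f id
    onto-id {S} {f} g onto p m with aper g
    ... | N , e with root N p m
      where
      root : ∀ n p → S ∋ p → Σ H λ p' → fold p' f n ≡ p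
      root zero p m = p , refl
      root (suc n) p m with onto p m
      ... | p₁ , m₁ , e₁ with root n p₁ m₁
      ... | p' , e' = p' , trans (cong f e') e₁
    ... | p' , refl = sym (e p')

    -- The start alphabet, and again the alphabet after each descent to a smaller set of states: the
    -- maps of blocks belong to no list fixed in advance.
    allMaps : List (H → H)
    allMaps = map (λ v h → lookup v (index (complete finH h))) (elements (finite-Vec finH (length (elements finH))))

    allMaps-complete : ∀ f → Any (λ γ → ∀ h → f h ≡ γ h) allMaps
    allMaps-complete f = map⁺ (Any.map (λ { refl h → sym (trans (lookup∘tabulate _ (index (complete finH h)))
        (cong f (sym (lookup-index (complete finH h))))) })
      (complete (finite-Vec finH _) (tabulate (λ i → f (List.lookup (elements finH) i)))))

    module _ {B B' C C' : List A → Set} (f : ∀ l → B l → B' l) (g : ∀ l → C l → C' l) where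
      until-mono : ∀ l → until B C l → until B' C' l
      until-mono [] c = g [] c
      until-mono (a ∷ t) (inj₁ c) = inj₁ (g _ c)
      until-mono (a ∷ t) (inj₂ (b , u)) = inj₂ (f _ b , until-mono t u)

    -- The word is cut at the positions whose letter acts like γ on S; every
    -- block between two cuts, together with the cut before it, is one
    -- letter acting on the smaller set γ S.
    module Cut {S Γ γ E ν} (L : Letters S (γ ∷ Γ) E ν) (γ-stable : ∀ p → S ∋ p → S ∋ γ p) where

      isCut : List A → Set
      isCut l = Agree S (ν l) γ

      E₀ : List A → Set
      E₀ l = E l ⊎ isCut l

      -- A block stops at a cut and never applies the letter there. Choosing `id` at cuts makes the
      -- letters fit the list `Γ` without `γ` at every suffix.
      ν₀ : List A → H → H
      ν₀ l = if dec (isCut l) then id else ν l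

      block : List A → H → H
      block = product E₀ ν₀

      isCut-def : Def isCut
      isCut-def = d-∀ part
        where
        part : ∀ h → Def (λ l → S ∋ h → ν l h ≡ γ h)
        part h with em {S ∋ h}
        ... | yes m = d-ext (λ l → mk⇔ (λ e _ → e) (λ f → f m)) (ν-def L h (γ h) m)
        ... | no ¬m = d-ext (λ l → mk⇔ (λ _ m → ⊥-elim (¬m m)) (λ _ → tt)) d-true

      blockLetters : Letters S Γ E₀ ν₀
      blockLetters = record { E-def = d-or (E-def L) isCut-def ; ν-def = def ; ν-good = good ; stable = st ; cover = cov }
        where
        def : ∀ p q → S ∋ p → Def (λ l → ν₀ l p ≡ q)
        def p q m = d-ext eq (d-or (d-and isCut-def (d-const (p ≡ q))) (d-and (d-not isCut-def) (ν-def L p q m)))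
          where
          eq : ∀ l → ((isCut l × p ≡ q) ⊎ (¬ isCut l × ν l p ≡ q)) ⇔ (ν₀ l p ≡ q)
          eq l with em {isCut l}
          ... | yes c = mk⇔ (λ { (inj₁ (_ , e)) → e ; (inj₂ (n , _)) → ⊥-elim (n c) }) (λ e → inj₁ (c , e))
          ... | no ¬c = mk⇔ (λ { (inj₁ (c , _)) → ⊥-elim (¬c c) ; (inj₂ (_ , e)) → e }) (λ e → inj₂ (¬c , e))
        good : ∀ l → Good (ν₀ l)
        good l with dec (isCut l)
        ... | true = good-id
        ... | false = ν-good L l
        st : ∀ l p → S ∋ p → S ∋ ν₀ l p
        st l p m with dec (isCut l)
        ... | true = m
        ... | false = stable L l p m
        cov : ∀ l → Agree S (ν₀ l) id ⊎ Any (Agree S (ν₀ l)) Γ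
        cov l with em {isCut l}
        ... | yes _ = inj₁ λ _ _ → refl
        ... | no ¬c with cover L l
        ... | inj₁ i = inj₁ i
        ... | inj₂ (here e) = ⊥-elim (¬c e)
        ... | inj₂ (there m) = inj₂ m

      block-stable : ∀ l p → S ∋ p → S ∋ block l p
      block-stable = product-stable (stable blockLetters)

      -- The conjunct with `onTail` only excludes the empty suffix: `ν []` is no letter of the word,
      -- although it may agree with `γ`.
      hasCut : List A → Set
      hasCut = until (λ l → ¬ E l) (λ l → ¬ E l × isCut l × onTail (λ _ → ⊤) l)

      -- The letter at a cut leads from the state just after this cut to the state just after the
      -- next one: first the block in between, then `γ`. The `γ` of the next cut is represented by
      -- `ν l`, which agrees with it on `S` and is known to be good. The last cut has no successor
      -- and acts as the identity.
      ν' : List A → H → H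
      ν' l = if dec (isCut l × onTail hasCut l) then ν l ∘ block (List.drop 1 l) else id

      S' : H → Bool
      S' h = dec (Σ H λ p → S ∋ p × γ p ≡ h)

      S'⊆S : ∀ h → S' ∋ h → S ∋ h
      S'⊆S h m with dec⇒ m
      ... | p , mp , refl = γ-stable p mp

      γ∈S' : ∀ p → S ∋ p → S' ∋ γ p
      γ∈S' p m = ⇒dec (p , m , refl)

      -- An until can find the last cut, as the cut whose tail contains no further one; the block
      -- behind it takes `x` to `q`.
      lastBlock : H → H → List A → Set
      lastBlock x q = until (λ l → ¬ E l)
        (λ l → ¬ E l × isCut l × onTail (λ t → ¬ hasCut t) l × block (List.drop 1 l) x ≡ q)

      module _ (block-def : ∀ p q → S ∋ p → Def (λ l → block l p ≡ q)) where

        hasCut-def : Def hasCut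
        hasCut-def = d-until (d-not (E-def L)) (d-and (d-not (E-def L)) (d-and isCut-def (d-tail d-true)))

        block-tail-def : ∀ p q → S ∋ p → Def (λ l → block (List.drop 1 l) p ≡ q)
        block-tail-def p q m = d-ext eq (d-or (d-tail (block-def p q m)) (d-and (d-not (d-tail d-true)) (d-const (p ≡ q))))
          where
          eq : ∀ l → (onTail (λ t → block t p ≡ q) l ⊎ (¬ onTail (λ _ → ⊤) l × p ≡ q)) ⇔ (block (List.drop 1 l) p ≡ q)
          eq [] = mk⇔ (λ { (inj₁ ()) ; (inj₂ (_ , e)) → e }) (λ e → inj₂ ((λ ()) , e))
          eq (a ∷ t) = mk⇔ (λ { (inj₁ e) → e ; (inj₂ (n , _)) → ⊥-elim (n tt) }) inj₁

        lastBlock-def : ∀ x q → S ∋ x → Def (lastBlock x q)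
        lastBlock-def x q m = d-until (d-not (E-def L))
          (d-and (d-not (E-def L)) (d-and isCut-def (d-and (d-tail (d-not hasCut-def)) (block-tail-def x q m))))

        cutLetters : Letters S' allMaps E ν'
        cutLetters = record { E-def = E-def L ; ν-def = def ; ν-good = good ; stable = st
          ; cover = λ l → inj₂ (Any.map (λ e p _ → e p) (allMaps-complete (ν' l))) }
          where
          cond-def : Def (λ l → isCut l × onTail hasCut l)
          cond-def = d-and isCut-def (d-tail hasCut-def)
          def : ∀ p q → S' ∋ p → Def (λ l → ν' l p ≡ q)
          def p q m' = d-ext eq (d-or
              (d-and cond-def (d-bind S {B = λ u l → ν l u ≡ q} (λ l → block-stable (List.drop 1 l) p m) (λ u _ → block-tail-def p u m) (λ u → ν-def L u q)))
              (d-and (d-not cond-def) (d-const (p ≡ q))))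
            where
            m : S ∋ p
            m = S'⊆S p m'
            eq : ∀ l → (((isCut l × onTail hasCut l) × ν l (block (List.drop 1 l) p) ≡ q) ⊎
                        (¬ (isCut l × onTail hasCut l) × p ≡ q)) ⇔ (ν' l p ≡ q)
            eq l with em {isCut l × onTail hasCut l}
            ... | yes c = mk⇔ (λ { (inj₁ (_ , e)) → e ; (inj₂ (n , _)) → ⊥-elim (n c) }) (λ e → inj₁ (c , e))
            ... | no ¬c = mk⇔ (λ { (inj₁ (c , _)) → ⊥-elim (¬c c) ; (inj₂ (_ , e)) → e }) (λ e → inj₂ (¬c , e))
          good : ∀ l → Good (ν' l)
          good l with dec (isCut l × onTail hasCut l)
          ... | true = good-∘ (ν-good L l) (product-good (ν-good blockLetters) (List.drop 1 l))
          ... | false = good-id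
          st : ∀ l p → S' ∋ p → S' ∋ ν' l p
          st l p m with em {isCut l × onTail hasCut l}
          ... | no _ = m
          ... | yes (c , _) = subst (S' ∋_) (sym (c _ mb)) (γ∈S' _ mb)
            where
            mb : S ∋ block (List.drop 1 l) p
            mb = block-stable (List.drop 1 l) p (S'⊆S p m)

        nocut-product : ∀ l p → ¬ hasCut l → S ∋ p → product E ν l p ≡ block l p
        nocut-product [] p n m = refl
        nocut-product (a ∷ t) p n m = cases em em
          where
          l : List A
          l = a ∷ t
          ν₀-off : ¬ isCut l → ν₀ l p ≡ ν l p
          ν₀-off ¬c rewrite ⇒dec-false ¬c = refl
          cases : Dec (E l) → Dec (isCut l) → product E ν l p ≡ block l p
          cases (yes e) _ = trans (product-stop {E} {ν} l e) (sym (product-stop {E₀} {ν₀} l (inj₁ e)))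
          cases (no ¬e) (yes c) = ⊥-elim (n (inj₁ (¬e , c , tt)))
          cases (no ¬e) (no ¬c) = trans (product-step {E} {ν} a t ¬e) (trans
            (nocut-product t (ν l p) (λ h → n (inj₂ (¬e , h))) (stable L l p m)) (sym (trans
              (product-step {E₀} {ν₀} a t (λ { (inj₁ e) → ¬e e ; (inj₂ c) → ¬c c }))
              (cong (block t) (ν₀-off ¬c)))))

        ν'-off : ∀ l → ¬ (isCut l × onTail hasCut l) → ∀ p → ν' l p ≡ p
        ν'-off l ¬c p rewrite ⇒dec-false ¬c = refl

        ν'-on : ∀ l → isCut l → onTail hasCut l → ∀ p → ν' l p ≡ ν l (block (List.drop 1 l) p)
        ν'-on l c h p rewrite ⇒dec {isCut l × onTail hasCut l} (c , h) = refl

        nocut-outer : ∀ l x → ¬ hasCut l → product E ν' l x ≡ x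
        nocut-outer [] x n = refl
        nocut-outer (a ∷ t) x n with em {E (a ∷ t)}
        ... | yes e = refl
        ... | no ¬e = trans (cong (product E ν' t) (ν'-off (a ∷ t) (λ (_ , h) → n (inj₂ (¬e , h))) x))
                            (nocut-outer t x (λ h → n (inj₂ (¬e , h))))

        lastBlock⇒hasCut : ∀ {x q} l → lastBlock x q l → hasCut l
        lastBlock⇒hasCut = until-mono (λ _ n → n) nonempty
          where
          nonempty : ∀ {x q} l → ¬ E l × isCut l × onTail (λ t → ¬ hasCut t) l × block (List.drop 1 l) x ≡ q →
                     ¬ E l × isCut l × onTail (λ _ → ⊤) l
          nonempty (a ∷ t) (n , c , _) = n , c , tt

        -- The word factors into the block before the first cut, `γ`, the letters `ν'` of the cuts,
        -- and the block after the last cut. The three cases are a head that is no cut, a cut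
        -- followed by another one, and the last cut.
        cut-product : ∀ l p q → hasCut l → S ∋ p →
          (product E ν l p ≡ q) ⇔ lastBlock (product E ν' l (γ (block l p))) q l
        cut-product [] p q (_ , _ , ()) m
        cut-product (a ∷ t) p q h m = cases em em
          where
          l : List A
          l = a ∷ t
          ¬e : ¬ E l
          ¬e = [ proj₁ , proj₁ ]′ h
          outer : H → H
          outer = product E ν' t
          cases : Dec (isCut l) → Dec (hasCut t) → (product E ν l p ≡ q) ⇔ lastBlock (product E ν' l (γ (block l p))) q l
          cases (no ¬c) _ = subst₂ (λ u v → (u ≡ q) ⇔ lastBlock v q l) (sym (product-step {E} {ν} a t ¬e)) (sym red)
              (cut-product t (ν l p) q ht (stable L l p m) ⇔∘ mk⇔ (λ b → inj₂ (¬e , b)) later)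
            where
            ht : hasCut t
            ht = [ (λ (_ , c , _) → ⊥-elim (¬c c)) , proj₂ ]′ h
            ν₀-off : ν₀ l p ≡ ν l p
            ν₀-off rewrite ⇒dec-false ¬c = refl
            later : ∀ {x} → lastBlock x q l → lastBlock x q t
            later (inj₁ (_ , c , _)) = ⊥-elim (¬c c)
            later (inj₂ (_ , b)) = b
            red : product E ν' l (γ (block l p)) ≡ outer (γ (block t (ν l p)))
            red = trans (product-step {E} {ν'} a t ¬e) (trans (cong outer (ν'-off l (λ (c , _) → ¬c c) _))
                    (cong (outer ∘ γ) (trans (product-step {E₀} {ν₀} a t (λ { (inj₁ e) → ¬e e ; (inj₂ c) → ¬c c }))
                      (cong (block t) ν₀-off))))
          cases (yes c) (yes ht) = subst₂ (λ u v → (u ≡ q) ⇔ lastBlock v q l)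
              (sym (trans (product-step {E} {ν} a t ¬e) (cong (product E ν t) (c p m)))) (sym red)
              (cut-product t (γ p) q ht (γ-stable p m) ⇔∘ mk⇔ (λ b → inj₂ (¬e , b)) later)
            where
            later : ∀ {x} → lastBlock x q l → lastBlock x q t
            later (inj₁ (_ , _ , n , _)) = ⊥-elim (n ht)
            later (inj₂ (_ , b)) = b
            red : product E ν' l (γ (block l p)) ≡ outer (γ (block t (γ p)))
            red = trans (product-step {E} {ν'} a t ¬e) (cong outer (trans (ν'-on l c ht _)
              (trans (c _ (block-stable t _ (γ-stable _ (block-stable l p m))))
                (cong (γ ∘ block t ∘ γ) (product-stop {E₀} {ν₀} l (inj₂ c))))))
          cases (yes c) (no ¬ht) = subst₂ (λ u v → (u ≡ q) ⇔ lastBlock v q l)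
              (sym (trans (product-step {E} {ν} a t ¬e) (trans (cong (product E ν t) (c p m)) (nocut-product t (γ p) ¬ht (γ-stable p m)))))
              (sym red)
              (mk⇔ (λ e → inj₁ (¬e , c , ¬ht , e)) now)
            where
            now : ∀ {x} → lastBlock x q l → block t x ≡ q
            now (inj₁ (_ , _ , _ , e)) = e
            now (inj₂ (_ , b)) = ⊥-elim (¬ht (lastBlock⇒hasCut t b))
            red : product E ν' l (γ (block l p)) ≡ γ p
            red = trans (product-step {E} {ν'} a t ¬e) (trans (cong outer (ν'-off l (λ (_ , h) → ¬ht h) _))
                   (trans (nocut-outer t _ ¬ht) (cong γ (product-stop {E₀} {ν₀} l (inj₂ c)))))

        cut-def : (∀ p q → S' ∋ p → Def (λ l → product E ν' l p ≡ q)) →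
                  ∀ p q → S ∋ p → Def (λ l → product E ν l p ≡ q)
        -- `u` is the state before the first cut and `z` the state just after the last one.
        cut-def outer-def p q m = d-ext eq (d-or
            (d-and hasCut-def (d-bind S {B = λ u l → lastBlock (product E ν' l (γ u)) q l} (λ l → block-stable l p m) (λ u _ → block-def p u m)
              (λ u mu → d-bind S' {B = λ z l → lastBlock z q l} (λ l → product-stable (stable cutLetters) l _ (γ∈S' u mu))
                (λ z _ → outer-def (γ u) z (γ∈S' u mu))
                (λ z mz → lastBlock-def z q (S'⊆S z mz)))))
            (d-and (d-not hasCut-def) (block-def p q m)))
          where
          eq : ∀ l → ((hasCut l × lastBlock (product E ν' l (γ (block l p))) q l) ⊎ (¬ hasCut l × block l p ≡ q)) ⇔ (product E ν l p ≡ q)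
          eq l with em {hasCut l}
          ... | yes h = mk⇔ (λ { (inj₁ (_ , b)) → from (cut-product l p q h m) b ; (inj₂ (n , _)) → ⊥-elim (n h) })
                            (λ e → inj₁ (h , to (cut-product l p q h m) e))
          ... | no n = mk⇔ (λ { (inj₁ (h , _)) → ⊥-elim (n h) ; (inj₂ (_ , e)) → trans (nocut-product l p n m) e })
                           (λ e → inj₂ (n , trans (sym (nocut-product l p n m)) e))

    -- If `γ` leaves `S`, no letter acts like it, as letters preserve `S`. If `γ` maps `S` onto `S`,
    -- letters acting like it are the identity on `S` by aperiodicity. In both cases `γ` is dropped
    -- from the alphabet. Otherwise its image is a smaller set of states, and the word is cut at
    -- `γ`.
    product-def : ∀ n S → count S (elements finH) ≤ n → ∀ Γ {E ν} → Letters S Γ E ν →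
                  ∀ p q → S ∋ p → Def (λ l → product E ν l p ≡ q)
    product-def n S le [] {E} {ν} L p q m = d-ext (λ l → mk⇔ (trans (trivial l)) (trans (sym (trivial l)))) (d-const (p ≡ q))
      where
      trivial : ∀ l → product E ν l p ≡ p
      trivial [] = refl
      trivial (a ∷ t) with dec (E (a ∷ t)) | cover L (a ∷ t)
      ... | true | _ = refl
      ... | false | inj₁ i rewrite i p m = trivial t
    product-def n S le (γ ∷ Γ) {E} {ν} L with em {∀ p → S ∋ p → S ∋ γ p}
    ... | no ¬st = product-def n S le Γ (shrink (λ l a → ⊥-elim (¬st λ p m → subst (S ∋_) (a p m) (stable L l p m))) L)
    ... | yes st with em {∀ h → S ∋ h → Σ H λ p → S ∋ p × γ p ≡ h}
    ... | yes onto = product-def n S le Γ (shrink (λ l a → onto-id {S} (ν-good L l)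
            λ h m → let p , mp , e = onto h m in p , mp , trans (a p mp) e) L)
    ... | no ¬onto = go n le
      where
      open Cut L st
      smaller : count S' (elements finH) < count S (elements finH)
      smaller with em {Σ H λ h → S ∋ h × ¬ S' ∋ h}
      ... | yes (h , m , n') = count-< S'⊆S (complete finH h) m n'
      ... | no all = ⊥-elim (¬onto λ h m → dec⇒ (dne λ n' → all (h , m , n')))
      block-def : ∀ p q → S ∋ p → Def (λ l → block l p ≡ q)
      block-def = product-def n S le Γ blockLetters
      go : ∀ n → count S (elements finH) ≤ n → ∀ p q → S ∋ p → Def (λ l → product E ν l p ≡ q)
      go zero le = ⊥-elim (<⇒≱ (<-≤-trans smaller le) z≤n)
      go (suc n) le = cut-def block-def (product-def n S' (s≤s⁻¹ (<-≤-trans smaller le)) allMaps (cutLetters block-def))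

    run-def : (∀ p q → Def (λ l → headAct l p ≡ q)) → ∀ p q → Def (λ l → run l p ≡ q)
    run-def atoms p q = d-ext (λ l → mk⇔ (trans (sym (agree l p))) (trans (agree l p)))
        (product-def _ (λ _ → true) ≤-refl allMaps letters p q refl)
      where
      letters : Letters (λ _ → true) allMaps (λ _ → ⊥) headAct
      letters = record
        { E-def = d-const ⊥ ; ν-def = λ p q _ → atoms p q
        ; ν-good = λ { [] → good-id ; (a ∷ _) → good-act a }
        ; stable = λ _ _ _ → refl
        ; cover = λ l → inj₂ (Any.map (λ e p _ → e p) (allMaps-complete (headAct l))) }
      agree : ∀ l p → product (λ _ → ⊥) headAct l p ≡ run l p
      agree [] p = refl
      agree (a ∷ t) p = trans (product-step {λ _ → ⊥} {headAct} a t (λ ())) (agree t (act a p))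

-- From temporal to first-order formulas.

module ToFO (em : ExcludedMiddle 0ℓ) (k : ℕ) where
  open Classical em

  Predicate : ℕ → Set₁
  Predicate n = Str k → Vector ℕ n → Set

  FODef : (n : ℕ) → Predicate n → Set₁
  FODef n Q = Σ (FO k n) λ φ → ∀ s → IsMatching s → (ρ : Vector ℕ n) → (∀ x → Dom s (ρ x)) →
              Q s ρ ⇔ FOSat s ρ φ

  retag : ∀ {n} {Q Q' : Predicate n} →
          (∀ s → IsMatching s → (ρ : Vector ℕ n) → (∀ x → Dom s (ρ x)) → Q s ρ ⇔ Q' s ρ) →
          FODef n Q → FODef n Q'
  retag e (φ , p) = φ , λ s ms ρ d → ⇔-sym (e s ms ρ d) ⇔∘ p s ms ρ d

  notᶠ : ∀ {n} {Q : Predicate n} → FODef n Q → FODef n (λ s ρ → ¬ Q s ρ)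
  notᶠ (φ , p) = negF φ , λ s ms ρ d → ¬-cong (p s ms ρ d)

  _orᶠ_ : ∀ {n} {Q Q' : Predicate n} → FODef n Q → FODef n Q' → FODef n (λ s ρ → Q s ρ ⊎ Q' s ρ)
  (φ , p) orᶠ (ψ , q) = φ orF ψ , λ s ms ρ d → p s ms ρ d ⊎-⇔ q s ms ρ d

  infixr 5 _andᶠ_
  _andᶠ_ : ∀ {n} {Q Q' : Predicate n} → FODef n Q → FODef n Q' → FODef n (λ s ρ → Q s ρ × Q' s ρ)
  p andᶠ q = retag (λ _ _ _ _ → ⇔-sym ×-from-⊎) (notᶠ (notᶠ p orᶠ notᶠ q))

  _⇒ᶠ_ : ∀ {n} {Q Q' : Predicate n} → FODef n Q → FODef n Q' → FODef n (λ s ρ → Q s ρ → Q' s ρ)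
  p ⇒ᶠ q = retag (λ _ _ _ _ → mk⇔ (λ { (inj₁ n) a → ⊥-elim (n a) ; (inj₂ b) _ → b })
                                   (λ f → dne λ n → n (inj₁ λ a → n (inj₂ (f a)))))
                 (notᶠ p orᶠ q)

  existsᶠ : ∀ {n} {Q : Predicate (suc n)} → FODef (suc n) Q → FODef n (λ s ρ → Σ ℕ λ i → Dom s i × Q s (i ∷ᵛ ρ))
  existsᶠ (φ , p) = exF φ , λ s ms ρ d →
    mk⇔ (λ (i , di , q) → i , di , to (p s ms (i ∷ᵛ ρ) (dom-∷ {s = s} {ρ} d di)) q)
        (λ (i , di , q) → i , di , from (p s ms (i ∷ᵛ ρ) (dom-∷ {s = s} {ρ} d di)) q)

  ltᶠ : ∀ {n} (x y : Fin n) → FODef n (λ s ρ → ρ x < ρ y)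
  ltᶠ x y = x ≺ y , λ _ _ _ _ → ⇔-refl

  eqᶠ : ∀ {n} (x y : Fin n) → FODef n (λ s ρ → ρ x ≡ ρ y)
  eqᶠ x y = x ≐ y , λ _ _ _ _ → ⇔-refl

  leᶠ : ∀ {n} (x y : Fin n) → FODef n (λ s ρ → ρ x ≤ ρ y)
  leᶠ x y = retag (λ _ _ _ _ → mk⇔ ≮⇒≥ ≤⇒≯) (notᶠ (ltᶠ y x))

  muᶠ : ∀ {n} (x y : Fin n) → FODef n (λ s ρ → mu s (ρ x) (ρ y))
  muᶠ x y = muF x y , λ _ _ _ _ → ⇔-refl

  callᶠ : ∀ {n} (x : Fin n) → FODef n (λ s ρ → callP s (ρ x))
  callᶠ x = callF x , λ _ _ _ _ → ⇔-refl

  retᶠ : ∀ {n} (x : Fin n) → FODef n (λ s ρ → retP s (ρ x))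
  retᶠ x = retF x , λ _ _ _ _ → ⇔-refl

  trueᶠ : ∀ {n} (x : Fin n) {Q : Predicate n} → (∀ s ρ → (∀ x → Dom s (ρ x)) → Q s ρ) → FODef n Q
  trueᶠ x h = retag (λ s _ ρ d → mk⇔ (λ _ → h s ρ d) (λ _ → refl)) (eqᶠ x x)

  -- C and R restrict the structure; first-order formulas follow them by relativising to
  -- an interval with definable bounds.
  record Window (n : ℕ) : Set₁ where
    field
      lower : Str k → Vector ℕ n → ℕ
      upper : Str k → Vector ℕ n → Bound
      lo≤   : ∀ s ρ → (∀ x → Dom s (ρ x)) → lo s ≤ lower s ρ
      ≤hi   : ∀ s ρ → (∀ x → Dom s (ρ x)) → ∀ q → q ≤B upper s ρ → q ≤B hi s
      lowerᶠ : ∀ {m} (f : Fin n → Fin m) (x : Fin m) → FODef m (λ s ρ → lower s (ρ ∘ f) ≤ ρ x)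
      upperᶠ : ∀ {m} (f : Fin n → Fin m) (x : Fin m) → FODef m (λ s ρ → ρ x ≤B upper s (ρ ∘ f))
    win : Str k → Vector ℕ n → Str k
    win s ρ = sub s (lower s ρ) (upper s ρ)
  open Window

  whole : ∀ {n} → Window n
  whole = record
    { lower = λ s _ → lo s ; upper = λ s _ → hi s
    ; lo≤ = λ _ _ _ → ≤-refl ; ≤hi = λ _ _ _ _ p → p
    ; lowerᶠ = λ f x → trueᶠ x λ s ρ d → proj₁ (d x)
    ; upperᶠ = λ f x → trueᶠ x λ s ρ d → proj₂ (d x) }

  _↑ : ∀ {n} → Window n → Window (suc n)
  W ↑ = record
    { lower = λ s ρ → lower W s (ρ ∘ suc) ; upper = λ s ρ → upper W s (ρ ∘ suc)
    ; lo≤ = λ s ρ d → lo≤ W s _ (d ∘ suc) ; ≤hi = λ s ρ d → ≤hi W s _ (d ∘ suc)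
    ; lowerᶠ = λ f x → lowerᶠ W (f ∘ suc) x
    ; upperᶠ = λ f x → upperᶠ W (f ∘ suc) x }

  upTo : ∀ {n} → Window n → Fin n → Window n
  upTo W y = record
    { lower = lower W ; upper = λ s ρ → fin (ρ y)
    ; lo≤ = lo≤ W ; ≤hi = λ s ρ d q p → ≤B-trans (hi s) p (proj₂ (d y))
    ; lowerᶠ = lowerᶠ W ; upperᶠ = λ f x → leᶠ x (f y) }

  downTo : ∀ {n} → Window n → Fin n → Window n
  downTo W y = record
    { lower = λ s ρ → ρ y ; upper = upper W
    ; lo≤ = λ s ρ d → proj₁ (d y) ; ≤hi = ≤hi W
    ; lowerᶠ = λ f x → leᶠ (f y) x ; upperᶠ = upperᶠ W }

  win⊆ : ∀ {n} (W : Window n) s ρ → (∀ x → Dom s (ρ x)) → ∀ {q} → Dom (win W s ρ) q → Dom s q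
  win⊆ W s ρ d (a , b) = ≤-trans (lo≤ W s ρ d) a , ≤hi W s ρ d _ b

  win-matching : ∀ {n} (W : Window n) {s ρ} → (∀ x → Dom s (ρ x)) → IsMatching s → IsMatching (win W s ρ)
  win-matching W d ms = sub-matching (win⊆ W _ _ d) ms

  domᶠ : ∀ {n} (W : Window n) (x : Fin n) → FODef n (λ s ρ → Dom (win W s ρ) (ρ x))
  domᶠ W x = lowerᶠ W id x andᶠ upperᶠ W id x

  ∃ᶠ : ∀ {n} (W : Window n) {Q : Predicate (suc n)} → FODef (suc n) Q →
       FODef n (λ s ρ → Σ ℕ λ i → Dom (win W s ρ) i × Q s (i ∷ᵛ ρ))
  ∃ᶠ W q = retag (λ s ms ρ d → mk⇔ (λ (i , _ , di , q) → i , di , q) (λ (i , di , q) → i , win⊆ W s ρ d di , di , q))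
           (existsᶠ (domᶠ (W ↑) zero andᶠ q))

  ∀ᶠ : ∀ {n} (W : Window n) {Q : Predicate (suc n)} → FODef (suc n) Q →
       FODef n (λ s ρ → ∀ i → Dom (win W s ρ) i → Q s (i ∷ᵛ ρ))
  ∀ᶠ W q = retag (λ s ms ρ d → mk⇔ (λ n i di → dne λ nq → n (i , di , nq)) (λ h (i , di , nq) → nq (h i di)))
           (notᶠ (∃ᶠ W (notᶠ q)))

  module _ {n} (W : Window n) where

    Mᶠ : (x y : Fin n) → FODef n (λ s ρ → M (win W s ρ) (ρ x) (ρ y))
    Mᶠ x y = domᶠ W x andᶠ domᶠ W y andᶠ muᶠ x y

    sucᶠ : (x y : Fin n) → FODef n (λ s ρ → Dom (win W s ρ) (ρ x) × Dom (win W s ρ) (ρ y) × ρ y ≡ suc (ρ x))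
    sucᶠ x y = retag (λ s ms ρ d → mk⇔
         (λ (dx , dy , x<y , h) → dx , dy , ≤-antisym
            (≮⇒≥ (λ lt → h (suc (ρ x)) (≤-trans (proj₁ dx) (n≤1+n _) , ≤B-trans (upper W s ρ) x<y (proj₂ dy)) ≤-refl lt)) x<y)
         (λ (dx , dy , e) → dx , dy , ≤-reflexive (sym e) ,
            λ i _ x<i i<y → <⇒≱ i<y (subst (_≤ i) (sym e) x<i)))
      (domᶠ W x andᶠ domᶠ W y andᶠ ltᶠ x y andᶠ
        ∀ᶠ W (ltᶠ (suc x) zero ⇒ᶠ notᶠ (ltᶠ zero (suc y))))

  module _ {n} (W : Window n) where

    matchedRetᶠ : (x : Fin n) → FODef n (λ s ρ → MatchedRet (win W s ρ) (ρ x))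
    matchedRetᶠ x = retag (λ s ms ρ d → mk⇔ (λ (i , _ , m) → i , m) (λ (i , m) → i , proj₁ m , m))
                          (∃ᶠ W (Mᶠ (W ↑) zero (suc x)))

    isCᶠ : (x y : Fin n) → FODef n (λ s ρ → IsC (win W s ρ) (ρ x) (ρ y))
    isCᶠ x y = retag (λ s ms ρ d → mk⇔
        (λ (dy , lt , (l , _ , u , v) , h) → dy , lt , (l , u , v) , λ j' l' a b m c → h j' (proj₁ m) l' (proj₁ (proj₂ m)) a b m c)
        (λ (dy , lt , (l , u , v) , h) → dy , lt , (l , proj₁ (proj₂ u) , u , v) , λ j' _ l' _ a b m c → h j' l' a b m c))
      (domᶠ W y andᶠ ltᶠ y x andᶠ
       ∃ᶠ W (Mᶠ (W ↑) (suc y) zero andᶠ ltᶠ (suc x) zero) andᶠ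
       ∀ᶠ W (∀ᶠ (W ↑) (ltᶠ (suc (suc y)) (suc zero) ⇒ᶠ (ltᶠ (suc zero) (suc (suc x)) ⇒ᶠ
         (Mᶠ (W ↑ ↑) (suc zero) zero ⇒ᶠ notᶠ (ltᶠ (suc (suc x)) zero))))))

    isRᶠ : (x y : Fin n) → FODef n (λ s ρ → IsR (win W s ρ) (ρ x) (ρ y))
    isRᶠ x y = retag (λ s ms ρ d → mk⇔
        (λ (dy , lt , (l , _ , u , v) , h) → dy , lt , (l , u , v) , λ l' j' a b m c → h l' (proj₁ (proj₂ m)) j' (proj₁ m) a b m c)
        (λ (dy , lt , (l , u , v) , h) → dy , lt , (l , proj₁ u , u , v) , λ l' _ j' _ a b m c → h l' j' a b m c))
      (domᶠ W y andᶠ ltᶠ x y andᶠ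
       ∃ᶠ W (Mᶠ (W ↑) zero (suc y) andᶠ ltᶠ zero (suc x)) andᶠ
       ∀ᶠ W (∀ᶠ (W ↑) (ltᶠ (suc (suc x)) (suc zero) ⇒ᶠ (ltᶠ (suc zero) (suc (suc y)) ⇒ᶠ
         (Mᶠ (W ↑ ↑) zero (suc zero) ⇒ᶠ notᶠ (ltᶠ zero (suc (suc x))))))))

  Upto : (R : ℕ → ℕ → Set) (B A : ℕ → Set) → ℕ → Set
  Upto R B A i = Σ ℕ λ j → Star R i j × A j × (∀ l → Star R i l → Star R l j → l ≢ j → B l)

  module _ {R : ℕ → ℕ → Set} {B A : ℕ → Set}
           (det : ∀ {i j j'} → R i j → R i j' → j ≡ j')
           (acyclic : ∀ {i j} → R i j → ¬ Star R j i) where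

    -- Steps being deterministic and acyclic, the positions on the path from `i` to `j` are exactly
    -- those reachable from `i` from which `j` is reachable. Paths need not be quantified.
    until⇔ : ∀ {i} → Until R B A i ⇔ Upto R B A i
    until⇔ = mk⇔ fwd (λ (j , r , q , h) → bwd r q h)
      where
      fwd : ∀ {i} → Until R B A i → Upto R B A i
      fwd (here q) = _ , εˢ , q , λ { l εˢ _ ne → ⊥-elim (ne refl) ; l (r ◅ rs) ss _ → ⊥-elim (acyclic r (rs ◅◅ ss)) }
      fwd (there p r u) with fwd u
      ... | j , rs , q , h = j , r ◅ rs , q , λ { l εˢ _ _ → p ; l (r' ◅ rs') ss ne → h l (subst (λ z → Star R z l) (det r' r) rs') ss ne }
      bwd : ∀ {i j} → Star R i j → A j → (∀ l → Star R i l → Star R l j → l ≢ j → B l) → Until R B A i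
      bwd εˢ q h = here q
      bwd (r ◅ rs) q h = there (h _ εˢ (r ◅ rs) (λ { refl → acyclic r rs })) r (bwd rs q (λ l s → h l (r ◅ s)))

  since⇔ : ∀ {R B A i} → Since R B A i ⇔ Until (λ a b → R b a) B A i
  since⇔ = mk⇔ fwd bwd
    where
    fwd : ∀ {R B A i} → Since R B A i → Until (λ a b → R b a) B A i
    fwd (here q) = here q
    fwd (there p r u) = there p r (fwd u)
    bwd : ∀ {R B A i} → Until (λ a b → R b a) B A i → Since R B A i
    bwd (here q) = here q
    bwd (there p r u) = there p r (bwd u)

  record Steps (R : Str k → ℕ → ℕ → Set) : Set₁ where
    field
      det     : ∀ {s} → IsMatching s → ∀ {i j j'} → R s i j → R s i j' → j ≡ j'
      acyclic : ∀ {s} → IsMatching s → ∀ {i j} → R s i j → ¬ Star (R s) j i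
      target  : ∀ {s i j} → R s i j → Dom s j
      reach   : Str k → ℕ → ℕ → Set
      reach⇔  : ∀ {s} → IsMatching s → ∀ {i j} → Dom s i → Dom s j → Star (R s) i j ⇔ reach s i j
      reachᶠ  : ∀ {n} (W : Window n) x y → FODef n (λ s ρ → reach (win W s ρ) (ρ x) (ρ y))
  open Steps

  module _ {R} (S : Steps R) where

    star-dom : ∀ {s i j} → Dom s i → Star (R s) i j → Dom s j
    star-dom d εˢ = d
    star-dom d (r ◅ rs) = star-dom (target S r) rs

    untilᶠ : ∀ {n} (W : Window n) x {A B : Str k → ℕ → Set} →
      FODef (suc n) (λ s ρ → Dom (win (W ↑) s ρ) (ρ zero) × A (win (W ↑) s ρ) (ρ zero)) →
      FODef (suc (suc n)) (λ s ρ → Dom (win (W ↑ ↑) s ρ) (ρ zero) × B (win (W ↑ ↑) s ρ) (ρ zero)) →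
      FODef n (λ s ρ → Dom (win W s ρ) (ρ x) × Until (R (win W s ρ)) (B (win W s ρ)) (A (win W s ρ)) (ρ x))
    untilᶠ W x {A} {B} α β = retag equiv
      (domᶠ W x andᶠ ∃ᶠ W (reachᶠ S (W ↑) (suc x) zero andᶠ α andᶠ
        ∀ᶠ (W ↑) (reachᶠ S (W ↑ ↑) (suc (suc x)) zero ⇒ᶠ (reachᶠ S (W ↑ ↑) zero (suc zero) ⇒ᶠ
          (notᶠ (eqᶠ zero (suc zero)) ⇒ᶠ β)))))
      where
      equiv : ∀ s → IsMatching s → ∀ ρ → (∀ y → Dom s (ρ y)) → let t = win W s ρ in
        (Dom t (ρ x) × Σ ℕ λ j → Dom t j × reach S t (ρ x) j × (Dom t j × A t j) ×
          (∀ l → Dom t l → reach S t (ρ x) l → reach S t l j → l ≢ j → Dom t l × B t l))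
        ⇔ (Dom t (ρ x) × Until (R t) (B t) (A t) (ρ x))
      equiv s ms ρ d = mk⇔
        (λ (dx , j , dj , r , (_ , a) , h) → dx , from (until⇔ (det S mt) (acyclic S mt))
          (j , from (reach⇔ S mt dx dj) r , a , λ l p q ne → let dl = star-dom dx p in
            proj₂ (h l dl (to (reach⇔ S mt dx dl) p) (to (reach⇔ S mt dl dj) q) ne)))
        (λ (dx , u) → let j , p , a , h = to (until⇔ (det S mt) (acyclic S mt)) u ; dj = star-dom dx p in
          dx , j , dj , to (reach⇔ S mt dx dj) p , (dj , a) , λ l dl r q ne →
            dl , h l (from (reach⇔ S mt dx dl) r) (from (reach⇔ S mt dl dj) q) ne)
        where
        mt = win-matching W d ms

  star-ind : ∀ {s : Str k} {R reach : ℕ → ℕ → Set} → (∀ {i} → Dom s i → reach i i) →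
    (∀ {i i' j} → Dom s i → Dom s i' → R i i' → reach i' j → reach i j) → (∀ {i j} → R i j → Dom s j) →
    ∀ {i j} → Dom s i → Star R i j → reach i j
  star-ind nil cons tgt di εˢ = nil di
  star-ind {s} nil cons tgt di (r ◅ rs) = cons di (tgt r) r (star-ind {s} nil cons tgt (tgt r) rs)

  linSteps : Steps LinStep
  linSteps = record
    { det = λ { _ (refl , _) (refl , _) → refl }
    ; acyclic = λ { {s} _ (refl , _) rs → <-irrefl refl (mono s rs) }
    ; target = proj₂
    ; reach = λ s i j → i ≤ j
    ; reach⇔ = λ {s} ms di dj → mk⇔ (mono s) (λ i≤j → build s di dj i≤j (≤⇒≤′ i≤j))
    ; reachᶠ = λ W x y → leᶠ x y }
    where
    mono : ∀ (s : Str k) {i j} → Star (LinStep s) i j → i ≤ j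
    mono s εˢ = ≤-refl
    mono s ((refl , _) ◅ rs) = ≤-trans (n≤1+n _) (mono s rs)
    build : ∀ (s : Str k) {i j} → Dom s i → Dom s j → i ≤ j → i ≤′ j → Star (LinStep s) i j
    build s di dj _ ≤′-refl = εˢ
    build s di dj _ (≤′-step p) = let q = ≤′⇒≤ p in
      build s di (≤-trans (proj₁ di) q , ≤B-trans (hi s) (n≤1+n _) (proj₂ dj)) q p ◅◅ ((refl , dj) ◅ εˢ)

  -- The interval `[i, j]` is closed under matching, except that a call at `j` and a return at `i`
  -- may have their partners outside. A pending call before `j` blocks the path, in accordance with
  -- the abstract steps.
  AbsReach : Str k → ℕ → ℕ → Set
  AbsReach s i j = i ≤ j ×
    (∀ c → Dom s c → i ≤ c → c < j → callP s c → Σ ℕ λ r → Dom s r × M s c r × r ≤ j) ×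
    (∀ r → Dom s r → ∀ c → Dom s c → M s c r → i < r → r ≤ j → i ≤ c)

  absSteps : Steps AbsStep
  absSteps = record
    { det = det'
    ; acyclic = λ ms r rs → <⇒≱ (mono ms r) (monos ms rs)
    ; target = λ { (inj₁ (_ , d , _)) → d ; (inj₂ (_ , _ , _ , d)) → d }
    ; reach = AbsReach
    ; reach⇔ = λ {s} ms {i} {j} di dj → mk⇔
         (star-ind {s} {AbsStep s} {AbsReach s} (λ _ → reach-refl {s}) (λ di di' → reach-cons ms di) (λ { (inj₁ (_ , d , _)) → d ; (inj₂ (_ , _ , _ , d)) → d }) di)
         (λ q → build ms j di dj q (m≤n+m j i))
    ; reachᶠ = λ W x y → leᶠ x y andᶠ
        ∀ᶠ W (leᶠ (suc x) zero ⇒ᶠ (ltᶠ zero (suc y) ⇒ᶠ (callᶠ zero ⇒ᶠ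
          ∃ᶠ (W ↑) (Mᶠ (W ↑ ↑) (suc zero) zero andᶠ leᶠ zero (suc (suc y)))))) andᶠ
        ∀ᶠ W (∀ᶠ (W ↑) (Mᶠ (W ↑ ↑) zero (suc zero) ⇒ᶠ (ltᶠ (suc (suc x)) (suc zero) ⇒ᶠ
          (leᶠ (suc zero) (suc (suc y)) ⇒ᶠ leᶠ (suc (suc x)) zero)))) }
    where
    det' : ∀ {s : Str k} → IsMatching s → ∀ {i j j'} → AbsStep s i j → AbsStep s i j' → j ≡ j'
    det' ms (inj₁ m) (inj₁ m') = M-fun ms m m'
    det' ms (inj₁ m) (inj₂ (nc , _)) = ⊥-elim (nc (M-call ms m))
    det' ms (inj₂ (nc , _)) (inj₁ m) = ⊥-elim (nc (M-call ms m))
    det' ms (inj₂ (_ , _ , refl , _)) (inj₂ (_ , _ , refl , _)) = refl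
    mono : ∀ {s : Str k} → IsMatching s → ∀ {i j} → AbsStep s i j → i < j
    mono ms (inj₁ m) = M-< ms m
    mono ms (inj₂ (_ , _ , refl , _)) = ≤-refl
    monos : ∀ {s : Str k} → IsMatching s → ∀ {i j} → Star (AbsStep s) i j → i ≤ j
    monos ms εˢ = ≤-refl
    monos ms (r ◅ rs) = ≤-trans (<⇒≤ (mono ms r)) (monos ms rs)
    reach-refl : ∀ {s : Str k} {i} → AbsReach s i i
    reach-refl = ≤-refl , (λ c _ p q _ → ⊥-elim (<⇒≱ q p)) , (λ r _ c _ _ p q → ⊥-elim (<⇒≱ p q))
    reach-cons : ∀ {s : Str k} → IsMatching s → ∀ {i i' j} → Dom s i → AbsStep s i i' → AbsReach s i' j → AbsReach s i j
    reach-cons {s} ms {i} {r} {j} di (inj₁ m) (r≤j , A , B) = ≤-trans (<⇒≤ (M-< ms m)) r≤j , A' , B'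
      where
      A' : ∀ c → Dom s c → i ≤ c → c < j → callP s c → Σ ℕ λ r → Dom s r × M s c r × r ≤ j
      A' c dc i≤c c<j cc with m≤n⇒m<n∨m≡n i≤c
      ... | inj₂ refl = r , proj₁ (proj₂ m) , m , r≤j
      ... | inj₁ i<c with c <? r
      ... | no c≮r = A c dc (≮⇒≥ c≮r) c<j cc
      ... | yes c<r with nest ms dc (proj₁ (proj₂ m)) (<⇒≤ c<r) cc (M-ret ms m)
      ... | l , _ , l≤r , inj₁ u = l , proj₁ (proj₂ u) , u , ≤-trans l≤r r≤j
      ... | l , c≤l , _ , inj₂ u with M-inj ms u m
      ... | refl = ⊥-elim (<⇒≱ i<c c≤l)
      B' : ∀ r' → Dom s r' → ∀ c → Dom s c → M s c r' → i < r' → r' ≤ j → i ≤ c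
      B' r' dr' c dc u i<r' r'≤j with r <? r'
      ... | yes r<r' = ≤-trans (<⇒≤ (M-< ms m)) (B r' dr' c dc u r<r' r'≤j)
      ... | no r≮r' with c <? i
      ... | no c≮i = ≮⇒≥ c≮i
      ... | yes c<i with m≤n⇒m<n∨m≡n (≮⇒≥ r≮r')
      ... | inj₁ r'<r = ⊥-elim (nocross ms u m c<i (<⇒≤ i<r') r'<r)
      ... | inj₂ refl = ≤-reflexive (M-inj ms m u)
    reach-cons {s} ms {i} {_} {j} di (inj₂ (nc , nr , refl , ds)) (i<j , A , B) = <⇒≤ i<j , A' , B'
      where
      A' : ∀ c → Dom s c → i ≤ c → c < j → callP s c → Σ ℕ λ r → Dom s r × M s c r × r ≤ j
      A' c dc i≤c c<j cc with m≤n⇒m<n∨m≡n i≤c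
      ... | inj₂ refl = ⊥-elim (nc cc)
      ... | inj₁ i<c = A c dc i<c c<j cc
      B' : ∀ r' → Dom s r' → ∀ c → Dom s c → M s c r' → i < r' → r' ≤ j → i ≤ c
      B' r' dr' c dc u i<r' r'≤j with m≤n⇒m<n∨m≡n i<r'
      ... | inj₂ refl = ⊥-elim (nr (c , u))
      ... | inj₁ lt = <⇒≤ (B r' dr' c dc u lt r'≤j)
    -- `n` bounds the distance left to `j`. A matched call jumps to its return, and the condition on
    -- the interval survives because an edge from inside the skipped block to beyond it would cross.
    build : ∀ {s : Str k} → IsMatching s → ∀ n {i j} → Dom s i → Dom s j → AbsReach s i j → j ≤ i + n → Star (AbsStep s) i j
    build {s} ms n {i} {j} di dj (i≤j , A , B) le with m≤n⇒m<n∨m≡n i≤j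
    ... | inj₂ refl = εˢ
    build {s} ms zero {i} {j} di dj (i≤j , A , B) le | inj₁ i<j = ⊥-elim (<⇒≱ i<j (subst (j ≤_) (+-identityʳ i) le))
    build {s} ms (suc n) {i} {j} di dj (i≤j , A , B) le | inj₁ i<j with em {callP s i}
    ... | yes ci with A i di ≤-refl i<j ci
    ... | r , dr , m , r≤j = inj₁ m ◅ build ms n dr dj
          (r≤j , (λ c dc r≤c → A c dc (≤-trans (<⇒≤ (M-< ms m)) r≤c)) , B') (fuel (M-< ms m))
      where
      fuel : ∀ {i'} → i < i' → j ≤ i' + n
      fuel {i'} lt = ≤-trans (subst (j ≤_) (+-suc i n) le) (+-monoˡ-≤ n lt)
      B' : ∀ r' → Dom s r' → ∀ c → Dom s c → M s c r' → r < r' → r' ≤ j → r ≤ c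
      B' r' dr' c dc u r<r' r'≤j with r ≤? c
      ... | yes p = p
      ... | no r≰c with m≤n⇒m<n∨m≡n (B r' dr' c dc u (<-trans (M-< ms m) r<r') r'≤j)
      ... | inj₁ i<c = ⊥-elim (nocross ms m u i<c (<⇒≤ (≰⇒> r≰c)) r<r')
      ... | inj₂ refl = ⊥-elim (<⇒≢ r<r' (M-fun ms m u))
    build {s} ms (suc n) {i} {j} di dj (i≤j , A , B) le | inj₁ i<j | no nc =
      inj₂ (nc , nr , refl , ds) ◅ build ms n ds dj (i<j , (λ c dc p → A c dc (<⇒≤ p)) , B') (subst (j ≤_) (+-suc i n) le)
      where
      ds : Dom s (suc i)
      ds = ≤-trans (proj₁ di) (n≤1+n _) , ≤B-trans (hi s) i<j (proj₂ dj)
      nr : ¬ MatchedRet s (suc i)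
      nr (c , u) with m≤n⇒m<n∨m≡n (B (suc i) ds c (proj₁ u) u ≤-refl i<j)
      ... | inj₁ i<c = <⇒≱ i<c (s≤s⁻¹ (M-< ms u))
      ... | inj₂ refl = nc (M-call ms u)
      B' : ∀ r' → Dom s r' → ∀ c → Dom s c → M s c r' → suc i < r' → r' ≤ j → suc i ≤ c
      B' r' dr' c dc u lt r'≤j with m≤n⇒m<n∨m≡n (B r' dr' c dc u (<⇒≤ lt) r'≤j)
      ... | inj₁ i<c = i<c
      ... | inj₂ refl = ⊥-elim (nc (M-call ms u))

  -- `Since` follows its path backwards, hence the reversed steps. Iterating C from a position
  -- visits precisely the calls of the blocks that enclose it.
  callSteps : Steps (λ s i j → CallStep s j i)
  callSteps = record
    { det = λ {s} _ → C-unique {s = s}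
    ; acyclic = λ {s} ms r rs → <⇒≱ (proj₁ (proj₂ r)) (mono s rs)
    ; target = proj₁
    ; reach = CallReach
    ; reach⇔ = λ {s} ms {i} {j} di dj → mk⇔
         (star-ind {s} {λ i j → IsC s i j} {CallReach s} (λ _ → inj₁ refl) (λ _ _ → reach-cons ms) proj₁ di)
         (build ms i dj ≤-refl)
    ; reachᶠ = λ W x y → retag (λ s ms ρ d → mk⇔
          (λ { (inj₁ e) → inj₁ e ; (inj₂ (a , l , _ , p)) → inj₂ (a , l , p) })
          (λ { (inj₁ e) → inj₁ e ; (inj₂ (a , l , p)) → inj₂ (a , l , proj₁ (proj₂ (proj₁ p)) , p) }))
        (eqᶠ y x orᶠ (ltᶠ y x andᶠ ∃ᶠ W (Mᶠ (W ↑) (suc y) zero andᶠ ltᶠ (suc x) zero))) }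
    where
    CallReach : Str k → ℕ → ℕ → Set
    CallReach s i j = j ≡ i ⊎ Encl s i j
    mono : ∀ (s : Str k) {i j} → Star (IsC s) i j → j ≤ i
    mono s εˢ = ≤-refl
    mono s (r ◅ rs) = ≤-trans (mono s rs) (<⇒≤ (proj₁ (proj₂ r)))
    reach-cons : ∀ {s : Str k} → IsMatching s → ∀ {i i' j} → IsC s i i' → CallReach s i' j → CallReach s i j
    reach-cons ms (_ , c<i , e , _) (inj₁ refl) = inj₂ (c<i , e)
    reach-cons ms {i} {c} {j} (_ , c<i , (rc , v , i<rc) , _) (inj₂ (j<c , l , u , c<l)) = inj₂ (<-trans j<c c<i , l , u , i<l)
      where
      i<l : i < l
      i<l with l <? rc
      ... | yes l<rc = ⊥-elim (nocross ms u v j<c (<⇒≤ c<l) l<rc)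
      ... | no l≮rc = <-≤-trans i<rc (≮⇒≥ l≮rc)
    build : ∀ {s : Str k} → IsMatching s → ∀ n {i j} → Dom s j → i ≤ n → CallReach s i j → Star (IsC s) i j
    build ms n dj le (inj₁ refl) = εˢ
    build ms zero dj z≤n (inj₂ (() , _))
    build {s} ms (suc n) {i} {j} dj le (inj₂ e@(j<i , l , u , i<l)) with encl⇒C {s = s} e
    ... | c , j≤c , isc@(_ , c<i , (rc , v , i<rc) , _) = isc ◅ build ms n dj (s≤s⁻¹ (<-≤-trans c<i le)) next'
      where
      next' : CallReach s c j
      next' with m≤n⇒m<n∨m≡n j≤c
      ... | inj₂ p = inj₁ p
      ... | inj₁ j<c = inj₂ (j<c , l , u , <-trans c<i i<l)

  -- The window follows nested uses of C and R. Variables range over the whole structure and may lie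
  -- outside the window, so membership in it is part of the claim.
  toFO : (φ : CaRet k) → ∀ {n} (W : Window n) (x : Fin n) →
         FODef n (λ s ρ → Dom (win W s ρ) (ρ x) × Sat (win W s ρ) φ (ρ x))
  toFO top W x = domᶠ W x andᶠ trueᶠ x λ _ _ _ → tt
  toFO (lett a) W x = domᶠ W x andᶠ (P a x , λ _ _ _ _ → ⇔-refl)
  toFO pret W x = domᶠ W x andᶠ domᶠ W x andᶠ retᶠ x andᶠ notᶠ (matchedRetᶠ W x)
  toFO call W x = domᶠ W x andᶠ callᶠ x
  toFO ret W x = domᶠ W x andᶠ retᶠ x
  toFO (neg φ) W x = retag (λ _ _ _ _ → mk⇔ (λ (d , n) → d , λ p → n (d , p)) (λ (d , n) → d , λ (_ , p) → n p))
    (domᶠ W x andᶠ notᶠ (toFO φ W x))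
  toFO (φ or ψ) W x = retag (λ _ _ _ _ → mk⇔
      (λ { (inj₁ (d , p)) → d , inj₁ p ; (inj₂ (d , p)) → d , inj₂ p })
      (λ { (d , inj₁ p) → inj₁ (d , p) ; (d , inj₂ p) → inj₂ (d , p) }))
    (toFO φ W x orᶠ toFO ψ W x)
  toFO (next φ) W x = retag (λ _ _ _ _ → mk⇔
      (λ { (_ , _ , (dx , _ , refl) , d , p) → dx , d , p })
      (λ (dx , d , p) → _ , d , (dx , d , refl) , d , p))
    (∃ᶠ W (sucᶠ (W ↑) (suc x) zero andᶠ toFO φ (W ↑) zero))
  toFO (nextμ φ) W x = retag (λ _ _ _ _ → mk⇔
      (λ (j , _ , m , _ , p) → proj₁ m , j , m , p)
      (λ (_ , j , m , p) → let d = proj₁ (proj₂ m) in j , d , m , d , p))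
    (∃ᶠ W (Mᶠ (W ↑) (suc x) zero andᶠ toFO φ (W ↑) zero))
  toFO (prevC φ) W x = retag (λ _ _ _ _ → mk⇔
      (λ (dx , j , _ , c , _ , p) → dx , j , c , p)
      (λ (dx , j , c , p) → dx , j , proj₁ c , c , proj₁ c , p))
    (domᶠ W x andᶠ ∃ᶠ W (isCᶠ (W ↑) (suc x) zero andᶠ toFO φ (W ↑) zero))
  toFO (φ U ψ) W x = untilᶠ linSteps W x {λ s → Sat s ψ} {λ s → Sat s φ} (toFO ψ (W ↑) zero) (toFO φ (W ↑ ↑) zero)
  toFO (φ Ua ψ) W x = untilᶠ absSteps W x {λ s → Sat s ψ} {λ s → Sat s φ} (toFO ψ (W ↑) zero) (toFO φ (W ↑ ↑) zero)
  toFO (φ Sc ψ) W x = retag (λ _ _ _ _ → ⇔-refl ×-⇔ ⇔-sym since⇔)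
    (untilᶠ callSteps W x {λ s → Sat s ψ} {λ s → Sat s φ} (toFO ψ (W ↑) zero) (toFO φ (W ↑ ↑) zero))
  toFO (prev φ) W x = retag (λ _ _ _ _ → mk⇔
      (λ (j , _ , (dj , dx , e) , _ , p) → dx , j , sym e , dj , p)
      (λ (dx , j , e , dj , p) → j , dj , (dj , dx , sym e) , dj , p))
    (∃ᶠ W (sucᶠ (W ↑) zero (suc x) andᶠ toFO φ (W ↑) zero))
  toFO (Cop φ) W x = retag (λ s ms ρ d → mk⇔
      (λ { (dx , inj₁ (j , _ , c , _ , p)) → dx , inj₁ (j , c , p)
         ; (dx , inj₂ (n , j , dj , least , _ , p)) → dx , inj₂ ((λ (j' , c) → n (j' , proj₁ c , c)) ,
             subst (Sat _ φ) (≤-antisym (least _ (≤-refl , lo-in (win W s ρ) dx)) (proj₁ dj)) p) })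
      (λ { (dx , inj₁ (j , c , p)) → dx , inj₁ (j , proj₁ c , c , (≤-refl , <⇒≤ (proj₁ (proj₂ c))) , p)
         ; (dx , inj₂ (n , p)) → dx , inj₂ ((λ (j' , _ , c) → n (j' , c)) , _ , (≤-refl , lo-in (win W s ρ) dx) , (λ _ q → proj₁ q) ,
             (≤-refl , proj₁ dx) , p) }))
    (domᶠ W x andᶠ
      (∃ᶠ W (isCᶠ (W ↑) (suc x) zero andᶠ toFO φ (downTo (upTo (W ↑) (suc x)) zero) zero)
       orᶠ (notᶠ (∃ᶠ W (isCᶠ (W ↑) (suc x) zero)) andᶠ
            -- The first position of the window is not named by a variable and is quantified as the
            -- least one.
            ∃ᶠ W (∀ᶠ (W ↑) (leᶠ (suc zero) zero) andᶠ toFO φ (upTo (W ↑) (suc x)) zero))))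
    where
    lo-in : ∀ (s : Str k) {i} → Dom s i → lo s ≤B hi s
    lo-in s (a , b) = ≤B-trans (hi s) a b
  toFO (Rop φ) W x = retag (λ s ms ρ d → mk⇔
      (λ { (dx , inj₁ (l , _ , c , _ , p)) → dx , inj₁ (l , c , p)
         ; (dx , inj₂ (n , _ , p)) → dx , inj₂ ((λ (j' , c) → n (j' , proj₁ c , c)) , p) })
      (λ { (dx , inj₁ (l , c , p)) → dx , inj₁ (l , proj₁ c , c , (≤-refl , <⇒≤ (proj₁ (proj₂ c))) , p)
         ; (dx , inj₂ (n , p)) → dx , inj₂ ((λ (j' , _ , c) → n (j' , c)) , (≤-refl , proj₂ dx) , p) }))
    (domᶠ W x andᶠ
      (∃ᶠ W (isRᶠ (W ↑) (suc x) zero andᶠ toFO φ (downTo (upTo (W ↑) zero) (suc x)) (suc x))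
       orᶠ (notᶠ (∃ᶠ W (isRᶠ (W ↑) (suc x) zero)) andᶠ toFO φ (downTo W x) x)))

-- Finite aperiodic algebras for nested words with marks.

module Algebras (em : ExcludedMiddle 0ℓ) (k : ℕ) where
  open Classical em

  Letter : ℕ → Set
  Letter j = Fin k × Bool × Bool × Vec Bool j

  Marks : ℕ → Set
  Marks j = ℕ → Vec Bool j

  letterAt : ∀ {j} → Str k → Marks j → ℕ → Letter j
  letterAt s m p = lab s p , dec (callP s p) , dec (retP s p) , m p

  -- `_·_` is concatenation at a place crossed by no edge, and `F` closes a word to a matched block.
  -- `val` is a function on structures that respects these two decompositions, not an evaluation of
  -- terms; so it also covers infinite structures, which are no finite product. `Good` contains the
  -- one-hole contexts and their composites.
  record Algebra (j : ℕ) : Set₂ where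
    infixr 6 _·_
    field
      H        : Set
      finite   : Finite H
      _·_      : H → H → H
      ε        : H
      letter   : Letter j → H
      F        : Letter j → Letter j → H → H
      Good     : (H → H) → Set₁
      good-id  : Good id
      good-∘   : ∀ {f g} → Good f → Good g → Good (f ∘ g)
      good-L   : ∀ u → Good (u ·_)
      good-R   : ∀ u → Good (_· u)
      good-F   : ∀ x y → Good (F x y)
      aper     : ∀ {f} → Good f → Σ ℕ λ N → ∀ h → fold h f N ≡ fold h f (suc N)
      val      : Str k → Marks j → H
      val-ext    : ∀ s {m m'} → (∀ q → Dom s q → m q ≡ m' q) → val s m ≡ val s m'
      val-empty  : ∀ s m → (∀ q → ¬ Dom s q) → val s m ≡ ε
      val-letter : ∀ s m p → IsMatching (sub s p (fin p)) → val (sub s p (fin p)) m ≡ letter (letterAt s m p)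
      val-concat : ∀ s m c → IsMatching s → lo s ≤ suc c → c ≤B hi s → (∀ i j → M s i j → i ≤ c → c < j → ⊥) →
                   val s m ≡ val (sub s (lo s) (fin c)) m · val (sub s (suc c) (hi s)) m
      val-block  : ∀ s m c r → IsMatching (sub s c (fin (suc r))) → M (sub s c (fin (suc r))) c (suc r) →
                   val (sub s c (fin (suc r))) m ≡ F (letterAt s m c) (letterAt s m (suc r)) (val (sub s (suc c) (fin r)) m)

  fold-stable : ∀ {H : Set} {f : H → H} {N} → (∀ h → fold h f N ≡ fold h f (suc N)) →
                ∀ {n} → N ≤ n → ∀ h → fold h f n ≡ fold h f (suc n)
  fold-stable {f = f} {N} e {n} N≤n h with ≤⇒≤′ N≤n
  ... | ≤′-refl = e h
  ... | ≤′-step p = cong f (fold-stable {f = f} e (≤′⇒≤ p) h)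

  dec-⊎ : ∀ (A B : Set) → dec (A ⊎ B) ≡ dec A ∨ dec B
  dec-⊎ A B with em {A} | em {B}
  ... | yes a | _ = ⇒dec (inj₁ a)
  ... | no ¬a | yes b = ⇒dec (inj₂ b)
  ... | no ¬a | no ¬b = ⇒dec-false [ ¬a , ¬b ]′

  dec-× : ∀ (A B : Set) → dec (A × B) ≡ dec A ∧ dec B
  dec-× A B with em {A} | em {B}
  ... | yes a | yes b = ⇒dec (a , b)
  ... | yes a | no ¬b = ⇒dec-false (¬b ∘ proj₂)
  ... | no ¬a | _ = ⇒dec-false (¬a ∘ proj₁)

  dec-bool : ∀ b → dec (b ≡ true) ≡ b
  dec-bool true = ⇒dec refl
  dec-bool false = ⇒dec-false λ ()

  module Split (s : Str k) (c : ℕ) (lo≤ : lo s ≤ suc c) (≤hi : c ≤B hi s) where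
    left right : Str k
    left = sub s (lo s) (fin c)
    right = sub s (suc c) (hi s)

    split : ∀ {q} → Dom s q → Dom left q ⊎ Dom right q
    split {q} (a , b) with q ≤? c
    ... | yes q≤c = inj₁ (a , q≤c)
    ... | no q≰c = inj₂ (≰⇒> q≰c , b)

    left⊆ : ∀ {q} → Dom left q → Dom s q
    left⊆ (a , b) = a , ≤B-trans (hi s) b ≤hi

    right⊆ : ∀ {q} → Dom right q → Dom s q
    right⊆ (a , b) = ≤-trans lo≤ a , b

  -- One algebra serving all atomic formulas.

  module Atomic {j : ℕ} (α β γ : Letter j → Bool) (δ : Letter j → Letter j → Bool) where

    B³ : Set
    B³ = Bool × Bool × Bool

    infixr 6 _·_
    -- The bits record that `α` occurs, that `β` occurs, and that the goal is met: `γ` occurs, or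
    -- some `α` precedes some `β`, or an edge satisfies `δ`. Concatenation can create a new pair,
    -- with `α` on the left and `β` on the right.
    _·_ : B³ → B³ → B³
    (a , b , c) · (a' , b' , c') = a ∨ a' , b ∨ b' , (c ∨ c') ∨ (a ∧ b')

    flag : Bool → B³ → B³
    flag d (a , b , c) = a , b , c ∨ d

    letter : Letter j → B³
    letter l = α l , β l , γ l

    Has : (Letter j → Bool) → Str k → Marks j → Set
    Has t s m = Σ ℕ λ p → Dom s p × t (letterAt s m p) ≡ true

    Pair : Str k → Marks j → Set
    Pair s m = Σ ℕ λ p → Σ ℕ λ q → Dom s p × Dom s q × p < q × α (letterAt s m p) ≡ true × β (letterAt s m q) ≡ true

    Arc : Str k → Marks j → Set
    Arc s m = Σ ℕ λ c → Σ ℕ λ r → M s c r × δ (letterAt s m c) (letterAt s m r) ≡ true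

    -- The part of the value that ignores the matching is multiplicative at every cut, even one
    -- crossed by edges. The two ends of a block can thus be split off; the edges are accounted for
    -- by `flag` alone.
    flat : Str k → Marks j → B³
    flat s m = dec (Has α s m) , dec (Has β s m) , dec (Has γ s m ⊎ Pair s m)

    val : Str k → Marks j → B³
    val s m = flag (dec (Arc s m)) (flat s m)

    triple : ∀ {a a' b b' c c' : Bool} → a ≡ a' → b ≡ b' → c ≡ c' → (a , b , c) ≡ (a' , b' , c')
    triple refl refl refl = refl

    ∨-swap : ∀ x d y → (x ∨ d) ∨ y ≡ (x ∨ y) ∨ d
    ∨-swap true d y = refl
    ∨-swap false true true = refl
    ∨-swap false true false = refl
    ∨-swap false false true = refl
    ∨-swap false false false = refl

    flag-·ˡ : ∀ d g h → flag d g · h ≡ flag d (g · h)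
    flag-·ˡ d (a , b , c) (a' , b' , c') =
      triple refl refl (trans (cong (_∨ (a ∧ b')) (∨-swap c d c')) (∨-swap (c ∨ c') d (a ∧ b')))

    flag-·ʳ : ∀ d g h → g · flag d h ≡ flag d (g · h)
    flag-·ʳ d (a , b , c) (a' , b' , c') =
      triple refl refl (trans (cong (_∨ (a ∧ b')) (sym (∨-assoc c c' d))) (∨-swap (c ∨ c') d (a ∧ b')))

    flag-flag : ∀ d e h → flag d (flag e h) ≡ flag (e ∨ d) h
    flag-flag d e (a , b , c) = triple refl refl (∨-assoc c e d)

    module _ (s : Str k) (m : Marks j) (c : ℕ) (lo≤ : lo s ≤ suc c) (≤hi : c ≤B hi s) where
      open Split s c lo≤ ≤hi

      has-concat : ∀ t → Has t s m ⇔ (Has t left m ⊎ Has t right m)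
      has-concat t = mk⇔ (λ (p , d , e) → [ (λ d' → inj₁ (p , d' , e)) , (λ d' → inj₂ (p , d' , e)) ]′ (split d))
                         [ (λ (p , d , e) → p , left⊆ d , e) , (λ (p , d , e) → p , right⊆ d , e) ]′

      third-concat : (Has γ s m ⊎ Pair s m) ⇔
        (((Has γ left m ⊎ Pair left m) ⊎ (Has γ right m ⊎ Pair right m)) ⊎ (Has α left m × Has β right m))
      third-concat = mk⇔ fwd bwd
        where
        fwd : Has γ s m ⊎ Pair s m →
          ((Has γ left m ⊎ Pair left m) ⊎ (Has γ right m ⊎ Pair right m)) ⊎ (Has α left m × Has β right m)
        fwd (inj₁ h) = inj₁ ([ inj₁ ∘ inj₁ , inj₂ ∘ inj₁ ]′ (to (has-concat γ) h))
        fwd (inj₂ (p , q , dp , dq , p<q , a , b)) with split dp | split dq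
        ... | inj₁ dp' | inj₁ dq' = inj₁ (inj₁ (inj₂ (p , q , dp' , dq' , p<q , a , b)))
        ... | inj₂ dp' | inj₂ dq' = inj₁ (inj₂ (inj₂ (p , q , dp' , dq' , p<q , a , b)))
        ... | inj₁ dp' | inj₂ dq' = inj₂ ((p , dp' , a) , (q , dq' , b))
        ... | inj₂ dp' | inj₁ dq' = ⊥-elim (<⇒≱ (<-trans (proj₁ dp') p<q) (proj₂ dq'))
        bwd : ((Has γ left m ⊎ Pair left m) ⊎ (Has γ right m ⊎ Pair right m)) ⊎ (Has α left m × Has β right m) →
          Has γ s m ⊎ Pair s m
        bwd (inj₁ (inj₁ (inj₁ h))) = inj₁ (from (has-concat γ) (inj₁ h))
        bwd (inj₁ (inj₁ (inj₂ (p , q , dp , dq , r)))) = inj₂ (p , q , left⊆ dp , left⊆ dq , r)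
        bwd (inj₁ (inj₂ (inj₁ h))) = inj₁ (from (has-concat γ) (inj₂ h))
        bwd (inj₁ (inj₂ (inj₂ (p , q , dp , dq , r)))) = inj₂ (p , q , right⊆ dp , right⊆ dq , r)
        bwd (inj₂ ((p , dp , a) , (q , dq , b))) =
          inj₂ (p , q , left⊆ dp , right⊆ dq , ≤-trans (s≤s (proj₂ dp)) (proj₁ dq) , a , b)

      flat-concat : flat s m ≡ flat left m · flat right m
      flat-concat = triple (trans (dec-cong (has-concat α)) (dec-⊎ _ _)) (trans (dec-cong (has-concat β)) (dec-⊎ _ _))
        (trans (dec-cong third-concat) (trans (dec-⊎ _ _) (cong₂ _∨_ (dec-⊎ _ _) (dec-× _ _))))

    flat-letter : ∀ s m p → flat (sub s p (fin p)) m ≡ letter (letterAt s m p)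
    flat-letter s m p = triple (single α) (single β)
        (trans (dec-cong (mk⇔ [ id , (λ (_ , _ , (a , _) , (_ , b) , lt , _) → ⊥-elim (<⇒≱ lt (≤-trans b a))) ]′ inj₁)) (single γ))
      where
      single : ∀ t → dec (Has t (sub s p (fin p)) m) ≡ t (letterAt s m p)
      single t = trans (dec-cong (mk⇔ (λ (q , (a , b) , e) → subst (λ z → t (letterAt s m z) ≡ true) (≤-antisym b a) e)
                                      (λ e → p , (≤-refl , ≤-refl) , e))) (dec-bool _)

    F : Letter j → Letter j → B³ → B³
    F x y h = flag (δ x y) (letter x · h · letter y)

    val-block : ∀ s m c r → IsMatching (sub s c (fin (suc r))) → M (sub s c (fin (suc r))) c (suc r) →
                val (sub s c (fin (suc r))) m ≡ F (letterAt s m c) (letterAt s m (suc r)) (val (sub s (suc c) (fin r)) m)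
    val-block s m c r ms u = begin
      flag (dec (Arc t m)) (flat t m)
        ≡⟨ cong₂ flag (trans (dec-cong arc) (dec-⊎ _ _)) flat-block ⟩
      flag (dec (Arc t' m) ∨ dec (δ x y ≡ true)) (letter x · flat t' m · letter y)
        ≡⟨ cong (λ z → flag (dec (Arc t' m) ∨ z) (letter x · flat t' m · letter y)) (dec-bool (δ x y)) ⟩
      flag (dec (Arc t' m) ∨ δ x y) (letter x · flat t' m · letter y)
        ≡⟨ flag-flag (δ x y) (dec (Arc t' m)) _ ⟨
      flag (δ x y) (flag (dec (Arc t' m)) (letter x · flat t' m · letter y))
        ≡⟨ cong (flag (δ x y)) (flag-·ʳ _ (letter x) _) ⟨
      flag (δ x y) (letter x · flag (dec (Arc t' m)) (flat t' m · letter y))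
        ≡⟨ cong (λ z → flag (δ x y) (letter x · z)) (flag-·ˡ _ (flat t' m) (letter y)) ⟨
      F x y (val t' m) ∎
      where
      open ≡-Reasoning
      t t' : Str k
      t = sub s c (fin (suc r))
      t' = sub s (suc c) (fin r)
      x y : Letter j
      x = letterAt s m c
      y = letterAt s m (suc r)
      c≤r : c ≤ r
      c≤r = s≤s⁻¹ (M-< ms u)
      flat-block : flat t m ≡ letter x · flat t' m · letter y
      flat-block = trans (flat-concat t m c (n≤1+n c) (≤-trans c≤r (n≤1+n r)))
        (cong₂ _·_ (flat-letter s m c)
          (trans (flat-concat (sub s (suc c) (fin (suc r))) m r (s≤s c≤r) (n≤1+n r))
            (cong (flat t' m ·_) (flat-letter s m (suc r)))))
      arc : Arc t m ⇔ (Arc t' m ⊎ δ x y ≡ true)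
      arc = mk⇔ fwd [ (λ (c' , r' , (dc , dr , v) , e) → c' , r' , (wide dc , wide dr , v) , e) , (λ e → c , suc r , u , e) ]′
        where
        wide : ∀ {q} → Dom t' q → Dom t q
        wide (a , b) = <⇒≤ a , m≤n⇒m≤1+n b
        fwd : Arc t m → Arc t' m ⊎ δ x y ≡ true
        fwd (c' , r' , v@((c≤c' , _) , (_ , r'≤r) , w) , e) with m≤n⇒m<n∨m≡n c≤c'
        ... | inj₂ refl rewrite M-fun ms v u = inj₂ e
        ... | inj₁ c<c' with m≤n⇒m<n∨m≡n r'≤r
        ... | inj₂ refl rewrite M-inj ms v u = inj₂ e
        ... | inj₁ r'<r = inj₁ (c' , r' , ((c<c' , ≤-trans (<⇒≤ (M-< ms v)) (s≤s⁻¹ r'<r)) ,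
                                           (<⇒≤ (≤-trans (s≤s c<c') (M-< ms v)) , s≤s⁻¹ r'<r) , w) , e)

    -- All the maps involved are inflationary for the componentwise order, in
    -- which chains have at most three strict steps.
    infix 4 _⊑_ _⊑₁_
    _⊑₁_ : Bool → Bool → Set
    a ⊑₁ b = a ≡ true → b ≡ true

    _⊑_ : B³ → B³ → Set
    (a , b , c) ⊑ (a' , b' , c') = a ⊑₁ a' × b ⊑₁ b' × c ⊑₁ c'

    ∨-⊑ˡ : ∀ {a} b → a ⊑₁ (a ∨ b)
    ∨-⊑ˡ b refl = refl

    ∨-⊑ʳ : ∀ a {b} → b ⊑₁ (a ∨ b)
    ∨-⊑ʳ a refl = ∨-zeroʳ a

    bit : Bool → ℕ
    bit true = 1
    bit false = 0

    rank : B³ → ℕ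
    rank (a , b , c) = bit a + (bit b + bit c)

    bit-≤1 : ∀ b → bit b ≤ 1
    bit-≤1 true = ≤-refl
    bit-≤1 false = z≤n

    ⊑₁-rank : ∀ {a b} → a ⊑₁ b → bit a < bit b ⊎ a ≡ b
    ⊑₁-rank {true} {b} f = inj₂ (sym (f refl))
    ⊑₁-rank {false} {true} f = inj₁ ≤-refl
    ⊑₁-rank {false} {false} f = inj₂ refl

    sum-rank : ∀ {A B : Set} {x x' : A} {y y' : B} {a a' b b'} →
               a < a' ⊎ (x ≡ x' × a ≡ a') → b < b' ⊎ (y ≡ y' × b ≡ b') → a + b < a' + b' ⊎ ((x , y) ≡ (x' , y') × a + b ≡ a' + b')
    sum-rank (inj₁ p) (inj₁ q) = inj₁ (+-mono-< p q)
    sum-rank (inj₁ p) (inj₂ (refl , refl)) = inj₁ (+-monoˡ-< _ p)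
    sum-rank {a = a} (inj₂ (refl , refl)) (inj₁ q) = inj₁ (+-monoʳ-< a q)
    sum-rank (inj₂ (refl , refl)) (inj₂ (refl , refl)) = inj₂ (refl , refl)

    ⊑-rank : ∀ {h g} → h ⊑ g → rank h < rank g ⊎ h ≡ g
    ⊑-rank (p , q , r) = [ inj₁ , inj₂ ∘ proj₁ ]′ (sum-rank (one p) (sum-rank (one q) (one r)))
      where
      one : ∀ {a b} → a ⊑₁ b → bit a < bit b ⊎ (a ≡ b × bit a ≡ bit b)
      one f = [ inj₁ , (λ e → inj₂ (e , cong bit e)) ]′ (⊑₁-rank f)

    rank-≤3 : ∀ h → rank h ≤ 3
    rank-≤3 (a , b , c) = +-mono-≤ (bit-≤1 a) (+-mono-≤ (bit-≤1 b) (bit-≤1 c))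

    inflationary-aper : ∀ {f} → (∀ h → h ⊑ f h) → ∀ h → fold h f 4 ≡ fold h f 5
    inflationary-aper {f} infl h with climb 4
      where
      climb : ∀ n → n ≤ rank (fold h f n) ⊎ fold h f n ≡ fold h f (suc n)
      climb zero = inj₁ z≤n
      climb (suc n) with climb n
      ... | inj₂ e = inj₂ (cong f e)
      ... | inj₁ p with ⊑-rank (infl (fold h f n))
      ... | inj₁ q = inj₁ (≤-trans (s≤s p) q)
      ... | inj₂ e = inj₂ (cong f e)
    ... | inj₂ e = e
    ... | inj₁ p = ⊥-elim (<⇒≱ (s≤s (rank-≤3 (fold h f 4))) p)

    atomic : Algebra j
    atomic = record
      { H = B³
      ; finite = finite-× finite-Bool (finite-× finite-Bool finite-Bool)
      ; _·_ = _·_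
      ; ε = false , false , false
      ; letter = letter
      ; F = F
      ; Good = λ f → Lift _ (∀ h → h ⊑ f h)
      ; good-id = lift λ _ → id , id , id
      ; good-∘ = λ {f} {g} (lift p) (lift q) → lift λ h → ⊑-trans {h} {g h} {f (g h)} (q h) (p (g h))
      ; good-L = λ u → lift (L⊑ u)
      ; good-R = λ u → lift (R⊑ u)
      ; good-F = λ x y → lift λ h → ⊑-trans {h} {h · letter y} {F x y h} (R⊑ (letter y) h)
          (⊑-trans {h · letter y} {letter x · h · letter y} {F x y h} (L⊑ (letter x) (h · letter y)) (flag⊑ (δ x y) (letter x · h · letter y)))
      ; aper = λ (lift p) → 4 , inflationary-aper p
      ; val = val
      ; val-ext = λ s {m} {m'} e → cong₂ flag (dec-cong (arc-ext s e)) (triple (dec-cong (has-ext s e α)) (dec-cong (has-ext s e β))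
          (dec-cong (has-ext s e γ ⊎-⇔ pair-ext s e)))
      ; val-empty = λ s m e → cong₂ flag (⇒dec-false λ (c , _ , u , _) → e c (proj₁ u))
          (triple (⇒dec-false λ (p , d , _) → e p d) (⇒dec-false λ (p , d , _) → e p d)
            (⇒dec-false [ (λ (p , d , _) → e p d) , (λ (p , _ , d , _) → e p d) ]′))
      ; val-letter = λ s m p ms → trans (cong₂ flag
          (⇒dec-false λ (c , r , u , _) → <⇒≱ (M-< ms u) (≤-trans (proj₂ (proj₁ (proj₂ u))) (proj₁ (proj₁ u)))) (flat-letter s m p))
          (triple refl refl (∨-identityʳ _))
      ; val-concat = λ s m c ms p q nc → let l = sub s (lo s) (fin c) ; r = sub s (suc c) (hi s) in begin
          val s m ≡⟨ cong₂ flag (trans (dec-cong (arc-concat s m c ms p q nc)) (dec-⊎ _ _)) (flat-concat s m c p q) ⟩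
          flag (dec (Arc l m) ∨ dec (Arc r m)) (flat l m · flat r m) ≡⟨ flag-flag (dec (Arc r m)) (dec (Arc l m)) (flat l m · flat r m) ⟨
          flag (dec (Arc r m)) (flag (dec (Arc l m)) (flat l m · flat r m)) ≡⟨ cong (flag (dec (Arc r m))) (flag-·ˡ _ (flat l m) (flat r m)) ⟨
          flag (dec (Arc r m)) (val l m · flat r m) ≡⟨ flag-·ʳ _ (val l m) (flat r m) ⟨
          val l m · val r m ∎
      ; val-block = val-block }
      where
      open ≡-Reasoning
      ⊑-trans : ∀ {x y z} → x ⊑ y → y ⊑ z → x ⊑ z
      ⊑-trans (p , q , r) (p' , q' , r') = p' ∘ p , q' ∘ q , r' ∘ r
      L⊑ : ∀ u h → h ⊑ u · h
      L⊑ (a , b , c) (a' , b' , c') = ∨-⊑ʳ a , ∨-⊑ʳ b , ∨-⊑ˡ (a ∧ b') ∘ ∨-⊑ʳ c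
      R⊑ : ∀ u h → h ⊑ h · u
      R⊑ (a , b , c) (a' , b' , c') = ∨-⊑ˡ a , ∨-⊑ˡ b , ∨-⊑ˡ (a' ∧ b) ∘ ∨-⊑ˡ c
      flag⊑ : ∀ d h → h ⊑ flag d h
      flag⊑ d h = id , id , ∨-⊑ˡ d
      module _ (s : Str k) {m m' : Marks j} (e : ∀ q → Dom s q → m q ≡ m' q) where
        at : ∀ {q} (t : Letter j → Bool) → Dom s q → (t (letterAt s m q) ≡ true) ⇔ (t (letterAt s m' q) ≡ true)
        at {q} t d rewrite e q d = ⇔-refl
        has-ext : ∀ t → Has t s m ⇔ Has t s m'
        has-ext t = mk⇔ (λ (p , d , a) → p , d , to (at t d) a) (λ (p , d , a) → p , d , from (at t d) a)
        pair-ext : Pair s m ⇔ Pair s m'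
        pair-ext = mk⇔ (λ (p , q , d , d' , l , a , b) → p , q , d , d' , l , to (at α d) a , to (at β d') b)
                       (λ (p , q , d , d' , l , a , b) → p , q , d , d' , l , from (at α d) a , from (at β d') b)
        at₂ : ∀ {c r} → M s c r → (δ (letterAt s m c) (letterAt s m r) ≡ true) ⇔ (δ (letterAt s m' c) (letterAt s m' r) ≡ true)
        at₂ {c} {r} (d , d' , _) rewrite e c d | e r d' = ⇔-refl
        arc-ext : Arc s m ⇔ Arc s m'
        arc-ext = mk⇔ (λ (c , r , u , a) → c , r , u , to (at₂ u) a) (λ (c , r , u , a) → c , r , u , from (at₂ u) a)
      arc-concat : ∀ s m c → IsMatching s → lo s ≤ suc c → c ≤B hi s → (∀ i j → M s i j → i ≤ c → c < j → ⊥) →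
                   Arc s m ⇔ (Arc (sub s (lo s) (fin c)) m ⊎ Arc (sub s (suc c) (hi s)) m)
      arc-concat s m c ms p q nc = mk⇔ fwd
          [ (λ (x , y , (d , d' , u) , a) → x , y , (left⊆ d , left⊆ d' , u) , a) , (λ (x , y , (d , d' , u) , a) → x , y , (right⊆ d , right⊆ d' , u) , a) ]′
        where
        open Split s c p q
        fwd : Arc s m → Arc left m ⊎ Arc right m
        fwd (x , y , v@(d , d' , u) , a) with split d | split d'
        ... | inj₁ e | inj₁ e' = inj₁ (x , y , (e , e' , u) , a)
        ... | inj₂ e | inj₂ e' = inj₂ (x , y , (e , e' , u) , a)
        ... | inj₁ e | inj₂ e' = ⊥-elim (nc x y v (proj₂ e) (proj₁ e'))
        ... | inj₂ e | inj₁ e' = ⊥-elim (<⇒≱ (<-≤-trans (proj₁ e) (<⇒≤ (M-< ms v))) (proj₂ e'))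

    val-third : ∀ s m → (proj₂ (proj₂ (val s m)) ≡ true) ⇔ ((Has γ s m ⊎ Pair s m) ⊎ Arc s m)
    val-third s m = mk⇔ (λ e → dec⇒ (trans (dec-⊎ _ _) e)) (λ h → trans (sym (dec-⊎ _ _)) (⇒dec h))

  -- Products of algebras, for disjunction.

  module Product {j} (A B : Algebra j) where
    private
      module A = Algebra A
      module B = Algebra B

    Componentwise : (A.H × B.H → A.H × B.H) → Set₁
    Componentwise f = Σ (A.H → A.H) λ g → Σ (B.H → B.H) λ h → A.Good g × B.Good h × (∀ x y → f (x , y) ≡ (g x , h y))

    fold-pair : ∀ {f} → (c : Componentwise f) → ∀ n x y → fold (x , y) f n ≡ (fold x (proj₁ c) n , fold y (proj₁ (proj₂ c)) n)
    fold-pair c zero x y = refl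
    fold-pair {f} c@(_ , _ , _ , _ , e) (suc n) x y = trans (cong f (fold-pair c n x y)) (e _ _)

    productAlgebra : Algebra j
    productAlgebra = record
      { H = A.H × B.H
      ; finite = finite-× A.finite B.finite
      ; _·_ = λ (x , y) (x' , y') → x A.· x' , y B.· y'
      ; ε = A.ε , B.ε
      ; letter = λ l → A.letter l , B.letter l
      ; F = λ l r (x , y) → A.F l r x , B.F l r y
      ; Good = Componentwise
      ; good-id = id , id , A.good-id , B.good-id , λ _ _ → refl
      ; good-∘ = λ { {f} (f₁ , f₂ , p , q , e) (g₁ , g₂ , p' , q' , e') →
          f₁ ∘ g₁ , f₂ ∘ g₂ , A.good-∘ p p' , B.good-∘ q q' , λ x y → trans (cong f (e' x y)) (e _ _) }
      ; good-L = λ (u , v) → _ , _ , A.good-L u , B.good-L v , λ _ _ → refl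
      ; good-R = λ (u , v) → _ , _ , A.good-R u , B.good-R v , λ _ _ → refl
      ; good-F = λ l r → _ , _ , A.good-F l r , B.good-F l r , λ _ _ → refl
      ; aper = aper
      ; val = λ s m → A.val s m , B.val s m
      ; val-ext = λ s e → cong₂ _,_ (A.val-ext s e) (B.val-ext s e)
      ; val-empty = λ s m e → cong₂ _,_ (A.val-empty s m e) (B.val-empty s m e)
      ; val-letter = λ s m p ms → cong₂ _,_ (A.val-letter s m p ms) (B.val-letter s m p ms)
      ; val-concat = λ s m c ms p q nc → cong₂ _,_ (A.val-concat s m c ms p q nc) (B.val-concat s m c ms p q nc)
      ; val-block = λ s m c r ms u → cong₂ _,_ (A.val-block s m c r ms u) (B.val-block s m c r ms u) }
      where
      aper : ∀ {f} → Componentwise f → Σ ℕ λ N → ∀ h → fold h f N ≡ fold h f (suc N)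
      aper {f} c@(g , h , gg , gh , _) with A.aper gg | B.aper gh
      ... | N , e | N' , e' = N + N' , λ (x , y) → trans (fold-pair c (N + N') x y) (trans
            (cong₂ _,_ (fold-stable {f = g} e (m≤m+n N N') x) (fold-stable {f = h} e' (m≤n+m N' N) y))
            (sym (fold-pair c (suc (N + N')) x y)))

  -- Power sets, for quantifiers.

  module Power {H : Set} (finite : Finite H) where

    -- As the enumeration may repeat elements, several vectors can have the same members. The
    -- vectors `⟪ Q ⟫` are canonical: among them, equal members mean equal vectors.
    Pow : Set
    Pow = Vec Bool (length (elements finite))

    infix 4 _∈ₚ_
    _∈ₚ_ : H → Pow → Set
    h ∈ₚ X = lookup X (index (complete finite h)) ≡ true

    -- Opaque, so that Q can be inferred from ⟪ Q ⟫.
    abstract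
      ⟪_⟫ : (H → Set) → Pow
      ⟪ Q ⟫ = tabulate λ i → dec (Q (List.lookup (elements finite) i))

      ∈-⟪⟫ : ∀ {Q h} → (h ∈ₚ ⟪ Q ⟫) ⇔ Q h
      ∈-⟪⟫ {Q} {h} = mk⇔ (λ e → dec⇒ (trans (sym eq) e)) (λ q → trans eq (⇒dec q))
        where
        eq : lookup ⟪ Q ⟫ (index (complete finite h)) ≡ dec (Q h)
        eq = trans (lookup∘tabulate _ (index (complete finite h))) (cong (dec ∘ Q) (sym (lookup-index (complete finite h))))

      ⟪⟫-cong : ∀ {Q Q'} → (∀ h → Q h ⇔ Q' h) → ⟪ Q ⟫ ≡ ⟪ Q' ⟫
      ⟪⟫-cong e = tabulate-cong λ i → dec-cong (e _)

    Image : (H → H) → Pow → H → Set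
    Image f X g = Σ H λ x → x ∈ₚ X × f x ≡ g

    image-⟪⟫ : ∀ {f Q g} → Image f ⟪ Q ⟫ g ⇔ (Σ H λ x → Q x × f x ≡ g)
    image-⟪⟫ = mk⇔ (λ (x , m , e) → x , to ∈-⟪⟫ m , e) (λ (x , q , e) → x , from ∈-⟪⟫ q , e)

  mark : ∀ {j} → ℕ → Marks j → Marks (suc j)
  mark p m q = does (q ≟ p) ∷ m q

  unmarked : ∀ {j} → Marks j → Marks (suc j)
  unmarked m q = false ∷ m q

  extend : ∀ {j} → Bool → Letter j → Letter (suc j)
  extend b (a , c , r , v) = a , c , r , b ∷ v

  letterAt-here : ∀ {j} s (m : Marks j) p → letterAt s (mark p m) p ≡ extend true (letterAt s m p)
  letterAt-here s m p = cong (λ b → extend b (letterAt s m p)) (dec-true (p ≟ p) refl)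

  mark-elsewhere : ∀ {j} (m : Marks j) {p q} → q ≢ p → mark p m q ≡ unmarked m q
  mark-elsewhere m {p} {q} n = cong (_∷ m q) (dec-false (q ≟ p) n)

  letterAt-elsewhere : ∀ {j} s (m : Marks j) {p q} → q ≢ p → letterAt s (mark p m) q ≡ extend false (letterAt s m q)
  letterAt-elsewhere s m {p} {q} n = cong (λ b → extend b (letterAt s m q)) (dec-false (q ≟ p) n)

  module MarkLaws {j} (A : Algebra (suc j)) where
    open Algebra A

    val-away : ∀ s (m : Marks j) {p} → ¬ Dom s p → val s (mark p m) ≡ val s (unmarked m)
    val-away s m {p} n = val-ext s λ q d → mark-elsewhere m λ { refl → n d }

    module _ (s : Str k) (m : Marks j) (c r : ℕ) (ms : IsMatching (sub s c (fin (suc r)))) (u : M (sub s c (fin (suc r))) c (suc r)) where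
      private
        t = sub s c (fin (suc r))
        inner = sub s (suc c) (fin r)
        c<sr : c < suc r
        c<sr = M-< ms u

      block-unmarked : val t (unmarked m) ≡ F (extend false (letterAt s m c)) (extend false (letterAt s m (suc r))) (val inner (unmarked m))
      block-unmarked = val-block s (unmarked m) c r ms u

      block-open : val t (mark c m) ≡ F (extend true (letterAt s m c)) (extend false (letterAt s m (suc r))) (val inner (unmarked m))
      block-open = begin
        val t (mark c m) ≡⟨ val-block s (mark c m) c r ms u ⟩
        F (letterAt s (mark c m) c) (letterAt s (mark c m) (suc r)) (val inner (mark c m))
          ≡⟨ cong₂ (λ x y → F x y (val inner (mark c m))) (letterAt-here s m c) (letterAt-elsewhere s m (λ e → <⇒≢ c<sr (sym e))) ⟩
        F (extend true (letterAt s m c)) (extend false (letterAt s m (suc r))) (val inner (mark c m))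
          ≡⟨ cong (F _ _) (val-away inner m (λ (a , _) → <⇒≱ a ≤-refl)) ⟩
        F (extend true (letterAt s m c)) (extend false (letterAt s m (suc r))) (val inner (unmarked m)) ∎
        where open ≡-Reasoning

      block-close : val t (mark (suc r) m) ≡ F (extend false (letterAt s m c)) (extend true (letterAt s m (suc r))) (val inner (unmarked m))
      block-close = begin
        val t (mark (suc r) m) ≡⟨ val-block s (mark (suc r) m) c r ms u ⟩
        F (letterAt s (mark (suc r) m) c) (letterAt s (mark (suc r) m) (suc r)) (val inner (mark (suc r) m))
          ≡⟨ cong₂ (λ x y → F x y (val inner (mark (suc r) m))) (letterAt-elsewhere s m (<⇒≢ c<sr)) (letterAt-here s m (suc r)) ⟩
        F (extend false (letterAt s m c)) (extend true (letterAt s m (suc r))) (val inner (mark (suc r) m))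
          ≡⟨ cong (F _ _) (val-away inner m (λ (_ , b) → <⇒≱ ≤-refl b)) ⟩
        F (extend false (letterAt s m c)) (extend true (letterAt s m (suc r))) (val inner (unmarked m)) ∎
        where open ≡-Reasoning

      block-inside : ∀ {p} → Dom inner p → val t (mark p m) ≡ F (extend false (letterAt s m c)) (extend false (letterAt s m (suc r))) (val inner (mark p m))
      block-inside {p} (a , b) = trans (val-block s (mark p m) c r ms u)
        (cong₂ (λ x y → F x y (val inner (mark p m))) (letterAt-elsewhere s m (<⇒≢ a)) (letterAt-elsewhere s m (λ e → <⇒≢ (s≤s b) (sym e))))

  -- The value of the new algebra at s is the value of s without the extra mark
  -- together with the set of values of s with the extra mark at some position.
  module Exists {j} (A : Algebra (suc j)) where
    open Algebra A
    open Power finite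
    open MarkLaws A

    H' : Set
    H' = H × Pow

    infixr 6 _·'_
    _·'_ : H' → H' → H'
    (h , X) ·' (h' , X') = h · h' , ⟪ (λ g → Image (_· h') X g ⊎ Image (h ·_) X' g) ⟫

    letter' : Letter j → H'
    letter' l = letter (extend false l) , ⟪ (λ g → letter (extend true l) ≡ g) ⟫

    F' : Letter j → Letter j → H' → H'
    F' x y (h , X) = F (extend false x) (extend false y) h ,
      ⟪ (λ g → Image (F (extend false x) (extend false y)) X g ⊎
               (F (extend true x) (extend false y) h ≡ g ⊎ F (extend false x) (extend true y) h ≡ g)) ⟫

    val' : Str k → Marks j → H'
    val' s m = val s (unmarked m) , ⟪ (λ g → Σ ℕ λ p → Dom s p × val s (mark p m) ≡ g) ⟫

    -- A context as it acts on `H'`. Either the extra mark is in the argument and `f` is applied, or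
    -- it is in the context, at a place indexed by `i`, and `W i` is applied to the unmarked
    -- argument.
    record Proper (f' : H' → H') : Set₁ where
      field
        f      : H → H
        f-good : Good f
        I      : Set
        W      : I → H → H
        W-good : ∀ i → Good (W i)
        eq     : ∀ h X → f' (h , X) ≡ (f h , ⟪ (λ g → Image f X g ⊎ (Σ I λ i → W i h ≡ g)) ⟫)
    open Proper

    -- The identity is a separate case: a proper map always returns a canonical vector, whereas the
    -- identity keeps any vector as it is.
    Good' : (H' → H') → Set₁
    Good' f' = (∀ x → f' x ≡ x) ⊎ Proper f'

    good-∘' : ∀ {f' g'} → Good' f' → Good' g' → Good' (f' ∘ g')
    good-∘' (inj₁ p) (inj₁ q) = inj₁ λ x → trans (p _) (q x)
    good-∘' (inj₁ p) (inj₂ q) = inj₂ record { Proper q ; eq = λ h X → trans (p _) (eq q h X) }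
    good-∘' {f'} (inj₂ p) (inj₁ q) = inj₂ record { Proper p ; eq = λ h X → trans (cong f' (q _)) (eq p h X) }
    good-∘' {f'} (inj₂ p) (inj₂ q) = inj₂ record
      { f = f p ∘ f q
      ; f-good = good-∘ (f-good p) (f-good q)
      ; I = I p ⊎ I q
      ; W = [ (λ i → W p i ∘ f q) , (λ i → f p ∘ W q i) ]′
      ; W-good = λ { (inj₁ i) → good-∘ (W-good p i) (f-good q) ; (inj₂ i) → good-∘ (f-good p) (W-good q i) }
      ; eq = λ h X → trans (cong f' (eq q h X)) (trans (eq p _ _) (cong (f p (f q h) ,_) (⟪⟫-cong λ g → mk⇔
          (λ { (inj₁ im) → part₁ h X g (to image-⟪⟫ im) ; (inj₂ (i , e)) → inj₂ (inj₁ i , e) })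
          (λ { (inj₁ (x , m , e)) → inj₁ (from image-⟪⟫ (f q x , inj₁ (x , m , refl) , e))
             ; (inj₂ (inj₁ i , e)) → inj₂ (i , e)
             ; (inj₂ (inj₂ i , e)) → inj₁ (from image-⟪⟫ (W q i h , inj₂ (i , refl) , e)) })))) }
      where
      part₁ : ∀ h X g → (Σ H λ y → (Image (f q) X y ⊎ (Σ (I q) λ i → W q i h ≡ y)) × f p y ≡ g) →
              Image (f p ∘ f q) X g ⊎ (Σ (I p ⊎ I q) λ i → [ (λ i → W p i ∘ f q) , (λ i → f p ∘ W q i) ]′ i h ≡ g)
      part₁ h X g (_ , inj₁ (x , m , refl) , e) = inj₁ (x , m , e)
      part₁ h X g (_ , inj₂ (i , refl) , e) = inj₂ (inj₂ i , e)

    module _ {f'} (p : Proper f') where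

      -- After `suc n` rounds the mark comes from the argument or entered in one of the rounds, with
      -- `b` rounds before that one and `a` after it.
      Content : ℕ → H → Pow → H → Set
      Content n h X g = Image (λ x → fold x (f p) (suc n)) X g ⊎
        (Σ ℕ λ a → Σ ℕ λ b → a + b ≡ n × Σ (I p) λ i → fold (W p i (fold h (f p) b)) (f p) a ≡ g)

      fold-proper : ∀ n h X → fold (h , X) f' (suc n) ≡ (fold h (f p) (suc n) , ⟪ Content n h X ⟫)
      fold-proper zero h X = trans (eq p h X) (cong (f p h ,_) (⟪⟫-cong λ g → mk⇔
        (λ { (inj₁ im) → inj₁ im ; (inj₂ (i , e)) → inj₂ (0 , 0 , refl , i , e) })
        (λ { (inj₁ im) → inj₁ im ; (inj₂ (zero , zero , _ , i , e)) → inj₂ (i , e) })))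
      fold-proper (suc n) h X = trans (cong f' (fold-proper n h X)) (trans (eq p _ _) (cong (fold h (f p) (suc (suc n)) ,_) (⟪⟫-cong λ g → mk⇔
        (λ { (inj₁ im) → fwd g (to image-⟪⟫ im) ; (inj₂ (i , e)) → inj₂ (0 , suc n , refl , i , e) })
        (λ { (inj₁ (x , m , e)) → inj₁ (from image-⟪⟫ (fold x (f p) (suc n) , inj₁ (x , m , refl) , e))
           ; (inj₂ (zero , _ , refl , i , e)) → inj₂ (i , e)
           ; (inj₂ (suc a , b , q , i , e)) → inj₁ (from image-⟪⟫ (_ , inj₂ (a , b , suc-injective q , i , refl) , e)) }))))
        where
        fwd : ∀ g → (Σ H λ y → Content n h X y × f p y ≡ g) → Content (suc n) h X g
        fwd g (_ , inj₁ (x , m , refl) , e) = inj₁ (x , m , e)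
        fwd g (_ , inj₂ (a , b , refl , i , refl) , e) = inj₂ (suc a , b , refl , i , e)

      -- In f^a ∘ W ∘ f^b with a + b ≥ 2N one of the two powers is in the stable range.
      proper-aper : Σ ℕ λ N → ∀ x → fold x f' N ≡ fold x f' (suc N)
      proper-aper with aper (f-good p)
      ... | N , e = suc (N + N) , λ (h , X) → trans (fold-proper (N + N) h X) (trans
          (cong₂ _,_ (stable (m≤n⇒m≤1+n (m≤m+n N N)) h) (⟪⟫-cong λ g → mk⇔ (up h X g) (down h X g)))
          (sym (fold-proper (suc (N + N)) h X)))
        where
        stable : ∀ {n} → N ≤ n → ∀ h → fold h (f p) n ≡ fold h (f p) (suc n)
        stable = fold-stable {f = f p} e
        N≤ : N ≤ suc (N + N)
        N≤ = m≤n⇒m≤1+n (m≤m+n N N)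
        up : ∀ h X g → Content (N + N) h X g → Content (suc (N + N)) h X g
        up h X g (inj₁ (x , m , eq)) = inj₁ (x , m , trans (sym (stable N≤ x)) eq)
        up h X g (inj₂ (a , b , q , i , eq)) with N ≤? a
        ... | yes N≤a = inj₂ (suc a , b , cong suc q , i , trans (sym (stable N≤a _)) eq)
        ... | no N≰a = inj₂ (a , suc b , trans (+-suc a b) (cong suc q) , i ,
                trans (cong (λ z → fold (W p i z) (f p) a) (sym (stable N≤b h))) eq)
          where
          N≤b : N ≤ b
          N≤b with N ≤? b
          ... | yes p = p
          ... | no N≰b = ⊥-elim (<⇒≢ (+-mono-< (≰⇒> N≰a) (≰⇒> N≰b)) q)
        down : ∀ h X g → Content (suc (N + N)) h X g → Content (N + N) h X g
        down h X g (inj₁ (x , m , eq)) = inj₁ (x , m , trans (stable N≤ x) eq)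
        down h X g (inj₂ (a , b , q , i , eq)) with N <? a
        down h X g (inj₂ (suc a , b , q , i , eq)) | yes N<a =
          inj₂ (a , b , suc-injective q , i , trans (stable (s≤s⁻¹ N<a) _) eq)
        ... | no N≮a with b
        ... | zero = ⊥-elim (N≮a (subst (suc N ≤_) (trans (sym q) (+-identityʳ a)) (s≤s (m≤m+n N N))))
        ... | suc b' = inj₂ (a , b' , suc-injective (trans (sym (+-suc a b')) q) , i ,
                trans (cong (λ z → fold (W p i z) (f p) a) (stable N≤b' h)) eq)
          where
          N≤b' : N ≤ b'
          N≤b' with N ≤? b'
          ... | yes p = p
          ... | no N≰b' = ⊥-elim (<⇒≢ (+-mono-≤-< (≮⇒≥ N≮a) (s≤s (≰⇒> N≰b'))) (trans q (sym (+-suc N N))))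

    good-L' : ∀ u → Good' (u ·'_)
    good-L' (u , Z) = inj₂ record
      { f = u ·_ ; f-good = good-L u ; I = Σ H (_∈ₚ Z) ; W = λ (x , _) h → x · h ; W-good = λ (x , _) → good-L x
      ; eq = λ h X → cong (u · h ,_) (⟪⟫-cong λ g → mk⇔
          [ (λ (x , m , e) → inj₂ ((x , m) , e)) , inj₁ ]′ [ inj₂ , (λ ((x , m) , e) → inj₁ (x , m , e)) ]′) }

    good-R' : ∀ u → Good' (_·' u)
    good-R' (u , Z) = inj₂ record
      { f = _· u ; f-good = good-R u ; I = Σ H (_∈ₚ Z) ; W = λ (x , _) h → h · x ; W-good = λ (x , _) → good-R x
      ; eq = λ h X → cong (h · u ,_) (⟪⟫-cong λ g → mk⇔
          [ inj₁ , (λ (x , m , e) → inj₂ ((x , m) , e)) ]′ [ inj₁ , (λ ((x , m) , e) → inj₂ (x , m , e)) ]′) }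

    good-F' : ∀ x y → Good' (F' x y)
    good-F' x y = inj₂ record
      { f = F (extend false x) (extend false y) ; f-good = good-F _ _ ; I = Bool
      ; W = λ { true → F (extend true x) (extend false y) ; false → F (extend false x) (extend true y) }
      ; W-good = λ { true → good-F _ _ ; false → good-F _ _ }
      ; eq = λ h X → cong (_ ,_) (⟪⟫-cong λ g → mk⇔
          (λ { (inj₁ im) → inj₁ im ; (inj₂ (inj₁ e)) → inj₂ (true , e) ; (inj₂ (inj₂ e)) → inj₂ (false , e) })
          (λ { (inj₁ im) → inj₁ im ; (inj₂ (true , e)) → inj₂ (inj₁ e) ; (inj₂ (false , e)) → inj₂ (inj₂ e) })) }

    val-concat' : ∀ s m c → IsMatching s → lo s ≤ suc c → c ≤B hi s → (∀ i j → M s i j → i ≤ c → c < j → ⊥) →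
                  val' s m ≡ val' (sub s (lo s) (fin c)) m ·' val' (sub s (suc c) (hi s)) m
    val-concat' s m c ms p q nc = cong₂ _,_ (val-concat s (unmarked m) c ms p q nc) (⟪⟫-cong λ g → mk⇔ (fwd g) (bwd g))
      where
      open Split s c p q
      disjoint : ∀ {x} → Dom left x → ¬ Dom right x
      disjoint (_ , a) (b , _) = <⇒≱ b a
      in-left : ∀ {x} → Dom left x → val s (mark x m) ≡ val left (mark x m) · val right (unmarked m)
      in-left {x} d = trans (val-concat s (mark x m) c ms p q nc) (cong (val left (mark x m) ·_) (val-away right m (disjoint d)))
      in-right : ∀ {x} → Dom right x → val s (mark x m) ≡ val left (unmarked m) · val right (mark x m)
      in-right {x} d = trans (val-concat s (mark x m) c ms p q nc) (cong (_· val right (mark x m)) (val-away left m (λ d' → disjoint d' d)))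
      Values : Str k → H → Set
      Values t g = Σ ℕ λ x → Dom t x × val t (mark x m) ≡ g
      fwd : ∀ g → Values s g → Image (_· val right (unmarked m)) ⟪ Values left ⟫ g ⊎ Image (val left (unmarked m) ·_) ⟪ Values right ⟫ g
      fwd g (x , d , e) with split d
      ... | inj₁ d' = inj₁ (_ , from ∈-⟪⟫ (x , d' , refl) , trans (sym (in-left d')) e)
      ... | inj₂ d' = inj₂ (_ , from ∈-⟪⟫ (x , d' , refl) , trans (sym (in-right d')) e)
      left-values : ∀ g → (Σ H λ y → Values left y × y · val right (unmarked m) ≡ g) → Values s g
      left-values g (_ , (x , d , refl) , e) = x , left⊆ d , trans (in-left d) e
      right-values : ∀ g → (Σ H λ y → Values right y × val left (unmarked m) · y ≡ g) → Values s g
      right-values g (_ , (x , d , refl) , e) = x , right⊆ d , trans (in-right d) e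
      bwd : ∀ g → Image (_· val right (unmarked m)) ⟪ Values left ⟫ g ⊎ Image (val left (unmarked m) ·_) ⟪ Values right ⟫ g → Values s g
      bwd g = [ left-values g ∘ to image-⟪⟫ , right-values g ∘ to image-⟪⟫ ]′

    val-block' : ∀ s m c r → IsMatching (sub s c (fin (suc r))) → M (sub s c (fin (suc r))) c (suc r) →
      val' (sub s c (fin (suc r))) m ≡ F' (letterAt s m c) (letterAt s m (suc r)) (val' (sub s (suc c) (fin r)) m)
    val-block' s m c r ms u = cong₂ _,_ (block-unmarked s m c r ms u) (⟪⟫-cong λ g → mk⇔ (fwd g) (bwd g))
      where
      t inner : Str k
      t = sub s c (fin (suc r))
      inner = sub s (suc c) (fin r)
      x y : Letter j
      x = letterAt s m c
      y = letterAt s m (suc r)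
      Values : Str k → H → Set
      Values t g = Σ ℕ λ x → Dom t x × val t (mark x m) ≡ g
      h : H
      h = val inner (unmarked m)
      Ends : H → Set
      Ends g = F (extend true x) (extend false y) h ≡ g ⊎ F (extend false x) (extend true y) h ≡ g
      fwd : ∀ g → Values t g → Image (F (extend false x) (extend false y)) ⟪ Values inner ⟫ g ⊎ Ends g
      fwd g (p , (a , b) , e) with m≤n⇒m<n∨m≡n a | m≤n⇒m<n∨m≡n b
      ... | inj₂ refl | _ = inj₂ (inj₁ (trans (sym (block-open s m c r ms u)) e))
      ... | inj₁ _ | inj₂ refl = inj₂ (inj₂ (trans (sym (block-close s m c r ms u)) e))
      ... | inj₁ a' | inj₁ b' = inj₁ (_ , from ∈-⟪⟫ (p , (a' , s≤s⁻¹ b') , refl) , trans (sym (block-inside s m c r ms u (a' , s≤s⁻¹ b'))) e)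
      inside : ∀ g → (Σ H λ z → Values inner z × F (extend false x) (extend false y) z ≡ g) → Values t g
      inside g (_ , (p , d@(a , b) , refl) , e) = p , (<⇒≤ a , m≤n⇒m≤1+n b) , trans (block-inside s m c r ms u d) e
      bwd : ∀ g → Image (F (extend false x) (extend false y)) ⟪ Values inner ⟫ g ⊎ Ends g → Values t g
      bwd g (inj₁ im) = inside g (to image-⟪⟫ im)
      bwd g (inj₂ (inj₁ e)) = c , proj₁ u , trans (block-open s m c r ms u) e
      bwd g (inj₂ (inj₂ e)) = suc r , proj₁ (proj₂ u) , trans (block-close s m c r ms u) e

    existsAlgebra : Algebra j
    existsAlgebra = record
      { H = H'
      ; finite = finite-× finite (finite-Vec finite-Bool _)
      ; _·_ = _·'_
      ; ε = ε , ⟪ (λ _ → ⊥) ⟫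
      ; letter = letter'
      ; F = F'
      ; Good = Good'
      ; good-id = inj₁ λ _ → refl
      ; good-∘ = good-∘'
      ; good-L = good-L'
      ; good-R = good-R'
      ; good-F = good-F'
      ; aper = [ (λ i → 0 , λ h → sym (i h)) , (λ p → proper-aper p) ]′
      ; val = val'
      ; val-ext = λ s {m} {m'} e → cong₂ _,_ (val-ext s λ q d → cong (false ∷_) (e q d))
          (⟪⟫-cong λ g → mk⇔ (λ (p , d , eq) → p , d , trans (sym (val-ext s λ q d → cong (_ ∷_) (e q d))) eq)
                              (λ (p , d , eq) → p , d , trans (val-ext s λ q d → cong (_ ∷_) (e q d)) eq))
      ; val-empty = λ s m e → cong₂ _,_ (val-empty s (unmarked m) e) (⟪⟫-cong λ g → mk⇔ (λ (p , d , _) → e p d) ⊥-elim)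
      ; val-letter = λ s m p ms → cong₂ _,_ (val-letter s (unmarked m) p ms) (⟪⟫-cong λ g → mk⇔
          (λ (q , (a , b) , e) → trans (sym (letter-here s m ms)) (subst (λ z → val (sub s p (fin p)) (mark z m) ≡ g) (≤-antisym b a) e))
          (λ e → p , (≤-refl , ≤-refl) , trans (letter-here s m ms) e))
      ; val-concat = val-concat'
      ; val-block = val-block' }
      where
      letter-here : ∀ s m {p} → IsMatching (sub s p (fin p)) → val (sub s p (fin p)) (mark p m) ≡ letter (extend true (letterAt s m p))
      letter-here s m {p} ms = trans (val-letter s (mark p m) p ms) (cong letter (letterAt-here s m p))

-- From first-order to temporal formulas.

module ToCaRet (em : ExcludedMiddle 0ℓ) (k : ℕ) where
  open Classical em
  open Kamp em
  open Algebras em k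

  -- A class of structures that contains the nonempty nested words and is closed under the cuts of C
  -- and R. Positions are at least 1, so that `pred x` can end the possibly empty interval before
  -- `x`.
  record Ok (s : Str k) : Set where
    constructor ok
    field
      is-matching : IsMatching s
      positive  : 1 ≤ lo s
      nonempty  : lo s ≤B hi s
  open Ok

  in-fin : ∀ {s : Str k} {a b q} → Dom s a → Dom s b → Dom (sub s a (fin b)) q → Dom s q
  in-fin {s} (la , _) (_ , bh) (p , q) = ≤-trans la p , ≤B-trans (hi s) q bh

  in-hi : ∀ {s : Str k} {a q} → Dom s a → Dom (sub s a (hi s)) q → Dom s q
  in-hi (la , _) (p , q) = ≤-trans la p , q

  restrict : ∀ {s : Str k} {a b i j} → (∀ {q} → Dom (sub s a b) q → Dom s q) → M (sub s a b) i j → M s i j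
  restrict inc (d , d' , u) = inc d , inc d' , u

  ok-fin : ∀ {s a b} → Ok s → Dom s a → Dom s b → a ≤ b → Ok (sub s a (fin b))
  ok-fin {s} o da db a≤b = ok (sub-matching (in-fin {s} da db) (is-matching o)) (≤-trans (positive o) (proj₁ da)) a≤b

  ok-hi : ∀ {s a} → Ok s → Dom s a → Ok (sub s a (hi s))
  ok-hi {s} o da = ok (sub-matching (in-hi {s} da) (is-matching o)) (≤-trans (positive o) (proj₁ da)) (proj₂ da)

  _andᶜ_ : CaRet k → CaRet k → CaRet k
  φ andᶜ ψ = neg (neg φ or neg ψ)

  -- Opaque, to keep Sat from unfolding them.
  abstract
    constᶜ : Set → CaRet k
    constᶜ B with dec B
    ... | true = top
    ... | false = neg top

    const-sat : ∀ B s x → Sat s (constᶜ B) x ⇔ B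
    const-sat B s x with em {B}
    ... | yes b = mk⇔ (λ _ → b) (λ _ → tt)
    ... | no ¬b = mk⇔ (λ n → ⊥-elim (n tt)) (λ b _ → ¬b b)

    caseᶜ : CaRet k → CaRet k → CaRet k → CaRet k
    caseᶜ φ ψ χ = (φ andᶜ ψ) or (neg φ andᶜ χ)

    case-yes : ∀ s x φ ψ χ → Sat s φ x → Sat s (caseᶜ φ ψ χ) x ⇔ Sat s ψ x
    case-yes s x φ ψ χ p = mk⇔ (λ { (inj₁ b) → proj₂ (from ×-from-⊎ b) ; (inj₂ b) → ⊥-elim (proj₁ (from ×-from-⊎ b) p) })
                               (λ b → inj₁ (to ×-from-⊎ (p , b)))

    case-no : ∀ s x φ ψ χ → ¬ Sat s φ x → Sat s (caseᶜ φ ψ χ) x ⇔ Sat s χ x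
    case-no s x φ ψ χ n = mk⇔ (λ { (inj₁ b) → ⊥-elim (n (proj₁ (from ×-from-⊎ b))) ; (inj₂ b) → proj₂ (from ×-from-⊎ b) })
                              (λ b → inj₂ (to ×-from-⊎ (n , b)))

  module _ (s : Str k) (x : ℕ) where
    C-yes : ∀ φ {j} → IsC s x j → Sat s (Cop φ) x ⇔ Sat (sub s j (fin x)) φ j
    C-yes φ {j} c = mk⇔ (λ { (inj₁ (j' , c' , p)) → subst (λ z → Sat (sub s z (fin x)) φ z) (C-unique {s = s} c' c) p
                            ; (inj₂ (n , _)) → ⊥-elim (n (j , c)) })
                        (λ p → inj₁ (j , c , p))

    C-no : ∀ φ → ¬ Σ ℕ (IsC s x) → Sat s (Cop φ) x ⇔ Sat (sub s (lo s) (fin x)) φ (lo s)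
    C-no φ n = mk⇔ (λ { (inj₁ (j , c , _)) → ⊥-elim (n (j , c)) ; (inj₂ (_ , p)) → p }) (λ p → inj₂ (n , p))

    R-yes : ∀ φ {j} → IsR s x j → Sat s (Rop φ) x ⇔ Sat (sub s x (fin j)) φ x
    R-yes φ {j} c = mk⇔ (λ { (inj₁ (j' , c' , p)) → subst (λ z → Sat (sub s x (fin z)) φ x) (R-unique {s = s} c' c) p
                            ; (inj₂ (n , _)) → ⊥-elim (n (j , c)) })
                        (λ p → inj₁ (j , c , p))

    R-no : ∀ φ → ¬ Σ ℕ (IsR s x) → Sat s (Rop φ) x ⇔ Sat (sub s x (hi s)) φ x
    R-no φ n = mk⇔ (λ { (inj₁ (j , c , _)) → ⊥-elim (n (j , c)) ; (inj₂ (_ , p)) → p }) (λ p → inj₂ (n , p))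

    prevC-yes : ∀ φ {j} → IsC s x j → Sat s (prevC φ) x ⇔ Sat s φ j
    prevC-yes φ {j} c = mk⇔ (λ (j' , c' , p) → subst (Sat s φ) (C-unique {s = s} c' c) p) (λ p → j , c , p)

    next-yes : ∀ φ → Dom s (suc x) → Sat s (next φ) x ⇔ Sat s φ (suc x)
    next-yes φ d = mk⇔ proj₂ (d ,_)

  eventually : ∀ (s : Str k) φ {x} → Dom s x → Sat s (top U φ) x ⇔ (Σ ℕ λ p → x ≤ p × Dom s p × Sat s φ p)
  eventually s φ dx = mk⇔ (fwd dx) (λ (p , x≤p , dp , a) → let n , e = m≤n⇒∃[o]m+o≡n x≤p in bwd n dp a dx e)
    where
    fwd : ∀ {x} → Dom s x → Sat s (top U φ) x → Σ ℕ λ p → x ≤ p × Dom s p × Sat s φ p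
    fwd dx (here a) = _ , ≤-refl , dx , a
    fwd dx (there _ (refl , d) u) with fwd d u
    ... | p , q , d' , a = p , <⇒≤ q , d' , a
    bwd : ∀ n {x p} → Dom s p → Sat s φ p → Dom s x → x + n ≡ p → Sat s (top U φ) x
    bwd zero {x} dp a dx e = here (subst (Sat s φ) (trans (sym e) (+-identityʳ x)) a)
    bwd (suc n) {x} dp a dx e = there tt (refl , dx') (bwd n dp a dx' e')
      where
      e' : suc x + n ≡ _
      e' = trans (sym (+-suc x n)) e
      dx' : Dom s (suc x)
      dx' = ≤-trans (proj₁ dx) (n≤1+n x) , ≤B-trans (hi s) (subst (suc x ≤_) e' (m≤m+n (suc x) n)) (proj₂ dp)

  -- Removing the first or the last position of a structure, provided it is unmatched there;
  -- B is the value to take when nothing is left.  Opaque, to keep Sat from unfolding them.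
  abstract
    exceptFirst exceptLast : CaRet k → Set → CaRet k
    exceptFirst φ B = caseᶜ (next top) (next (Rop φ)) (constᶜ B)
    exceptLast φ B = caseᶜ (next top) (top U (next (neg (next top)) andᶜ Cop φ)) (constᶜ B)

    -- R at the second position keeps everything up to the end: a return bounding it would have its
    -- call before that position, that is, at the unmatched first one.
    exceptFirst-sat : ∀ s φ B {Q : Set} → Ok s → ¬ Σ ℕ (M s (lo s)) →
      (suc (lo s) ≤B hi s → Sat (sub s (suc (lo s)) (hi s)) φ (suc (lo s)) ⇔ Q) →
      (¬ suc (lo s) ≤B hi s → B ⇔ Q) → Sat s (exceptFirst φ B) (lo s) ⇔ Q
    exceptFirst-sat s φ B o nc some none with em {suc (lo s) ≤B hi s}
    ... | yes le = case-yes s (lo s) (next top) (next (Rop φ)) (constᶜ B) ((n≤1+n _ , le) , tt) ⇔∘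
        next-yes s (lo s) (Rop φ) (n≤1+n _ , le) ⇔∘ R-no s (suc (lo s)) φ noR ⇔∘ some le
      where
      noR : ¬ Σ ℕ (IsR s (suc (lo s)))
      noR (l , _ , _ , (j , u , j<) , _) with ≤-antisym (s≤s⁻¹ j<) (proj₁ (proj₁ u))
      ... | refl = nc (l , u)
    ... | no nle = case-no s (lo s) (next top) (next (Rop φ)) (constᶜ B) (λ ((_ , le) , _) → nle le) ⇔∘ const-sat B s (lo s) ⇔∘ none nle

    -- The until finds the last position but one, as the position with a next one but no second next
    -- one. C there restricts to `[a, n]`: a block enclosing `n` could only end at `suc n`, which is
    -- no matched return.
    exceptLast-sat : ∀ s a n φ B {Q : Set} → let t = sub s a (fin (suc n)) in Ok t → ¬ MatchedRet t (suc n) →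
      (a ≤ n → Sat (sub s a (fin n)) φ a ⇔ Q) → (¬ a ≤ n → B ⇔ Q) → Sat t (exceptLast φ B) a ⇔ Q
    exceptLast-sat s a n φ B o nr some none with a ≤? n
    ... | yes le = case-yes t a (next top) (top U lastly) (constᶜ B) ((n≤1+n _ , s≤s le) , tt) ⇔∘
        eventually t lastly (≤-refl , m≤n⇒m≤1+n le) ⇔∘ here-only ⇔∘ some le
      where
      t : Str k
      t = sub s a (fin (suc n))
      lastly : CaRet k
      lastly = next (neg (next top)) andᶜ Cop φ
      noC : ¬ Σ ℕ (IsC t n)
      noC (j , _ , _ , (l , u , n<l) , _) with ≤-antisym (proj₂ (proj₁ (proj₂ u))) n<l
      ... | refl = nr (j , u)
      here-only : (Σ ℕ λ p → a ≤ p × Dom t p × Sat t lastly p) ⇔ Sat (sub s a (fin n)) φ a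
      here-only = mk⇔ fwd (λ p → n , le , (le , n≤1+n n) ,
          to ×-from-⊎ ((((m≤n⇒m≤1+n le) , ≤-refl) , (λ ((_ , q) , _) → <⇒≱ q ≤-refl)) , from (C-no t n φ noC) p))
        where
        fwd : (Σ ℕ λ p → a ≤ p × Dom t p × Sat t lastly p) → Sat (sub s a (fin n)) φ a
        fwd (p , a≤p , dp , b) with from ×-from-⊎ b
        ... | ((_ , sp≤) , nn) , c with ≤-antisym (s≤s⁻¹ sp≤) (≮⇒≥ λ p<n → nn ((m≤n⇒m≤1+n (m≤n⇒m≤1+n a≤p) , s≤s p<n) , tt))
        ... | refl = to (C-no t n φ noC) c
    ... | no nle = case-no (sub s a (fin (suc n))) a (next top) (top U (next (neg (next top)) andᶜ Cop φ)) (constᶜ B) (λ ((_ , le) , _) → nle (s≤s⁻¹ le)) ⇔∘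
        const-sat B (sub s a (fin (suc n))) a ⇔∘ none nle

  -- Definability at the positions that satisfy a side condition.

  PDef : (C Q : Str k → ℕ → Set) → Set₁
  PDef C Q = Σ (CaRet k) λ φ → ∀ s → Ok s → ∀ x → Dom s x → C s x → Sat s φ x ⇔ Q s x

  module _ {C : Str k → ℕ → Set} where
    pConv : ∀ {Q Q'} → (∀ s → Ok s → ∀ x → Dom s x → C s x → Q s x ⇔ Q' s x) → PDef C Q → PDef C Q'
    pConv e (φ , p) = φ , λ s o x d c → p s o x d c ⇔∘ e s o x d c

    pNot : ∀ {Q} → PDef C Q → PDef C (λ s x → ¬ Q s x)
    pNot (φ , p) = neg φ , λ s o x d c → ¬-cong (p s o x d c)

    pAnd : ∀ {Q Q'} → PDef C Q → PDef C Q' → PDef C (λ s x → Q s x × Q' s x)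
    pAnd (φ , p) (ψ , q) = φ andᶜ ψ , λ s o x d c → ⇔-sym ×-from-⊎ ⇔∘ (p s o x d c ×-⇔ q s o x d c)

    pConst : ∀ B → PDef C (λ _ _ → B)
    pConst B = constᶜ B , λ s o x d c → const-sat B s x

    pCase : ∀ {D Q} → PDef C D → PDef (λ s x → C s x × D s x) Q → PDef (λ s x → C s x × ¬ D s x) Q → PDef C Q
    pCase {D} {Q} (φ , p) (ψ , q) (χ , r) = caseᶜ φ ψ χ , spec
      where
      spec : ∀ s → Ok s → ∀ x → Dom s x → C s x → Sat s (caseᶜ φ ψ χ) x ⇔ Q s x
      spec s o x d c with em {D s x}
      ... | yes t = case-yes s x φ ψ χ (from (p s o x d c) t) ⇔∘ q s o x d (c , t)
      ... | no n = case-no s x φ ψ χ (n ∘ to (p s o x d c)) ⇔∘ r s o x d (c , n)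

    pBool : ∀ {D} → PDef C D → ∀ b → PDef C (λ s x → dec (D s x) ≡ b)
    pBool p true = pConv (λ _ _ _ _ _ → mk⇔ ⇒dec dec⇒) p
    pBool p false = pConv (λ s _ x _ _ → mk⇔ ⇒dec-false (λ e d → case-absurd (trans (sym (⇒dec d)) e))) (pNot p)
      where
      case-absurd : true ≡ false → ⊥
      case-absurd ()

    -- A disjunction over the finitely many values of `f`; inside each disjunct the value is a
    -- constant.
    pBind : ∀ {X : Set} → Finite X → {f : Str k → ℕ → X} (Q : X → Str k → ℕ → Set) →
            (∀ x → PDef C (λ s p → f s p ≡ x)) → (∀ x → PDef C (Q x)) → PDef C (λ s p → Q (f s p) s p)
    pBind {X} finX {f} Q df dq = pConv {Q = λ s p → Any (λ x → f s p ≡ x × Q x s p) (elements finX)} (λ s _ p _ _ → mk⇔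
        (λ a → let x , _ , e , q = find {P = λ x → f s p ≡ x × Q x s p} a in subst (λ z → Q z s p) (sym e) q)
        (λ q → lose (complete finX (f s p)) (refl , q))) (go (elements finX))
      where
      go : ∀ xs → PDef C (λ s p → Any (λ x → f s p ≡ x × Q x s p) xs)
      go [] = pConv (λ _ _ _ _ _ → mk⇔ ⊥-elim λ ()) (pConst ⊥)
      go (x ∷ xs) with pAnd (df x) (dq x) | go xs
      ... | φ , p | ψ , q = φ or ψ , λ s o y d c → (p s o y d c ⊎-⇔ q s o y d c) ⇔∘
            mk⇔ [ here , there ]′ (λ { (here h) → inj₁ h ; (there t) → inj₂ t })

  pWeaken : ∀ {C C' Q : Str k → ℕ → Set} → (∀ s → Ok s → ∀ x → C' s x → C s x) → PDef C Q → PDef C' Q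
  pWeaken h (φ , p) = φ , λ s o x d c → p s o x d (h s o x c)

  -- Levels of nesting, and passing between a call and its return.

  MCall : Str k → ℕ → Set
  MCall s x = Σ ℕ (M s x)

  -- The interior of the innermost block enclosing x, or everything if there is none.
  level : Str k → ℕ → ℕ × Bound
  level s x with em {Σ ℕ (IsC s x)}
  ... | yes (j , _ , _ , (l , _) , _) = suc j , fin (pred l)
  ... | no _ = lo s , hi s

  lower : Str k → ℕ → ℕ
  lower s x = proj₁ (level s x)

  upper : Str k → ℕ → Bound
  upper s x = proj₂ (level s x)

  level-C : ∀ {s x j r} → IsMatching s → IsC s x j → M s j (suc r) → level s x ≡ (suc j , fin r)
  level-C {s} {x} ms c u with em {Σ ℕ (IsC s x)}
  ... | no n = ⊥-elim (n (_ , c))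
  ... | yes (j , c'@(_ , _ , (l , u' , _) , _)) with C-unique {s = s} c' c
  ... | refl with M-fun ms u' u
  ... | refl = refl

  level-top : ∀ {s x} → ¬ Σ ℕ (IsC s x) → level s x ≡ (lo s , hi s)
  level-top {s} {x} n with em {Σ ℕ (IsC s x)}
  ... | yes c = ⊥-elim (n c)
  ... | no _ = refl

  M-suc : ∀ {s : Str k} {c l} → IsMatching s → M s c l → Σ ℕ λ r → l ≡ suc r × c ≤ r
  M-suc {l = zero} ms u with () ← M-< ms u
  M-suc {l = suc r} ms u = r , refl , s≤s⁻¹ (M-< ms u)

  data Location (s : Str k) (x : ℕ) : Set where
    topmost : ¬ Σ ℕ (IsC s x) → Location s x
    within  : ∀ j r → IsC s x j → M s j (suc r) → x ≤ r → Location s x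

  locate : ∀ {s} → IsMatching s → ∀ x → Location s x
  locate {s} ms x with em {Σ ℕ (IsC s x)}
  ... | no n = topmost n
  ... | yes (j , c@(_ , _ , (l , u , x<l) , _)) with M-suc ms u
  ... | r , refl , _ = within j r c u (s≤s⁻¹ x<l)

  record IsLevel (s : Str k) (x : ℕ) (a : ℕ) (b : Bound) : Set where
    field
      a≤x  : a ≤ x
      x≤b  : x ≤B b
      sub⊆ : ∀ {q} → Dom (sub s a b) q → Dom s q
      open-edges : ∀ i j → M s i j → a ≤ i → i < x → x < j → ⊥

  is-level : ∀ {s} → IsMatching s → ∀ {x} → Dom s x → IsLevel s x (lower s x) (upper s x)
  is-level {s} ms {x} d with locate ms x
  ... | topmost n rewrite level-top {s} {x} n = record
        { a≤x = proj₁ d ; x≤b = proj₂ d ; sub⊆ = id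
        ; open-edges = λ i j u _ i<x x<j → let m , _ , c = encl⇒C {s = s} (i<x , j , u , x<j) in n (m , c) }
  ... | within j r c u x≤r rewrite level-C ms c u = record
        { a≤x = proj₁ (proj₂ c) ; x≤b = x≤r
        ; sub⊆ = λ (p , q) → dom-between ms (proj₁ u) (proj₁ (proj₂ u)) (<⇒≤ p) (m≤n⇒m≤1+n q)
        ; open-edges = λ i l v j<i i<x x<l → proj₂ (proj₂ (proj₂ c)) i l j<i i<x v x<l }

  -- Edges do not cross, so the blocks that enclose a matched call are those that enclose its
  -- return.
  level-return : ∀ {s c r} → IsMatching s → M s c r → level s r ≡ level s c
  level-return {s} {c} {r} ms u with locate ms c
  ... | topmost n = trans (level-top {s} {r} no-C) (sym (level-top {s} {c} n))
    where
    no-C : ¬ Σ ℕ (IsC s r)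
    no-C (j , _ , j<r , (l , v , r<l) , _) with <-cmp j c
    ... | tri< j<c _ _ = let m , _ , p = encl⇒C {s = s} (j<c , l , v , <-trans (M-< ms u) r<l) in n (m , p)
    ... | tri≈ _ refl _ = <⇒≢ r<l (M-fun ms u v)
    ... | tri> _ _ c<j = nocross ms u v c<j (<⇒≤ j<r) r<l
  ... | within j q (dj , j<c , _ , mx) v c≤q = trans (level-C ms isc v) (sym (level-C ms (dj , j<c , (suc q , v , s≤s c≤q) , mx) v))
    where
    r<sq : r < suc q
    r<sq with <-cmp r (suc q)
    ... | tri< lt _ _ = lt
    ... | tri≈ _ refl _ = ⊥-elim (<⇒≢ j<c (M-inj ms v u))
    ... | tri> _ _ gt = ⊥-elim (nocross ms v u j<c (m≤n⇒m≤1+n c≤q) gt)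
    isc : IsC s r j
    isc = dj , <-trans j<c (M-< ms u) , (suc q , v , r<sq) , greatest
      where
      greatest : ∀ j' l' → j < j' → j' < r → M s j' l' → r < l' → ⊥
      greatest j' l' j<j' j'<r w r<l' with <-cmp j' c
      ... | tri< lt _ _ = mx j' l' j<j' lt w (<-trans (M-< ms u) r<l')
      ... | tri≈ _ refl _ = <⇒≢ r<l' (M-fun ms u w)
      ... | tri> _ _ gt = nocross ms u w gt (<⇒≤ j'<r) r<l'

  retOf callOf : Str k → ℕ → ℕ
  retOf s c with em {Σ ℕ (M s c)}
  ... | yes (r , _) = r
  ... | no _ = 0
  callOf s r with em {MatchedRet s r}
  ... | yes (c , _) = c
  ... | no _ = 0

  retOf-≡ : ∀ {s c r} → IsMatching s → M s c r → retOf s c ≡ r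
  retOf-≡ {s} {c} ms u with em {Σ ℕ (M s c)}
  ... | yes (r , v) = M-fun ms v u
  ... | no n = ⊥-elim (n (_ , u))

  callOf-≡ : ∀ {s c r} → IsMatching s → M s c r → callOf s r ≡ c
  callOf-≡ {s} {c} {r} ms u with em {MatchedRet s r}
  ... | yes (c' , v) = M-inj ms v u
  ... | no n = ⊥-elim (n (_ , u))

  call-ret-adjacent : ∀ {s : Str k} → IsMatching s → ∀ {x} → Dom s x → Dom s (suc x) → callP s x → retP s (suc x) → M s x (suc x)
  call-ret-adjacent {s} ms {x} d d' c r with nest ms d d' (n≤1+n x) c r
  ... | l , p , q , inj₁ u = subst (M s x) (≤-antisym q (M-< ms u)) u
  ... | l , p , q , inj₂ u = subst (λ z → M s z (suc x)) (≤-antisym (s≤s⁻¹ (M-< ms u)) p) u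

  pAtReturn : ∀ {Q} → PDef MatchedRet Q → PDef MCall (λ s c → Q s (retOf s c))
  pAtReturn {Q} (φ , p) = nextμ φ , λ s o c d (r , u) → subst (λ z → Sat s (nextμ φ) c ⇔ Q s z) (sym (retOf-≡ (is-matching o) u))
    (mk⇔ (λ (r' , v , a) → to (p s o r (proj₁ (proj₂ u)) (c , u)) (subst (Sat s φ) (M-fun (is-matching o) v u) a))
         (λ q → r , u , from (p s o r (proj₁ (proj₂ u)) (c , u)) q))

  -- No operator leads back from a return to its call. The call of a return `x` is `x - 1` if that
  -- is a call, and otherwise C(x - 1), the innermost block still open there.
  pAtCall : ∀ {Q} → PDef MCall Q → PDef MatchedRet (λ s r → Q s (callOf s r))
  pAtCall {Q} (φ , p) = prev χ , spec
    where
    χ : CaRet k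
    χ = caseᶜ call φ (prevC φ)
    spec : ∀ s → Ok s → ∀ x → Dom s x → MatchedRet s x → Sat s (prev χ) x ⇔ Q s (callOf s x)
    spec s o x d (c , u) with M-suc (is-matching o) u
    ... | y , refl , c≤y = subst (λ z → Sat s (prev χ) (suc y) ⇔ Q s z) (sym (callOf-≡ ms u))
          (mk⇔ (λ { (_ , refl , _ , a) → a }) (λ a → y , refl , dy , a) ⇔∘ at-pred ⇔∘ p s o c (proj₁ u) (suc y , u))
      where
      ms : IsMatching s
      ms = is-matching o
      dy : Dom s y
      dy = dom-between ms (proj₁ u) d c≤y (n≤1+n y)
      at-pred : Sat s χ y ⇔ Sat s φ c
      at-pred with em {callP s y}
      ... | yes cy with M-inj ms (call-ret-adjacent ms dy d cy (M-ret ms u)) u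
      ... | refl = case-yes s y call φ (prevC φ) cy
      at-pred | no ncy = case-no s y call φ (prevC φ) ncy ⇔∘ prevC-yes s y φ
          (proj₁ u , c<y , (suc y , u , ≤-refl) , greatest)
        where
        c<y : c < y
        c<y = ≤∧≢⇒< c≤y λ { refl → ncy (M-call ms u) }
        greatest : ∀ j' l' → c < j' → j' < y → M s j' l' → y < l' → ⊥
        greatest j' l' c<j' j'<y v y<l' with m≤n⇒m<n∨m≡n y<l'
        ... | inj₂ refl = <⇒≢ c<j' (M-inj ms u v)
        ... | inj₁ lt = nocross ms u v c<j' (<⇒≤ (m<n⇒m<1+n j'<y)) lt

  no-marks : ∀ {j} → Marks j
  no-marks _ = replicate _ false

  AtStart : Str k → ℕ → Set
  AtStart s x = x ≡ lo s

  ValueDef : ∀ {j} → Algebra j → Set₁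
  ValueDef A = ∀ h → PDef AtStart (λ s _ → Algebra.val A s no-marks ≡ h)

  -- The value of a word with one mark, defined at the marked position.

  module Point {j} (A : Algebra (suc j)) (D : ValueDef A) where
    open Algebra A
    open MarkLaws A

    value : Str k → H
    value s = val s no-marks

    m₀ : Marks j
    m₀ = no-marks

    leftValue rightValue innerValue : Str k → ℕ → H
    leftValue s x = value (sub s (lower s x) (fin (pred x)))
    rightValue s x = value (sub s (suc x) (upper s x))
    innerValue s c = value (sub s (suc c) (fin (pred (retOf s c))))

    D-sat : ∀ h s → Ok s → Sat s (proj₁ (D h)) (lo s) ⇔ (value s ≡ h)
    D-sat h s o = proj₂ (D h) s o (lo s) (≤-refl , nonempty o) refl

    exceptLastD : H → CaRet k
    exceptLastD h = exceptLast (proj₁ (D h)) (ε ≡ h)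

    valueUpTo : ∀ s a n h → Ok (sub s a (fin (suc n))) → ¬ MatchedRet (sub s a (fin (suc n))) (suc n) →
                Sat (sub s a (fin (suc n))) (exceptLastD h) a ⇔ (value (sub s a (fin n)) ≡ h)
    valueUpTo s a n h o nr = exceptLast-sat s a n (proj₁ (D h)) (ε ≡ h) o nr
      (λ le → D-sat h (sub s a (fin n)) (ok-fin o (≤-refl , m≤n⇒m≤1+n le) (le , n≤1+n n) le))
      (λ nle → let e = val-empty (sub s a (fin n)) no-marks (λ q (p , p') → nle (≤-trans p p')) in
               mk⇔ (trans e) (trans (sym e)))

    -- C cuts out `[C(x), x]`, or `[lo, x]` if nothing encloses `x`, and the bounding positions have
    -- to go. Inside the cut C(x) is unmatched because its return lies beyond `x`, and `x` because
    -- it is no matched return.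
    left-def : ∀ h → PDef (λ s x → ¬ MatchedRet s x) (λ s x → leftValue s x ≡ h)
    left-def h = caseᶜ (prevC top) (Cop χ₁) (Cop χ₂) , spec
      where
      χ₁ χ₂ : CaRet k
      -- The default is never taken: C(x) precedes `x`, so a position remains after the first one is
      -- removed.
      χ₁ = exceptFirst (exceptLastD h) ⊥
      χ₂ = exceptLastD h
      spec : ∀ s → Ok s → ∀ x → Dom s x → ¬ MatchedRet s x →
             Sat s (caseᶜ (prevC top) (Cop χ₁) (Cop χ₂)) x ⇔ (leftValue s x ≡ h)
      spec s o zero d nr = ⊥-elim (<⇒≱ (≤-trans (positive o) (proj₁ d)) z≤n)
      spec s o x@(suc y) d nr with locate (is-matching o) x
      ... | topmost n rewrite level-top {s} {x} n = case-no s x (prevC top) (Cop χ₁) (Cop χ₂) (λ (j , c , _) → n (j , c)) ⇔∘ C-no s x χ₂ n ⇔∘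
              valueUpTo s (lo s) y h (ok-fin o dlo d (proj₁ d)) (λ (i , u) → nr (i , restrict {s} (in-fin {s} dlo d) u))
        where
        dlo : Dom s (lo s)
        dlo = ≤-refl , nonempty o
      ... | within j r c@(dj , j<x , _) u x≤r rewrite level-C (is-matching o) c u =
              case-yes s x (prevC top) (Cop χ₁) (Cop χ₂) (j , c , tt) ⇔∘ C-yes s x χ₁ c ⇔∘ exceptFirst-sat (sub s j (fin x)) (exceptLastD h) ⊥ (ok-fin o dj d (<⇒≤ j<x))
                (λ (l , v) → <⇒≱ (s≤s x≤r) (subst (_≤ x) (M-fun (is-matching o) (restrict {s} (in-fin {s} dj d) v) u) (proj₂ (proj₁ (proj₂ v)))))
                (λ _ → valueUpTo s (suc j) y h (ok-fin o dsj d j<x) (λ (i , v) → nr (i , restrict {s} (in-fin {s} dsj d) v)))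
                (λ n → ⊥-elim (n j<x))
        where
        dsj : Dom s (suc j)
        dsj = dom-between (is-matching o) dj d (n≤1+n j) j<x

    -- R ends the cut at the return of the enclosing block, so both ends are removed. With no
    -- enclosing block the cut runs to the end of the structure, possibly infinite, and only `x` is
    -- removed.
    right-def : ∀ h → PDef (λ s x → ¬ MCall s x) (λ s x → rightValue s x ≡ h)
    right-def h = caseᶜ (prevC top) (Rop χ₁) (Rop χ₂) , spec
      where
      χ₁ χ₂ : CaRet k
      χ₁ = exceptFirst (exceptLastD h) ⊥
      χ₂ = exceptFirst (proj₁ (D h)) (ε ≡ h)
      spec : ∀ s → Ok s → ∀ x → Dom s x → ¬ MCall s x →
             Sat s (caseᶜ (prevC top) (Rop χ₁) (Rop χ₂)) x ⇔ (rightValue s x ≡ h)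
      spec s o x d nc with locate (is-matching o) x
      ... | topmost n rewrite level-top {s} {x} n = case-no s x (prevC top) (Rop χ₁) (Rop χ₂) (λ (j , c , _) → n (j , c)) ⇔∘ R-no s x χ₂ (¬C⇒¬R {s = s} n) ⇔∘
              exceptFirst-sat (sub s x (hi s)) (proj₁ (D h)) (ε ≡ h) (ok-hi o d) (λ (l , u) → nc (l , restrict {s} (in-hi {s} d) u))
                (λ le → D-sat h (sub s (suc x) (hi s)) (ok-hi o (m≤n⇒m≤1+n (proj₁ d) , le)))
                (λ nle → let e = val-empty (sub s (suc x) (hi s)) no-marks (λ q (p , p') → nle (≤B-trans (hi s) p p')) in
                         mk⇔ (trans e) (trans (sym e)))
      ... | within j r c@(dj , j<x , _) u x≤r rewrite level-C (is-matching o) c u =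
              case-yes s x (prevC top) (Rop χ₁) (Rop χ₂) (j , c , tt) ⇔∘ R-yes s x χ₁ (C⇒R (is-matching o) c u) ⇔∘
              exceptFirst-sat (sub s x (fin (suc r))) (exceptLastD h) ⊥ (ok-fin o d dr (m≤n⇒m≤1+n x≤r)) (λ (l , v) → nc (l , restrict {s} (in-fin {s} d dr) v))
                (λ _ → valueUpTo s (suc x) r h (ok-fin o dsx dr (s≤s x≤r))
                  (λ (i , v) → <⇒≱ j<x (subst (x ≤_) (M-inj (is-matching o) (restrict {s} (in-fin {s} dsx dr) v) u) (<⇒≤ (proj₁ (proj₁ v))))))
                (λ n → ⊥-elim (n (s≤s x≤r)))
        where
        dr : Dom s (suc r)
        dr = proj₁ (proj₂ u)
        dsx : Dom s (suc x)
        dsx = dom-between (is-matching o) d dr (n≤1+n x) (s≤s x≤r)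

    -- R at `c + 1` ends at the return of `c`, unless `c + 1` is that return; then the interior is
    -- empty.
    inner-def : ∀ h → PDef MCall (λ s c → innerValue s c ≡ h)
    inner-def h = χ , spec
      where
      χ : CaRet k
      χ = caseᶜ (next ret) (constᶜ (ε ≡ h)) (next (Rop (exceptLastD h)))
      spec : ∀ s → Ok s → ∀ c → Dom s c → MCall s c →
             Sat s χ c ⇔ (innerValue s c ≡ h)
      spec s o c d (l , u) with M-suc (is-matching o) u
      ... | r , refl , c≤r rewrite retOf-≡ (is-matching o) u = go em
        where
        ms : IsMatching s
        ms = is-matching o
        dr : Dom s (suc r)
        dr = proj₁ (proj₂ u)
        dsc : Dom s (suc c)
        dsc = dom-between ms d dr (n≤1+n c) (s≤s c≤r)
        go : Dec (retP s (suc c)) → Sat s χ c ⇔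
             (value (sub s (suc c) (fin r)) ≡ h)
        go (yes rc) with M-fun ms u (call-ret-adjacent ms d dsc (M-call ms u) rc)
        ... | refl = case-yes s c (next ret) (constᶜ (ε ≡ h)) (next (Rop (exceptLastD h))) (dsc , rc) ⇔∘ const-sat (ε ≡ h) s c ⇔∘ mk⇔ (trans e) (trans (sym e))
          where
          e : value (sub s (suc c) (fin c)) ≡ ε
          e = val-empty (sub s (suc c) (fin c)) no-marks λ q (p , p') → <⇒≱ p p'
        go (no nrc) = case-no s c (next ret) (constᶜ (ε ≡ h)) (next (Rop (exceptLastD h))) (nrc ∘ proj₂) ⇔∘
            next-yes s c (Rop (exceptLastD h)) dsc ⇔∘ R-yes s (suc c) (exceptLastD h) isr ⇔∘
            valueUpTo s (suc c) r h (ok-fin o dsc dr (s≤s c≤r))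
              (λ (i , v) → <⇒≢ (proj₁ (proj₁ v)) (M-inj ms u (restrict {s} (in-fin {s} dsc dr) v)))
          where
          c<r : c < r
          c<r = ≤∧≢⇒< c≤r λ { refl → nrc (M-ret ms u) }
          isr : IsR s (suc c) (suc r)
          isr = dr , s≤s c<r , (c , u , ≤-refl) , least
            where
            least : ∀ l' j' → suc c < l' → l' < suc r → M s j' l' → j' < suc c → ⊥
            least l' j' a b v j'<sc with m≤n⇒m<n∨m≡n (s≤s⁻¹ j'<sc)
            ... | inj₂ refl = <⇒≢ b (M-fun ms v u)
            ... | inj₁ j'<c = nocross ms v u j'<c (<⇒≤ (<-trans (n<1+n c) a)) b

    label : Str k → ℕ → Letter j
    label s x = letterAt s m₀ x

    finite-Letter : Finite (Letter j)
    finite-Letter = finite-× (finite-Fin k) (finite-× finite-Bool (finite-× finite-Bool (finite-Vec finite-Bool j)))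

    label-def : ∀ {C} l → PDef C (λ s x → label s x ≡ l)
    label-def (a , b , c , v) = pConv
      (λ _ _ _ _ _ → mk⇔ (λ { (refl , refl , refl , refl) → refl }) (λ { refl → refl , refl , refl , refl }))
      (pAnd (lett a , λ _ _ _ _ _ → ⇔-refl)
        (pAnd (pBool (call , λ _ _ _ _ _ → ⇔-refl) b)
          (pAnd (pBool (ret , λ _ _ _ _ _ → ⇔-refl) c) (pConst (replicate j false ≡ v)))))

    -- One shape for three uses: `G` puts the mark on the call, or on the return, or, in `surround`,
    -- disregards the actual interior and inserts a given value for it.
    blockValue : (Letter j → Letter j → H → H) → Str k → ℕ → H
    blockValue G s c = leftValue s c · G (label s c) (label s (retOf s c)) (innerValue s c) · rightValue s (retOf s c)

    blockValue-def : ∀ G g → PDef MCall (λ s c → blockValue G s c ≡ g)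
    blockValue-def G g =
      pBind finite {leftValue} (λ h₁ s c → h₁ · G (label s c) (label s (retOf s c)) (innerValue s c) · rightValue s (retOf s c) ≡ g)
        (λ h → pWeaken (λ s o x (_ , u) (_ , v) → call≢ret (is-matching o) (proj₁ u) (M-call (is-matching o) u) (M-ret (is-matching o) v)) (left-def h)) λ h₁ →
      pBind finite-Letter {label} (λ x s c → h₁ · G x (label s (retOf s c)) (innerValue s c) · rightValue s (retOf s c) ≡ g) label-def λ x →
      pBind finite-Letter {λ s c → label s (retOf s c)} (λ y s c → h₁ · G x y (innerValue s c) · rightValue s (retOf s c) ≡ g)
        (λ l → pAtReturn {λ s r → label s r ≡ l} (label-def l)) λ y →
      pBind finite {innerValue} (λ h₂ s c → h₁ · G x y h₂ · rightValue s (retOf s c) ≡ g) inner-def λ h₂ →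
      pBind finite {λ s c → rightValue s (retOf s c)} (λ h₃ s c → h₁ · G x y h₂ · h₃ ≡ g)
        (λ h → pAtReturn {λ s r → rightValue s r ≡ h}
          (pWeaken (λ s o x (_ , v) (_ , u) → call≢ret (is-matching o) (proj₁ u) (M-call (is-matching o) u) (M-ret (is-matching o) v)) (right-def h))) λ h₃ →
      pConst (h₁ · G x y h₂ · h₃ ≡ g)

    Unmatched : Str k → ℕ → Set
    Unmatched s x = ¬ MCall s x × ¬ MatchedRet s x

    letterValue : Str k → ℕ → H
    letterValue s x = leftValue s x · letter (extend true (label s x)) · rightValue s x

    letterValue-def : ∀ g → PDef Unmatched (λ s x → letterValue s x ≡ g)
    letterValue-def g =
      pBind finite {leftValue} (λ h₁ s x → h₁ · letter (extend true (label s x)) · rightValue s x ≡ g) (λ h → pWeaken (λ _ _ _ → proj₂) (left-def h)) λ h₁ →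
      pBind finite-Letter {label} (λ l s x → h₁ · letter (extend true l) · rightValue s x ≡ g) label-def λ l →
      pBind finite {rightValue} (λ h₂ s x → h₁ · letter (extend true l) · h₂ ≡ g) (λ h → pWeaken (λ _ _ _ → proj₁) (right-def h)) λ h₂ →
      pConst (h₁ · letter (extend true l) · h₂ ≡ g)

    surround : Str k → ℕ → H → H
    surround s c h = blockValue (λ x y _ → F (extend false x) (extend false y) h) s c

    Context : Set₁
    Context = Σ (H → H) Good

    context : Str k → ℕ → Context
    context s c = surround s c , good-∘ (good-L _) (good-∘ (good-R _) (good-F _ _))

    monodromy : Monodromy Context H
    monodromy = record { act = proj₁ ; Good = Good ; good-id = good-id ; good-∘ = good-∘ ; good-act = proj₂ ; aper = aper }
    open Monodromy monodromy using (run; headAct)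

    -- The word to which Kamp's theorem is applied: the contexts of the enclosing calls, innermost
    -- first, the order in which `run` applies them. Its proper suffixes are the chains of these
    -- calls themselves, so `prevC` moves to the tail.
    data Chain (s : Str k) : ℕ → List Context → Set₁ where
      root : ∀ {x} → ¬ Σ ℕ (IsC s x) → Chain s x []
      up   : ∀ {x c l} → IsC s x c → Chain s c l → Chain s x (context s c ∷ l)

    chain : ∀ s x → Σ (List Context) (Chain s x)
    chain s x = go x x ≤-refl
      where
      go : ∀ n x → x ≤ n → Σ (List Context) (Chain s x)
      go n x x≤n with em {Σ ℕ (IsC s x)}
      go n x x≤n | no ¬c = [] , root ¬c
      go zero x x≤n | yes (_ , _ , c<x , _) = ⊥-elim (<⇒≱ c<x (≤-trans x≤n z≤n))
      go (suc n) x x≤n | yes (c , isc@(_ , c<x , _)) with go n c (s≤s⁻¹ (≤-trans c<x x≤n))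
      ... | l , ch = context s c ∷ l , up isc ch

    ChainDef : (List Context → Set) → Set₁
    ChainDef B = Σ (CaRet k) λ φ → ∀ s → Ok s → ∀ x → Dom s x → ∀ {l} → Chain s x l → Sat s φ x ⇔ B l

    closed : Closed ChainDef
    closed = record
      { d-ext = λ e (φ , p) → φ , λ s o x d {l} ch → p s o x d ch ⇔∘ e l
      ; d-true = top , λ _ _ _ _ _ → ⇔-refl
      ; d-not = λ (φ , p) → neg φ , λ s o x d ch → ¬-cong (p s o x d ch)
      ; d-or = λ (φ , p) (ψ , q) → φ or ψ , λ s o x d ch → p s o x d ch ⊎-⇔ q s o x d ch
      ; d-tail = λ {B} (φ , p) → prevC φ , λ s o x d → λ
          { (root n) → mk⇔ (λ (j , c , _) → ⊥-elim (n (j , c))) ⊥-elim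
          ; (up c ch) → prevC-yes s x φ c ⇔∘ p s o _ (proj₁ c) ch }
      ; d-until = λ (φ , p) (ψ , q) → φ Sc ψ , λ s o x d ch → mk⇔ (fwd φ ψ p q s o d ch) (bwd φ ψ p q s o d ch) }
      where
      module _ {B C : List Context → Set} (φ ψ : CaRet k)
               (p : ∀ s → Ok s → ∀ x → Dom s x → ∀ {l} → Chain s x l → Sat s φ x ⇔ B l)
               (q : ∀ s → Ok s → ∀ x → Dom s x → ∀ {l} → Chain s x l → Sat s ψ x ⇔ C l) (s : Str k) (o : Ok s) where
        fwd : ∀ {x} → Dom s x → ∀ {l} → Chain s x l → Sat s (φ Sc ψ) x → until B C l
        fwd d ch@(root n) (here c) = to (q s o _ d ch) c
        fwd d (root n) (there _ c _) = ⊥-elim (n (_ , c))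
        fwd d ch@(up _ _) (here c) = inj₁ (to (q s o _ d ch) c)
        fwd d ch@(up c ch') (there b c' u) with C-unique {s = s} c' c
        ... | refl = inj₂ (to (p s o _ d ch) b , fwd (proj₁ c) ch' u)
        bwd : ∀ {x} → Dom s x → ∀ {l} → Chain s x l → until B C l → Sat s (φ Sc ψ) x
        bwd d ch@(root n) c = here (from (q s o _ d ch) c)
        bwd d ch@(up _ _) (inj₁ c) = here (from (q s o _ d ch) c)
        bwd d ch@(up c ch') (inj₂ (b , u)) = there (from (p s o _ d ch) b) c (bwd (proj₁ c) ch' u)

    head-def : ∀ p q → ChainDef (λ l → headAct l p ≡ q)
    head-def p q = χ , λ s o x d → λ
        { (root n) → case-no s x (prevC top) (prevC (proj₁ β)) (constᶜ (p ≡ q)) (λ (j , c , _) → n (j , c)) ⇔∘ const-sat (p ≡ q) s x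
        ; (up {c = c} isc@(dc , _ , (r , u , _) , _) ch) →
            case-yes s x (prevC top) (prevC (proj₁ β)) (constᶜ (p ≡ q)) (c , isc , tt) ⇔∘ prevC-yes s x (proj₁ β) isc ⇔∘
            proj₂ β s o c dc (r , u) }
      where
      β : PDef MCall (λ s c → surround s c p ≡ q)
      β = blockValue-def (λ x y _ → F (extend false x) (extend false y) p) q
      χ : CaRet k
      χ = caseᶜ (prevC top) (prevC (proj₁ β)) (constᶜ (p ≡ q))

    Always : Str k → ℕ → Set
    Always _ _ = ⊤

    climbed : Str k → ℕ → H → H
    climbed s x = run (proj₁ (chain s x))

    climbed-def : ∀ h g → PDef Always (λ s x → climbed s x h ≡ g)
    climbed-def h g = proj₁ ρ , λ s o x d _ → proj₂ ρ s o x d (proj₂ (chain s x))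
      where
      ρ : ChainDef (λ l → run l h ≡ g)
      ρ = run-def monodromy finite closed head-def h g

    -- Intended for the two ends of a block or for a single unmatched position. No edge of the level
    -- crosses the place before `x₀` or the place after `x₁`.
    split-level : ∀ {s x₀ x₁ a b p} → Ok s → Dom s x₀ → IsLevel s x₀ a b → IsLevel s x₁ a b →
      ¬ MatchedRet s x₀ → ¬ MCall s x₁ → x₀ ≤ p → p ≤ x₁ →
      val (sub s a b) (mark p m₀) ≡
        value (sub s a (fin (pred x₀))) · val (sub s x₀ (fin x₁)) (mark p m₀) · value (sub s (suc x₁) b)
    split-level {s} {zero} o d = ⊥-elim (<⇒≱ (≤-trans (positive o) (proj₁ d)) z≤n)
    split-level {s} {suc y} {x₁} {a} {b} {p} o d L₀ L₁ nr nc y<p p≤x₁ = begin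
      val t (mark p m₀)
        ≡⟨ val-concat t (mark p m₀) y (sub-matching L₀.sub⊆ ms) L₀.a≤x (≤B-trans b (n≤1+n y) L₀.x≤b) cut₀ ⟩
      val (sub s a (fin y)) (mark p m₀) · val t' (mark p m₀)
        ≡⟨ cong₂ _·_ (val-away (sub s a (fin y)) m₀ (λ (_ , le) → <⇒≱ y<p le))
             (val-concat t' (mark p m₀) x₁ (sub-matching inc' ms) (≤-trans (≤-trans y<p p≤x₁) (n≤1+n x₁)) L₁.x≤b cut₁) ⟩
      value (sub s a (fin y)) · val (sub s (suc y) (fin x₁)) (mark p m₀) · val (sub s (suc x₁) b) (mark p m₀)
        ≡⟨ cong (λ z → value (sub s a (fin y)) · val (sub s (suc y) (fin x₁)) (mark p m₀) · z)
             (val-away (sub s (suc x₁) b) m₀ (λ (le , _) → <⇒≱ le p≤x₁)) ⟩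
      value (sub s a (fin y)) · val (sub s (suc y) (fin x₁)) (mark p m₀) · value (sub s (suc x₁) b) ∎
      where
      open ≡-Reasoning
      module L₀ = IsLevel L₀
      module L₁ = IsLevel L₁
      ms : IsMatching s
      ms = is-matching o
      t t' : Str k
      t = sub s a b
      t' = sub s (suc y) b
      inc' : ∀ {q} → Dom t' q → Dom s q
      inc' (le , le') = L₀.sub⊆ (≤-trans L₀.a≤x le , le')
      cut₀ : ∀ i l → M t i l → i ≤ y → y < l → ⊥
      cut₀ i l u i≤y y<l with m≤n⇒m<n∨m≡n y<l
      ... | inj₂ refl = nr (i , restrict {s} L₀.sub⊆ u)
      ... | inj₁ lt = L₀.open-edges i l (restrict {s} L₀.sub⊆ u) (proj₁ (proj₁ u)) (s≤s i≤y) lt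
      cut₁ : ∀ i l → M t' i l → i ≤ x₁ → x₁ < l → ⊥
      cut₁ i l u i≤x₁ x₁<l with m≤n⇒m<n∨m≡n i≤x₁
      ... | inj₂ refl = nc (l , restrict {s} inc' u)
      ... | inj₁ lt = L₁.open-edges i l (restrict {s} inc' u) (≤-trans L₀.a≤x (proj₁ (proj₁ u))) lt x₁<l

    levelOf : Str k → ℕ → Str k
    levelOf s x = sub s (lower s x) (upper s x)

    module Block {s : Str k} (o : Ok s) {c r : ℕ} (u : M s c (suc r)) where
      private
        ms = is-matching o
        t = sub s c (fin (suc r))

      inc : ∀ {q} → Dom t q → Dom s q
      inc = in-fin {s} (proj₁ u) (proj₁ (proj₂ u))

      block-matching : IsMatching t
      block-matching = sub-matching inc ms

      block-edge : M t c (suc r)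
      block-edge = (≤-refl , <⇒≤ (M-< ms u)) , (<⇒≤ (M-< ms u) , ≤-refl) , proj₂ (proj₂ u)

      level-c : IsLevel s c (lower s c) (upper s c)
      level-c = is-level ms (proj₁ u)

      level-r : IsLevel s (suc r) (lower s c) (upper s c)
      level-r = subst (λ l → IsLevel s (suc r) (proj₁ l) (proj₂ l)) (level-return ms u) (is-level ms (proj₁ (proj₂ u)))

      split-block : ∀ {p} → c ≤ p → p ≤ suc r →
        val (levelOf s c) (mark p m₀) ≡ leftValue s c · val t (mark p m₀) · rightValue s (suc r)
      split-block {p} c≤p p≤r = trans
        (split-level o (proj₁ u) level-c level-r
          (λ (_ , v) → call≢ret ms (proj₁ u) (M-call ms u) (M-ret ms v))
          (λ (_ , v) → call≢ret ms (proj₁ v) (M-call ms v) (M-ret ms u)) c≤p p≤r)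
        (cong (λ b → leftValue s c · val t (mark p m₀) · value (sub s (suc (suc r)) b)) (sym (cong proj₂ (level-return ms u))))

      blockValue-≡ : ∀ G → blockValue G s c ≡
        leftValue s c · G (label s c) (label s (suc r)) (value (sub s (suc c) (fin r))) · rightValue s (suc r)
      blockValue-≡ G rewrite retOf-≡ ms u = refl

      in-block : ∀ {p} G → c ≤ p → p ≤ suc r →
        val t (mark p m₀) ≡ G (label s c) (label s (suc r)) (value (sub s (suc c) (fin r))) →
        val (levelOf s c) (mark p m₀) ≡ blockValue G s c
      in-block G c≤p p≤r e = trans (split-block c≤p p≤r)
        (trans (cong (λ z → leftValue s c · z · rightValue s (suc r)) e) (sym (blockValue-≡ G)))

    -- If a block encloses `x`, the level of `x` is the interior of the innermost one. Its call and
    -- return and the siblings of that block complete it to the level of the call, and this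
    -- completion is what `surround` computes.
    climb : ∀ {s x l p} → Ok s → Chain s x l → lower s x ≤ p → p ≤B upper s x →
            val s (mark p m₀) ≡ run l (val (levelOf s x) (mark p m₀))
    climb {s} {x} o (root n) _ _ rewrite level-top {s} {x} n = refl
    climb {s} {x} {p = p} o (up {c = c} {l} isc@(dc , _ , (_ , u , _) , _) ch) a≤p p≤b with M-suc (is-matching o) u
    ... | r , refl , c≤r rewrite level-C (is-matching o) isc u =
      trans (climb o ch (≤-trans (IsLevel.a≤x level-c) (<⇒≤ a≤p)) (≤B-trans (upper s c) (m≤n⇒m≤1+n p≤b) (IsLevel.x≤b level-r)))
        (cong (run l) (in-block (λ x y _ → F (extend false x) (extend false y) (val (sub s (suc c) (fin r)) (mark p m₀)))
          (<⇒≤ a≤p) (m≤n⇒m≤1+n p≤b) (block-inside s m₀ c r block-matching block-edge (a≤p , p≤b))))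
      where
      open Block o u

    openMap closeMap : Letter j → Letter j → H → H
    openMap x y = F (extend true x) (extend false y)
    closeMap x y = F (extend false x) (extend true y)

    at-call : ∀ {s c} → Ok s → MCall s c → val s (mark c m₀) ≡ climbed s c (blockValue openMap s c)
    at-call {s} {c} o (_ , u) with M-suc (is-matching o) u
    ... | r , refl , c≤r = trans (climb o (proj₂ (chain s c)) (IsLevel.a≤x level-c) (IsLevel.x≤b level-c))
            (cong (climbed s c) (in-block openMap ≤-refl (m≤n⇒m≤1+n c≤r) (block-open s m₀ c r block-matching block-edge)))
      where open Block o u

    at-return : ∀ {s c r} → Ok s → M s c r → val s (mark r m₀) ≡ climbed s c (blockValue closeMap s c)
    at-return {s} {c} o u with M-suc (is-matching o) u
    ... | r , refl , c≤r = trans (climb o (proj₂ (chain s c)) (IsLevel.a≤x level-r) (IsLevel.x≤b level-r))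
            (cong (climbed s c) (in-block closeMap (m≤n⇒m≤1+n c≤r) ≤-refl (block-close s m₀ c r block-matching block-edge)))
      where open Block o u

    at-unmatched : ∀ {s x} → Ok s → Dom s x → Unmatched s x → val s (mark x m₀) ≡ climbed s x (letterValue s x)
    at-unmatched {s} {x} o d (nc , nr) = trans (climb o (proj₂ (chain s x)) (IsLevel.a≤x L) (IsLevel.x≤b L))
      (cong (climbed s x) (trans (split-level o d L L nr nc ≤-refl ≤-refl)
        (cong (λ z → leftValue s x · z · rightValue s x)
          (trans (val-letter s (mark x m₀) x (sub-matching (in-fin {s} d d) (is-matching o))) (cong letter (letterAt-here s m₀ x))))))
      where
      L : IsLevel s x (lower s x) (upper s x)
      L = is-level (is-matching o) d

    mcall-def : PDef Always MCall
    mcall-def = nextμ top , λ _ _ _ _ _ → mk⇔ (λ (r , u , _) → r , u) (λ (r , u) → r , u , tt)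

    mret-def : PDef Always MatchedRet
    mret-def = ret andᶜ neg pret , λ s o x d _ → ⇔-sym ×-from-⊎ ⇔∘ mk⇔
      (λ (r , n) → dne λ m → n (d , r , m)) (λ (c , u) → M-ret (is-matching o) u , λ (_ , _ , m) → m (c , u))

    -- A marked return is treated at its call, where the whole block is accessible and the level is
    -- the same; `pAtCall` brings the formula back to the return.
    point-def : ∀ g → PDef Always (λ s x → val s (mark x m₀) ≡ g)
    point-def g = pCase mcall-def (pWeaken (λ _ _ _ → proj₂) call-def)
      (pCase (pWeaken _ mret-def) (pWeaken (λ _ _ _ → proj₂) ret-def) (pWeaken (λ _ _ _ ((_ , nc) , nr) → nc , nr) unmatched-def))
      where
      through : ∀ {C f} → (∀ h → PDef C (λ s x → f s x ≡ h)) → PDef C (λ s x → climbed s x (f s x) ≡ g)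
      through {f = f} df = pBind finite {f} (λ h s x → climbed s x h ≡ g) df (λ h → pWeaken _ (climbed-def h g))
      call-def : PDef MCall (λ s x → val s (mark x m₀) ≡ g)
      call-def = pConv (λ s o x d m → let e = at-call o m in mk⇔ (trans e) (trans (sym e))) (through (blockValue-def openMap))
      at-ret : PDef MCall (λ s c → climbed s c (blockValue closeMap s c) ≡ g)
      at-ret = through (blockValue-def closeMap)
      ret-def : PDef MatchedRet (λ s x → val s (mark x m₀) ≡ g)
      ret-def = pConv (λ s o x d (c , u) → let e = trans (at-return o u) (cong (λ z → climbed s z (blockValue closeMap s z)) (sym (callOf-≡ (is-matching o) u)))
                        in mk⇔ (trans e) (trans (sym e)))
                      (pAtCall {λ s c → climbed s c (blockValue closeMap s c) ≡ g} at-ret)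
      unmatched-def : PDef Unmatched (λ s x → val s (mark x m₀) ≡ g)
      unmatched-def = pConv (λ s o x d m → let e = at-unmatched o d m in mk⇔ (trans e) (trans (sym e))) (through letterValue-def)

  -- From first-order formulas to algebras.

  marks : ∀ {n} → Vector ℕ n → Marks n
  marks ρ q = tabulate λ i → does (q ≟ ρ i)

  marked : ∀ {n} (ρ : Vector ℕ n) i → lookup (marks ρ (ρ i)) i ≡ true
  marked ρ i = trans (lookup∘tabulate _ i) (dec-true (ρ i ≟ ρ i) refl)

  marked⇒≡ : ∀ {n} (ρ : Vector ℕ n) i {q} → lookup (marks ρ q) i ≡ true → q ≡ ρ i
  marked⇒≡ ρ i {q} e = ≡ᵇ⇒≡ q (ρ i) (from T-≡ (trans (sym (lookup∘tabulate (λ i → does (q ≟ ρ i)) i)) e))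

  record Recogniser {n} (φ : FO k n) : Set₂ where
    field
      algebra  : Algebra n
      valueDef : ValueDef algebra
    open Algebra algebra
    field
      Accepts  : H → Set
      correct  : ∀ s → IsMatching s → ∀ ρ → (∀ i → Dom s (ρ i)) → FOSat s ρ φ ⇔ Accepts (val s (marks ρ))

  module _ {n} (α β γ : Letter n → Bool) (δ : Letter n → Letter n → Bool) where
    open Atomic α β γ δ

    -- An atomic formula tests only the positions of its variables, so its tests fail on unmarked
    -- letters and every unmarked word has the same value. This starts the induction.
    Blind : (Letter n → Bool) → Set
    Blind t = ∀ a b c → t (a , b , c , replicate n false) ≡ false

    atomicDef : Blind α → Blind β → Blind γ → (∀ a b c l → δ (a , b , c , replicate n false) l ≡ false) → ValueDef atomic
    atomicDef bα bβ bγ bδ h = pConv (λ s _ _ _ _ → let e = trivial s in mk⇔ (trans e) (trans (sym e))) (pConst ((false , false , false) ≡ h))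
      where
      absurd : ∀ {b} → b ≡ false → ¬ b ≡ true
      absurd refl ()
      none : ∀ t → Blind t → ∀ s → ¬ Has t s no-marks
      none t b s (_ , _ , e) = absurd (b _ _ _) e
      trivial : ∀ s → val s no-marks ≡ (false , false , false)
      trivial s = cong₂ flag (⇒dec-false λ (_ , _ , _ , e) → absurd (bδ _ _ _ _) e)
        (triple (⇒dec-false (none α bα s)) (⇒dec-false (none β bβ s))
          (⇒dec-false [ none γ bγ s , (λ (_ , _ , _ , _ , _ , e , _) → absurd (bα _ _ _) e) ]′))

    atomicRecogniser : ∀ {φ} → Blind α → Blind β → Blind γ → (∀ a b c l → δ (a , b , c , replicate n false) l ≡ false) →
      (∀ s → IsMatching s → ∀ ρ → (∀ i → Dom s (ρ i)) →
        FOSat s ρ φ ⇔ ((Has γ s (marks ρ) ⊎ Pair s (marks ρ)) ⊎ Arc s (marks ρ))) → Recogniser φ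
    atomicRecogniser bα bβ bγ bδ c = record
      { algebra = atomic ; valueDef = atomicDef bα bβ bγ bδ ; Accepts = λ h → proj₂ (proj₂ h) ≡ true
      ; correct = λ s ms ρ d → c s ms ρ d ⇔∘ ⇔-sym (val-third s (marks ρ)) }

  never : ∀ {A : Set} → A → Bool
  never _ = false

  blank : ∀ {A B C : Set} → A → B → C → false ≡ false
  blank _ _ _ = refl

  at : ∀ {n} → Fin n → Letter n → Bool
  at x (_ , _ , _ , v) = lookup v x

  unaryRecogniser : ∀ {n φ} (x : Fin n) (t : Letter n → Bool) →
    (∀ s ρ → FOSat s ρ φ ⇔ (t (letterAt s (marks ρ) (ρ x)) ≡ true)) → Recogniser φ
  unaryRecogniser {n} x t e = atomicRecogniser never never γ (λ _ → never) blank blank blind (λ _ → blank) λ s ms ρ d →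
    e s ρ ⇔∘ mk⇔ (λ a → inj₁ (inj₁ (ρ x , d x , cong₂ _∧_ a (marked ρ x))))
      (λ { (inj₁ (inj₁ (p , _ , a))) → subst (λ q → t (letterAt s (marks ρ) q) ≡ true)
               (marked⇒≡ ρ x (∧-conicalʳ (t (letterAt s (marks ρ) p)) _ a)) (∧-conicalˡ _ _ a)
         ; (inj₁ (inj₂ (_ , _ , _ , _ , _ , () , _))) ; (inj₂ (_ , _ , _ , ())) })
    where
    γ : Letter n → Bool
    γ l = t l ∧ at x l
    blind : ∀ a b c → γ (a , b , c , replicate n false) ≡ false
    blind a b c = trans (cong (t (a , b , c , replicate n false) ∧_) (lookup-replicate x false)) (∧-zeroʳ _)

  at-blind : ∀ {n} (x : Fin n) a b c → at x (a , b , c , replicate n false) ≡ false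
  at-blind x _ _ _ = lookup-replicate x false

  ≺-recogniser : ∀ {n} (x y : Fin n) → Recogniser (x ≺ y)
  ≺-recogniser x y = atomicRecogniser (at x) (at y) never (λ _ → never) (at-blind x) (at-blind y) blank (λ _ → blank) λ s ms ρ d → mk⇔
    (λ lt → inj₁ (inj₂ (ρ x , ρ y , d x , d y , lt , marked ρ x , marked ρ y)))
    (λ { (inj₁ (inj₂ (p , q , _ , _ , lt , a , b))) → subst₂ _<_ (marked⇒≡ ρ x a) (marked⇒≡ ρ y b) lt
       ; (inj₁ (inj₁ (_ , _ , ()))) ; (inj₂ (_ , _ , _ , ())) })

  mu-recogniser : ∀ {n} (x y : Fin n) → Recogniser (muF x y)
  mu-recogniser x y = atomicRecogniser never never never (λ l r → at x l ∧ at y r) blank blank blank (λ a b c _ → cong (_∧ _) (at-blind x a b c)) λ s ms ρ d → mk⇔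
    (λ u → inj₂ (ρ x , ρ y , (d x , d y , u) , cong₂ _∧_ (marked ρ x) (marked ρ y)))
    (λ { (inj₂ (c , r , (_ , _ , u) , a)) → subst₂ (mu s) (marked⇒≡ ρ x (∧-conicalˡ _ _ a))
             (marked⇒≡ ρ y (∧-conicalʳ (lookup (marks ρ c) x) _ a)) u
       ; (inj₁ (inj₁ (_ , _ , ()))) ; (inj₁ (inj₂ (_ , _ , _ , _ , _ , () , _))) })

  module _ {j} (A : Algebra (suc j)) (D : ValueDef A) where
    open Exists A
    open Algebra A
    open Power finite
    open Point A D

    Attained : H → Str k → ℕ → Set
    Attained g s _ = Σ ℕ λ p → Dom s p × val s (mark p m₀) ≡ g

    -- From the first position `top U` reaches every position, and so quantifies over the place of
    -- the mark.
    attained-def : ∀ g → PDef AtStart (Attained g)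
    attained-def g = (top U proj₁ (point-def g)) , λ { s o _ d refl → eventually s (proj₁ (point-def g)) d ⇔∘ mk⇔
      (λ (q , _ , dq , a) → q , dq , to (proj₂ (point-def g) s o q dq tt) a)
      (λ (q , dq , a) → q , proj₁ dq , dq , from (proj₂ (point-def g) s o q dq tt) a) }

    attained-iff : ∀ g B → PDef AtStart (λ s x → Attained g s x ⇔ B)
    attained-iff g B with em {B}
    ... | yes b = pConv (λ _ _ _ _ _ → mk⇔ (λ a → mk⇔ (λ _ → b) (λ _ → a)) (λ e → from e b)) (attained-def g)
    ... | no ¬b = pConv (λ _ _ _ _ _ → mk⇔ (λ n → mk⇔ (⊥-elim ∘ n) (⊥-elim ∘ ¬b)) (λ e a → ¬b (to e a))) (pNot (attained-def g))

    attained-all : ∀ X → PDef AtStart (λ s x → ∀ g → Attained g s x ⇔ (g ∈ₚ X))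
    attained-all X = pConv (λ _ _ _ _ _ → mk⇔ (λ f g → f g (complete finite g)) (λ f g _ → f g)) (go (elements finite))
      where
      go : ∀ xs → PDef AtStart (λ s x → ∀ g → g ∈ xs → Attained g s x ⇔ (g ∈ₚ X))
      go [] = pConv (λ _ _ _ _ _ → mk⇔ (λ _ _ ()) (λ _ → tt)) (pConst ⊤)
      go (x ∷ xs) = pConv (λ _ _ _ _ _ → mk⇔ (λ { (e , _) _ (here refl) → e ; (_ , f) g (there m) → f g m })
                                               (λ f → f x (here refl) , λ g m → f g (there m)))
                          (pAnd (attained-iff x (x ∈ₚ X)) (go xs))

    existsDef : ValueDef existsAlgebra
    existsDef (h , X) = pConv (λ s _ x _ _ → mk⇔
        (λ (e , c , f) → cong₂ _,_ e (trans (⟪⟫-cong f) (sym c)))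
        (λ { refl → refl , ⟪⟫-cong (λ g → ⇔-sym ∈-⟪⟫) , λ g → ⇔-sym ∈-⟪⟫ }))
      -- Values are canonical vectors. The constant conjunct rejects any other `X`, for which equal
      -- members would not give equality.
      (pAnd (D h) (pAnd (pConst (X ≡ ⟪ (λ g → g ∈ₚ X) ⟫)) (attained-all X)))

  recognise : ∀ {n} (φ : FO k n) → Recogniser φ
  recognise (P a x) = unaryRecogniser x (λ (b , _) → dec (b ≡ a)) λ s ρ → mk⇔ ⇒dec dec⇒
  recognise (x ≐ y) = unaryRecogniser x (at y) λ s ρ → mk⇔
    (λ e → subst (λ q → lookup (marks ρ q) y ≡ true) (sym e) (marked ρ y)) (marked⇒≡ ρ y)
  recognise (callF x) = unaryRecogniser x (λ (_ , b , _) → b) λ s ρ → mk⇔ ⇒dec dec⇒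
  recognise (retF x) = unaryRecogniser x (λ (_ , _ , b , _) → b) λ s ρ → mk⇔ ⇒dec dec⇒
  recognise (x ≺ y) = ≺-recogniser x y
  recognise (muF x y) = mu-recogniser x y
  recognise (negF φ) = record { Recogniser R ; Accepts = λ h → ¬ Recogniser.Accepts R h
                              ; correct = λ s ms ρ d → ¬-cong (Recogniser.correct R s ms ρ d) }
    where
    R : Recogniser φ
    R = recognise φ
  recognise (φ orF ψ) = record
    { algebra = Product.productAlgebra R.algebra S.algebra
    ; valueDef = λ (h , g) → pConv (λ _ _ _ _ _ → mk⇔ (λ (e , e') → cong₂ _,_ e e') (λ e → cong proj₁ e , cong proj₂ e))
                                   (pAnd (R.valueDef h) (S.valueDef g))
    ; Accepts = λ (h , g) → R.Accepts h ⊎ S.Accepts g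
    ; correct = λ s ms ρ d → R.correct s ms ρ d ⊎-⇔ S.correct s ms ρ d }
    where
    module R = Recogniser (recognise φ)
    module S = Recogniser (recognise ψ)
  recognise (exF φ) = record
    { algebra = Exists.existsAlgebra R.algebra
    ; valueDef = existsDef R.algebra R.valueDef
    ; Accepts = λ (_ , X) → Σ (Algebra.H R.algebra) λ g → g ∈ₚ X × R.Accepts g
    ; correct = λ s ms ρ d → mk⇔
        -- `marks (p ∷ᵛ ρ)` is `mark p (marks ρ)` by computation, so the bound variable is the extra
        -- mark.
        (λ (p , dp , a) → _ , from ∈-⟪⟫ (p , dp , refl) , to (R.correct s ms (p ∷ᵛ ρ) (dom-∷ {s = s} {ρ} d dp)) a)
        (λ (g , m , a) → let p , dp , e = to ∈-⟪⟫ m in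
          p , dp , from (R.correct s ms (p ∷ᵛ ρ) (dom-∷ {s = s} {ρ} d dp)) (subst R.Accepts (sym e) a)) }
    where
    module R = Recogniser (recognise φ)
    open Power (Algebra.finite R.algebra)

  -- The free variable is the single mark, and `point-def` gives the value of the word with this
  -- mark at any position, not only the first.
  toCaRet : (ψ : FO k 1) → PDef (λ _ _ → ⊤) (λ s i → FOSat s (λ _ → i) ψ)
  toCaRet ψ = pConv (λ s o x d _ → ⇔-sym (R.correct s (Ok.is-matching o) (λ _ → x) (λ _ → d)))
    (pBind (Algebra.finite R.algebra) (λ g _ _ → R.Accepts g) (Point.point-def R.algebra R.valueDef) (λ g → pConst (R.Accepts g)))
    where
    module R = Recogniser (recognise ψ)

theorem4p13 : ExcludedMiddle 0ℓ → (k : ℕ) →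
    ((φ : CaRet k) → Σ (FO k 1) (λ φ' → (w : NestedWord k) (i : ℕ) → Dom (str w) i →
    Sat (str w) φ i ⇔ FOSat (str w) (λ _ → i) φ'))
    ×
    ((ψ : FO k 1) → Σ (CaRet k) (λ ψ' → (w : NestedWord k) (i : ℕ) → Dom (str w) i →
    FOSat (str w) (λ _ → i) ψ ⇔ Sat (str w) ψ' i))
theorem4p13 em k =
  (λ φ → let φ' , p = ToFO.toFO em k φ (ToFO.whole em k) zero in φ' , λ w i d →
     mk⇔ (d ,_) proj₂ ⇔∘ p (str w) (matching w) (λ _ → i) (λ _ → d)) ,
  (λ ψ → let ψ' , p = ToCaRet.toCaRet em k ψ in ψ' , λ w i d → mk⇔
     (from (p (str w) (ToCaRet.ok (matching w) (≤-reflexive (sym (lo≡1 w))) (≤B-trans (hi (str w)) (proj₁ d) (proj₂ d))) i d tt))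
     (to (p (str w) (ToCaRet.ok (matching w) (≤-reflexive (sym (lo≡1 w))) (≤B-trans (hi (str w)) (proj₁ d) (proj₂ d))) i d tt)))
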